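{- Let $S = \{s_1, \ldots, s_n\}$ be a set of segments in $\mathbb{R}^3$, affinely spanning $\mathbb{R}^3$. If $S$ is antipodal, then $n \leq 4$; if $S$ is strictly antipodal, then $n \leq 3$. For the antipodal case we have equality ($n=4$) if and only if the segments are subsegments of some four parallel edges of a parallelepiped (one of each), or they are subsegments of two parallel edges of a face of a parallelepiped, and of two parallel edges of the opposite face of the parallelepiped, which are not parallel to the first two edges (one of each). For the strictly antipodal case we have equality ($n=3$) if and only if the segments are subsegments of the three lateral edges of a triangular prism (one of each), or they are subsegments of the relative interiors of three mutually skew edges of a parallelepiped (one of each).
   Context: Segments are non-degenerate, closed, bounded line segments ($1$-simplices). For a finite set $S=\{s_1,\dots,s_n\}$ of segments in $\mathbb{R}^3$ with $\operatorname{aff}(\bigcup_{i=1}^n s_i)=\mathbb{R}^3$ (this is the meaning of "affinely spanning $\mathbb{R}^3$"), let $P:=\operatorname{conv}(\bigcup_{i=1}^n s_i)$. $S$ is antipodal if for any $i\neq j$ there are different parallel supporting planes $H',H''$ of $P$ with $s_i\subset H'$ and $s_j\subset H''$. $S$ is strictly antipodal if for any $i\ne j$ there are different parallel supporting planes $H',H''$ of $P$ with $s_i=P\cap H'$ and $s_j=P\cap H''$. -}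

module Defs where

open import Algebra.Bundles using (CommutativeRing)
import Algebra.Properties.Group as GroupProperties
import Algebra.Properties.Semiring.Sum as SemiringSum
open import Data.Bool.Base using (Bool; true; false; not; if_then_else_)
open import Data.Fin.Base using (Fin)
open import Data.Fin.Patterns using (0F; 1F; 2F; 3F)
open import Data.Fin.Permutation using (Permutation; _⟨$⟩ʳ_)
open import Data.Nat.Base using (ℕ)
open import Data.Product.Base using (_×_; _,_; ∃; ∃₂; Σ-syntax)
open import Data.Sum.Base using (_⊎_)
open import Data.Vec.Base using (Vec; lookup; insertAt)
open import Data.Vec.Functional using (Vector; []; _∷_; map; zipWith; replicate)
open import Data.Vec.Properties using (insertAt-lookup)
open import Function.Definitions using (Injective)
open import Level using (0ℓ)
open import Relation.Binary.Core using (Rel)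
open import Relation.Binary.PropositionalEquality.Core using (_≡_; _≢_; subst₂)
open import Relation.Binary.Structures using (IsDecTotalOrder)
import Relation.Binary.Reasoning.Setoid as SetoidReasoning
open import Relation.Nullary.Negation using (¬_)
open import Relation.Unary using (Pred; _∈_; _⊆_; _≐_; _∩_; _≬_; ⋃; Satisfiable)

-- The library has no real numbers.  They are given by their axioms: a
-- Dedekind-complete totally ordered field, which is classically unique up to
-- isomorphism.  The decidability of the order is part of the classical reading, so
-- that constructing an instance requires excluded middle.
record Reals : Set₁ where
  field
    commutativeRing : CommutativeRing 0ℓ 0ℓ

  open CommutativeRing commutativeRing public

  infix 4 _≤_ _<_

  field
    _≤_             : Rel Carrier 0ℓ
    isDecTotalOrder : IsDecTotalOrder _≈_ _≤_
    1≉0             : 1# ≉ 0#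
    inverse         : ∀ x → x ≉ 0# → ∃ λ y → x * y ≈ 1#
    +-monoˡ-≤       : ∀ z {x y} → x ≤ y → x + z ≤ y + z
    *-nonneg        : ∀ {x y} → 0# ≤ x → 0# ≤ y → 0# ≤ x * y

  UpperBound : Pred Carrier 0ℓ → Pred Carrier 0ℓ
  UpperBound A b = ∀ {x} → x ∈ A → x ≤ b

  field
    complete : (A : Pred Carrier 0ℓ) → Satisfiable A → Satisfiable (UpperBound A) →
               ∃ λ s → s ∈ UpperBound A × (∀ {b} → b ∈ UpperBound A → s ≤ b)

  _<_ : Rel Carrier 0ℓ
  x < y = x ≤ y × x ≉ y

module Geometry (ℝ : Reals) where

  open Reals ℝ
  open SemiringSum semiring using (sum; sum-cong-≋; ∑-distrib-+; sum-syntax)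
  private
    module +ᴳ = GroupProperties +-group

  Point : Set
  Point = Vector Carrier 3

  PointSet : Set₁
  PointSet = Pred Point 0ℓ

  infix  4 _≋_
  infixl 6 _⊕_ _⊖_
  infixr 7 _⊙_

  _≋_ : Rel Point 0ℓ
  p ≋ q = ∀ k → p k ≈ q k

  𝟎 : Point
  𝟎 = replicate 3 0#

  _⊕_ _⊖_ : Point → Point → Point
  _⊕_ = zipWith _+_
  _⊖_ = zipWith _-_

  _⊙_ : Carrier → Point → Point
  c ⊙ p = map (c *_) p

  ⟨_,_⟩ : Point → Point → Carrier
  ⟨ u , p ⟩ = sum (zipWith _*_ u p)

  combine : ∀ {m} → Vector Carrier m → Vector Point m → Point
  combine {m} w x k = ∑[ i < m ] (w i * x i k)

  LinearlyIndependent : ∀ {m} → Vector Point m → Set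
  LinearlyIndependent v = ∀ w → combine w v ≋ 𝟎 → ∀ i → w i ≈ 0#

  -- Meant for nonzero vectors only; the factor is then nonzero.
  Proportional : Point → Point → Set
  Proportional u v = ∃ λ c → u ≋ c ⊙ v

  aff : PointSet → PointSet
  aff X p = Σ[ m ∈ ℕ ] Σ[ w ∈ Vector Carrier m ] Σ[ x ∈ Vector Point m ]
    (∀ i → x i ∈ X) × sum w ≈ 1# × p ≋ combine w x

  conv : PointSet → PointSet
  conv X p = Σ[ m ∈ ℕ ] Σ[ w ∈ Vector Carrier m ] Σ[ x ∈ Vector Point m ]
    (∀ i → x i ∈ X) × (∀ i → 0# ≤ w i) × sum w ≈ 1# × p ≋ combine w x

  ----------------------------------------------------------------------
  -- Segments

  record Segment : Set where
    constructor segment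
    field
      source target : Point
      nondegenerate : ¬ (source ≋ target)

    at : Carrier → Point
    at t = (1# - t) ⊙ source ⊕ t ⊙ target

    direction : Point
    direction = target ⊖ source

  open Segment

  ⟦_⟧ : Segment → PointSet
  ⟦ s ⟧ p = ∃ λ t → 0# ≤ t × t ≤ 1# × p ≋ at s t

  relint : Segment → PointSet
  relint s p = ∃ λ t → 0# < t × t < 1# × p ≋ at s t

  line : Segment → PointSet
  line s p = ∃ λ t → p ≋ at s t

  Parallel : Segment → Segment → Set
  Parallel s t = Proportional (direction s) (direction t)

  Skew : Segment → Segment → Set
  Skew s t = ¬ Parallel s t × ¬ (line s ≬ line t)

  -- A set of n segments is an enumeration without repetition; segments are
  -- compared as point sets, so the order of the endpoints is irrelevant.
  Distinct : ∀ {n} → Vector Segment n → Set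
  Distinct S = ∀ i j → i ≢ j → ¬ (⟦ S i ⟧ ≐ ⟦ S j ⟧)

  union : ∀ {n} → Vector Segment n → PointSet
  union {n} S = ⋃ (Fin n) (λ i → ⟦ S i ⟧)

  AffinelySpanning : ∀ {n} → Vector Segment n → Set
  AffinelySpanning S = ∀ p → p ∈ aff (union S)

  ----------------------------------------------------------------------
  -- Planes and antipodality

  record Plane : Set where
    constructor plane
    field
      normal  : Point
      offset  : Carrier
      nonzero : ¬ (normal ≋ 𝟎)

  open Plane

  planeSet lowerHalf upperHalf : Plane → PointSet
  planeSet  H p = ⟨ normal H , p ⟩ ≈ offset H
  lowerHalf H p = ⟨ normal H , p ⟩ ≤ offset H
  upperHalf H p = offset H ≤ ⟨ normal H , p ⟩

  ParallelPlanes : Plane → Plane → Set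
  ParallelPlanes H H′ = Proportional (normal H) (normal H′)

  DifferentPlanes : Plane → Plane → Set
  DifferentPlanes H H′ = ¬ (planeSet H ≐ planeSet H′)

  Supports : Plane → PointSet → Set
  Supports H P = (P ≬ planeSet H) × (P ⊆ lowerHalf H ⊎ P ⊆ upperHalf H)

  record ParallelSupports (P : PointSet) (H H′ : Plane) : Set where
    field
      different : DifferentPlanes H H′
      parallel  : ParallelPlanes H H′
      supports  : Supports H P
      supports′ : Supports H′ P

  Antipodal : ∀ {n} → Vector Segment n → Set
  Antipodal S = ∀ i j → i ≢ j → ∃₂ λ H H′ →
    ParallelSupports P H H′ × ⟦ S i ⟧ ⊆ planeSet H × ⟦ S j ⟧ ⊆ planeSet H′
    where P = conv (union S)

  StrictlyAntipodal : ∀ {n} → Vector Segment n → Set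
  StrictlyAntipodal S = ∀ i j → i ≢ j → ∃₂ λ H H′ →
    ParallelSupports P H H′ × ⟦ S i ⟧ ≐ (P ∩ planeSet H) × ⟦ S j ⟧ ≐ (P ∩ planeSet H′)
    where P = conv (union S)

  ----------------------------------------------------------------------
  -- Parallelepipeds

  combine-injective : ∀ {m} {v : Vector Point m} → LinearlyIndependent v →
                      ∀ u w → combine u v ≋ combine w v → ∀ i → u i ≈ w i
  combine-injective {m} {v} indep u w eq i =
    +ᴳ.x∙y⁻¹≈ε⇒x≈y (u i) (w i) (indep (λ j → u j - w j) vanishes i)
    where
    open SetoidReasoning setoid

    difference : ∀ k → combine (λ j → u j - w j) v k + combine w v k ≈ combine u v k
    difference k = begin
      combine (λ j → u j - w j) v k + combine w v k
        ≈⟨ ∑-distrib-+ (λ j → (u j - w j) * v j k) (λ j → w j * v j k) ⟨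
      ∑[ j < m ] ((u j - w j) * v j k + w j * v j k)
        ≈⟨ sum-cong-≋ (λ j → trans (sym (distribʳ (v j k) (u j - w j) (w j)))
             (*-congʳ (trans (+-assoc (u j) (- w j) (w j))
               (trans (+-congˡ (-‿inverseˡ (w j))) (+-identityʳ (u j)))))) ⟩
      combine u v k ∎

    vanishes : combine (λ j → u j - w j) v ≋ 𝟎
    vanishes k = +ᴳ.∙-cancelʳ (combine w v k) _ _
      (trans (difference k) (trans (eq k) (sym (+-identityˡ _))))

  bit : Bool → Carrier
  bit b = if b then 1# else 0#

  -- The (b 0F, b 1F, b 2F)-corner of the unit cube is sent to
  -- origin + Σᵢ bᵢ · axis i.
  record Parallelepiped : Set where
    field
      origin      : Point
      axis        : Vector Point 3
      independent : LinearlyIndependent axis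

    coordinates : Vec Bool 3 → Vector Carrier 3
    coordinates b i = bit (lookup b i)

    vertex : Vec Bool 3 → Point
    vertex b = origin ⊕ combine (coordinates b) axis

    face : Fin 3 → Bool → PointSet
    face k b p = Σ[ w ∈ Vector Carrier 3 ]
      (∀ i → 0# ≤ w i × w i ≤ 1#) × w k ≈ bit b × p ≋ origin ⊕ combine w axis

    -- The twelve edges: a coordinate that varies, together with the values of
    -- the two remaining ones.  Different labels are different edges.
    EdgeLabel : Set
    EdgeLabel = Fin 3 × Vec Bool 2

    edge : EdgeLabel → Segment
    edge (k , c) = segment (vertex b₀) (vertex b₁) λ eq →
      1≉0 (sym (subst₂ (λ x y → bit x ≈ bit y)
        (insertAt-lookup c k false) (insertAt-lookup c k true)
        (combine-injective {v = axis} independent (coordinates b₀) (coordinates b₁)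
          (λ j → +ᴳ.∙-cancelˡ (origin j) _ _ (eq j)) k)))
      where
      b₀ = insertAt c k false
      b₁ = insertAt c k true

  record TriangularPrism : Set where
    field
      base        : Vector Point 3
      translation : Point

    frame : Vector Point 3
    frame = (base 1F ⊖ base 0F) ∷ (base 2F ⊖ base 0F) ∷ translation ∷ []

    -- The base is a nondegenerate triangle and the translation is not parallel
    -- to its plane.
    field
      independent : LinearlyIndependent frame

    lateralEdge : Fin 3 → Segment
    lateralEdge i = segment (base i) (base i ⊕ translation) λ eq →
      1≉0 (independent coefficients (λ k → vanishes k (eq k)) 2F)
      where
      open SetoidReasoning setoid

      coefficients : Vector Carrier 3
      coefficients = 0# ∷ 0# ∷ 1# ∷ []

      vanishes : ∀ k → base i k ≈ base i k + translation k → combine coefficients frame k ≈ 0#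
      vanishes k eq = begin
        0# * frame 0F k + (0# * frame 1F k + (1# * translation k + 0#))
          ≈⟨ +-cong (zeroˡ _) (+-cong (zeroˡ _) (trans (+-identityʳ _) (*-identityˡ _))) ⟩
        0# + (0# + translation k)  ≈⟨ trans (+-identityˡ _) (+-identityˡ _) ⟩
        translation k              ≈⟨ +ᴳ.∙-cancelˡ (base i k) _ _ (trans (sym eq) (sym (+-identityʳ _))) ⟩
        0# ∎

  ----------------------------------------------------------------------
  -- The extremal configurations

  -- The segments are contained in the given sets, one of each.
  OneInEach : ∀ {n m} → Vector Segment n → Vector PointSet m → Set
  OneInEach {n} {m} S T = Σ[ π ∈ Permutation n m ] (∀ i → ⟦ S i ⟧ ⊆ T (π ⟨$⟩ʳ i))

  InFourParallelEdges : ∀ {n} → Vector Segment n → Set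
  InFourParallelEdges S =
    Σ[ Q ∈ Parallelepiped ] let open Parallelepiped Q in
    Σ[ e ∈ Vector EdgeLabel 4 ]
      Injective _≡_ _≡_ e
      × (∀ i j → Parallel (edge (e i)) (edge (e j)))
      × OneInEach S (λ i → ⟦ edge (e i) ⟧)

  InEdgesOfOppositeFaces : ∀ {n} → Vector Segment n → Set
  InEdgesOfOppositeFaces S =
    Σ[ Q ∈ Parallelepiped ] let open Parallelepiped Q in
    Σ[ e ∈ Vector EdgeLabel 4 ] Σ[ k ∈ Fin 3 ] Σ[ b ∈ Bool ]
      Injective _≡_ _≡_ e
      × (⟦ edge (e 0F) ⟧ ⊆ face k b       × ⟦ edge (e 1F) ⟧ ⊆ face k b)
      × (⟦ edge (e 2F) ⟧ ⊆ face k (not b) × ⟦ edge (e 3F) ⟧ ⊆ face k (not b))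
      × Parallel (edge (e 0F)) (edge (e 1F))
      × Parallel (edge (e 2F)) (edge (e 3F))
      × ¬ Parallel (edge (e 0F)) (edge (e 2F))
      × OneInEach S (λ i → ⟦ edge (e i) ⟧)

  InLateralEdgesOfPrism : ∀ {n} → Vector Segment n → Set
  InLateralEdgesOfPrism S =
    Σ[ T ∈ TriangularPrism ] let open TriangularPrism T in
      OneInEach S (λ i → ⟦ lateralEdge i ⟧)

  InSkewEdges : ∀ {n} → Vector Segment n → Set
  InSkewEdges S =
    Σ[ Q ∈ Parallelepiped ] let open Parallelepiped Q in
    Σ[ e ∈ Vector EdgeLabel 3 ]
      (∀ i j → i ≢ j → Skew (edge (e i)) (edge (e j)))
      × OneInEach S (λ i → relint (edge (e i)))

{-# OPTIONS --safe #-}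

-- A pair of parallel supporting planes through two segments is an affine functional f i j
-- which is 0 on the i-th segment, 1 on the j-th and takes values in [0, 1] on all of them.
-- Its linear part annihilates both directions, so what can happen is decided by the rank of
-- the directions.
--
-- If some three directions are independent, then the three functionals of their pairs are the
-- coordinates of a parallelepiped, with the segments on three mutually skew edges, and there
-- is no fourth segment.  Indeed, if its direction is parallel to another one, two functionals
-- vanishing on it force the third to vanish.  Otherwise the directions can be rescaled to have
-- sum zero, and then the linear parts are the differences t k - t l of four functionals, up to
-- nonzero factors.  The signs of these factors define a tournament on the other three indices
-- at each of the four segments; a cycle in one of them is impossible, and if all are linear
-- orders then the inequalities sum up to 0 < 0.
--
-- If the directions span a plane, the functional of a nonparallel pair is the height above that
-- plane, whence there are two directions, at heights 0 and 1, with at most two segments each.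
-- If all are parallel, the segments project to antipodal points in a plane.  The signs of the
-- coefficients in the affine relation between any four of them force a parallelogram, and five
-- points would give two parallelograms on the same three points.
--
-- In the strictly antipodal case f i j lies in (0, 1) on every third segment, which excludes
-- all configurations of four segments.
module Submission where

open import Algebra.Bundles using (CommutativeRing)
import Algebra.Properties.Ring as RingProperties
import Algebra.Properties.Semiring.Mult.TCOptimised as Multiples
import Algebra.Properties.Semiring.Sum as SemiringSum
import Algebra.Solver.Ring as RingSolver
open import Algebra.Solver.Ring.AlmostCommutativeRing using (fromCommutativeRing; _-Raw-AlmostCommutative⟶_)
open import Data.Bool.Base using (Bool; true; false; not)
import Data.Bool.Properties as Bool
open import Data.Empty using (⊥; ⊥-elim)
open import Data.Fin.Base using (Fin; zero; suc; punchIn; punchOut; splitAt; inject≤; _↑ˡ_; _↑ʳ_)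
open import Data.Fin.Patterns using (0F; 1F; 2F; 3F; 4F)
open import Data.Fin.Permutation as Permutation using (Permutation; _⟨$⟩ʳ_; _⟨$⟩ˡ_; inverseˡ; ↔⇒≡)
import Data.Fin.Properties as Fin
open import Data.Integer.Base as ℤ using (ℤ; +_; -[1+_])
import Data.Integer.Properties as ℤ
open import Data.Maybe.Base as Maybe using (Maybe)
open import Data.Nat.Base as ℕ using (ℕ; zero; suc)
import Data.Nat.Properties as ℕ
open import Data.Product.Base using (_×_; _,_; ∃; proj₁; proj₂; Σ-syntax)
import Data.Product.Properties as Product
open import Data.Sum.Base as Sum using (_⊎_; inj₁; inj₂; [_,_]′)
open import Data.Vec.Base as Vec using (Vec; lookup) renaming ([] to []ᵥ; _∷_ to _∷ᵥ_)
import Data.Vec.Properties as Vec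
open import Data.Vec.Functional using (Vector; []; _∷_; _++_; insertAt; tail)
open import Data.Vec.Functional.Properties using (insertAt-lookup; insertAt-punchIn; lookup-++ˡ; lookup-++ʳ)
open import Defs
open import Function.Base using (_∘_; case_of_)
open import Function.Bundles using (_⇔_; mk⇔)
import Relation.Binary.Reasoning.Setoid as SetoidReasoning
open import Relation.Binary.PropositionalEquality.Core as ≡ using (_≡_; _≢_)
open import Relation.Binary.Structures using (IsDecTotalOrder)
open import Relation.Nullary.Decidable using (Dec; yes; no; ¬?; dec⇒maybe; from-yes; _→-dec_; _×-dec_; _⊎-dec_)
open import Relation.Nullary.Negation using (¬_; contradiction)
open import Relation.Unary using (_∈_; _⊆_)

-- Bounds for an affine functional on the segments are the same as bounds on their hull, so `conv`
-- enters only in the translation between planes and functionals. Two functionals that vanish on the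
-- same segment and have proportional linear parts agree: each takes the value 1 on a segment where
-- the other is at most 1. This rigidity settles parallel and coplanar directions. The obstacle is
-- the case of four directions no three of which are coplanar, where only inequalities are
-- available. After rescaling to vectors `e m` with sum zero, a linear form that kills `e i` and
-- `e j` takes opposite values at `e k` and `e l`, hence is a multiple of `t k - t l`. At midpoints
-- the bounds on the segments `k` and `l` are strict, so everything is expressed by the sixteen
-- values `T i k` and by the sign of one multiple for each pair. One sign orders `k` and `l` at `i`,
-- and the opposite way at `j`, so six signs determine all four tournaments. All inequalities are
-- linear in the values `T i k`, and a contradiction is a selection of them with left-hand sides
-- adding up to zero.

-- The library's ring solver computes with coefficients; integer ones are needed to
-- see cancellations.
module IntegerCoefficients {c ℓ} (R : CommutativeRing c ℓ) where

  open CommutativeRing R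
  open RingProperties ring
  open Multiples semiring using (×-homo-+; ×1-homo-*; 1+×) renaming (_×_ to _•_)
  open SetoidReasoning setoid

  private
    fromℕ : ℕ → Carrier
    fromℕ n = n • 1#

    fromℤ : ℤ → Carrier
    fromℤ (+ n)    = fromℕ n
    fromℤ -[1+ n ] = - fromℕ (suc n)

    fromℤ-neg : ∀ z → fromℤ (ℤ.- z) ≈ - fromℤ z
    fromℤ-neg (+ zero)  = sym -0#≈0#
    fromℤ-neg (+ suc n) = refl
    fromℤ-neg -[1+ n ]  = sym (-‿involutive _)

    fromℤ-⊖ : ∀ m n → fromℤ (m ℤ.⊖ n) ≈ fromℕ m - fromℕ n
    fromℤ-⊖ zero    zero    = sym (-‿inverseʳ 0#)
    fromℤ-⊖ zero    (suc n) = sym (+-identityˡ _)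
    fromℤ-⊖ (suc m) zero    = sym (trans (+-congˡ -0#≈0#) (+-identityʳ _))
    fromℤ-⊖ (suc m) (suc n) = begin
      fromℤ (suc m ℤ.⊖ suc n)                 ≡⟨ ≡.cong fromℤ (ℤ.[1+m]⊖[1+n]≡m⊖n m n) ⟩
      fromℤ (m ℤ.⊖ n)                         ≈⟨ fromℤ-⊖ m n ⟩
      fromℕ m - fromℕ n                       ≈⟨ +-congʳ (trans (+-congʳ (-‿inverseˡ 1#)) (+-identityˡ _)) ⟨
      (- 1# + 1# + fromℕ m) - fromℕ n         ≈⟨ +-congʳ (trans (+-assoc _ _ _) (+-comm _ _)) ⟩
      ((1# + fromℕ m) - 1#) - fromℕ n         ≈⟨ +-assoc _ _ _ ⟩
      (1# + fromℕ m) + (- 1# - fromℕ n)       ≈⟨ +-congˡ (-‿+-comm 1# (fromℕ n)) ⟩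
      (1# + fromℕ m) - (1# + fromℕ n)         ≈⟨ +-cong (1+× m 1#) (-‿cong (1+× n 1#)) ⟨
      fromℕ (suc m) - fromℕ (suc n)           ∎

    fromℤ-+ : ∀ x y → fromℤ (x ℤ.+ y) ≈ fromℤ x + fromℤ y
    fromℤ-+ (+ m)    (+ n)    = ×-homo-+ 1# m n
    fromℤ-+ (+ m)    -[1+ n ] = fromℤ-⊖ m (suc n)
    fromℤ-+ -[1+ m ] (+ n)    = trans (fromℤ-⊖ n (suc m)) (+-comm _ _)
    fromℤ-+ -[1+ m ] -[1+ n ] = begin
      - fromℕ (suc (suc (m ℕ.+ n)))       ≡⟨ ≡.cong (λ k → - fromℕ (suc k)) (ℕ.+-suc m n) ⟨
      - fromℕ (suc m ℕ.+ suc n)           ≈⟨ -‿cong (×-homo-+ 1# (suc m) (suc n)) ⟩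
      - (fromℕ (suc m) + fromℕ (suc n))   ≈⟨ -‿+-comm _ _ ⟨
      - fromℕ (suc m) - fromℕ (suc n)     ∎

    fromℤ-*-pos : ∀ m y → fromℤ (+ m ℤ.* y) ≈ fromℕ m * fromℤ y
    fromℤ-*-pos m (+ n) = trans (reflexive (≡.cong fromℤ (≡.sym (ℤ.pos-* m n)))) (×1-homo-* m n)
    fromℤ-*-pos m -[1+ n ] = begin
      fromℤ (+ m ℤ.* ℤ.- (+ suc n))       ≡⟨ ≡.cong fromℤ (ℤ.neg-distribʳ-* (+ m) (+ suc n)) ⟨
      fromℤ (ℤ.- (+ m ℤ.* + suc n))       ≈⟨ fromℤ-neg (+ m ℤ.* + suc n) ⟩
      - fromℤ (+ m ℤ.* + suc n)           ≈⟨ -‿cong (fromℤ-*-pos m (+ suc n)) ⟩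
      - (fromℕ m * fromℕ (suc n))         ≈⟨ -‿distribʳ-* _ _ ⟩
      fromℕ m * - fromℕ (suc n)           ∎

    fromℤ-* : ∀ x y → fromℤ (x ℤ.* y) ≈ fromℤ x * fromℤ y
    fromℤ-* (+ m)    y = fromℤ-*-pos m y
    fromℤ-* -[1+ m ] y = begin
      fromℤ (ℤ.- (+ suc m) ℤ.* y)         ≡⟨ ≡.cong fromℤ (ℤ.neg-distribˡ-* (+ suc m) y) ⟨
      fromℤ (ℤ.- (+ suc m ℤ.* y))         ≈⟨ fromℤ-neg (+ suc m ℤ.* y) ⟩
      - fromℤ (+ suc m ℤ.* y)             ≈⟨ -‿cong (fromℤ-*-pos (suc m) y) ⟩
      - (fromℕ (suc m) * fromℤ y)         ≈⟨ -‿distribˡ-* _ _ ⟩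
      - fromℕ (suc m) * fromℤ y           ∎

    morphism : ℤ.+-*-rawRing -Raw-AlmostCommutative⟶ fromCommutativeRing R
    morphism = record
      { ⟦_⟧    = fromℤ
      ; +-homo = fromℤ-+
      ; *-homo = fromℤ-*
      ; -‿homo = fromℤ-neg
      ; 0-homo = refl
      ; 1-homo = refl
      }

  open RingSolver ℤ.+-*-rawRing (fromCommutativeRing R) morphism
    (λ x y → Maybe.map (λ eq → reflexive (≡.cong fromℤ eq)) (dec⇒maybe (x ℤ.≟ y)))
    public using (solve; _:=_; _:+_; _:*_; _:-_; :-_; con; Polynomial)

  :0 :1 : ∀ {n} → Polynomial n
  :0 = con (+ 0)
  :1 = con (+ 1)

-- Ordered field arithmetic, strict positivity and the number one half.

module OrderedField (ℝ : Reals) where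

  open Reals ℝ hiding (zero)
  open IntegerCoefficients commutativeRing
  open RingProperties ring using (x∙y⁻¹≈ε⇒x≈y; -‿involutive; -0#≈0#)
  open SetoidReasoning setoid

  open IsDecTotalOrder isDecTotalOrder public
    using (_≟_; total; ≤-respˡ-≈; ≤-respʳ-≈)
    renaming (refl to ≤-refl; reflexive to ≤-reflexive; trans to ≤-trans; antisym to ≤-antisym)

  0≤-cong : ∀ {x y} → x ≈ y → 0# ≤ x → 0# ≤ y
  0≤-cong = ≤-respʳ-≈

  x-y≈0⇒x≈y : ∀ {x y} → x - y ≈ 0# → x ≈ y
  x-y≈0⇒x≈y = x∙y⁻¹≈ε⇒x≈y _ _

  x≈y⇒x-y≈0 : ∀ {x y} → x ≈ y → x - y ≈ 0#
  x≈y⇒x-y≈0 {x} {y} eq = trans (+-congʳ eq) (-‿inverseʳ y)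

  x≈0⇒-x≈0 : ∀ {x} → x ≈ 0# → - x ≈ 0#
  x≈0⇒-x≈0 eq = trans (-‿cong eq) -0#≈0#

  -x≈0⇒x≈0 : ∀ {x} → - x ≈ 0# → x ≈ 0#
  -x≈0⇒x≈0 eq = trans (sym (-‿involutive _)) (x≈0⇒-x≈0 eq)

  1-0≈1 : 1# - 0# ≈ 1#
  1-0≈1 = solve 0 (:1 :- :0 := :1) refl

  x≈1-[1-x] : ∀ x → x ≈ 1# - (1# - x)
  x≈1-[1-x] = solve 1 (λ x → x := :1 :- (:1 :- x)) refl

  x≤y⇒0≤y-x : ∀ {x y} → x ≤ y → 0# ≤ y - x
  x≤y⇒0≤y-x {x} {y} x≤y = ≤-respˡ-≈ (-‿inverseʳ x) (+-monoˡ-≤ (- x) x≤y)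

  0≤y-x⇒x≤y : ∀ {x y} → 0# ≤ y - x → x ≤ y
  0≤y-x⇒x≤y {x} {y} p = ≤-respˡ-≈ (+-identityˡ x)
    (≤-respʳ-≈ (solve 2 (λ x y → y :- x :+ x := y) refl x y) (+-monoˡ-≤ x p))

  +-nonneg : ∀ {x y} → 0# ≤ x → 0# ≤ y → 0# ≤ x + y
  +-nonneg {x} {y} p q = ≤-trans q (≤-respˡ-≈ (+-identityˡ y) (+-monoˡ-≤ y p))

  x≤0⇒0≤-x : ∀ {x} → x ≤ 0# → 0# ≤ - x
  x≤0⇒0≤-x p = 0≤-cong (+-identityˡ _) (x≤y⇒0≤y-x p)

  0≤-x⇒x≤0 : ∀ {x} → 0# ≤ - x → x ≤ 0#
  0≤-x⇒x≤0 p = 0≤y-x⇒x≤y (0≤-cong (sym (+-identityˡ _)) p)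

  sign : ∀ x → 0# ≤ x ⊎ 0# ≤ - x
  sign x with total 0# x
  ... | inj₁ 0≤x = inj₁ 0≤x
  ... | inj₂ x≤0 = inj₂ (x≤0⇒0≤-x x≤0)

  0≤x∧0≤-x⇒x≈0 : ∀ {x} → 0# ≤ x → 0# ≤ - x → x ≈ 0#
  0≤x∧0≤-x⇒x≈0 p q = ≤-antisym (0≤-x⇒x≤0 q) p

  x*x-nonneg : ∀ x → 0# ≤ x * x
  x*x-nonneg x with sign x
  ... | inj₁ p = *-nonneg p p
  ... | inj₂ p = 0≤-cong (solve 1 (λ x → (:- x) :* (:- x) := x :* x) refl x) (*-nonneg p p)

  0≤1 : 0# ≤ 1#
  0≤1 = 0≤-cong (*-identityˡ 1#) (x*x-nonneg 1#)

  x*y≈0⇒y≈0 : ∀ {x y} → x ≉ 0# → x * y ≈ 0# → y ≈ 0#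
  x*y≈0⇒y≈0 {x} {y} x≉0 eq with inverse x x≉0
  ... | x⁻¹ , x*x⁻¹≈1 = begin
    y               ≈⟨ *-identityˡ y ⟨
    1# * y          ≈⟨ *-congʳ x*x⁻¹≈1 ⟨
    x * x⁻¹ * y     ≈⟨ solve 3 (λ x i y → x :* i :* y := i :* (x :* y)) refl x x⁻¹ y ⟩
    x⁻¹ * (x * y)   ≈⟨ *-congˡ eq ⟩
    x⁻¹ * 0#        ≈⟨ zeroʳ x⁻¹ ⟩
    0#              ∎

  *-≉0 : ∀ {x y} → x ≉ 0# → y ≉ 0# → x * y ≉ 0#
  *-≉0 x≉0 y≉0 eq = y≉0 (x*y≈0⇒y≈0 x≉0 eq)

  x*x≈0⇒x≈0 : ∀ {x} → x * x ≈ 0# → x ≈ 0#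
  x*x≈0⇒x≈0 {x} eq with x ≟ 0#
  ... | yes p = p
  ... | no  p = x*y≈0⇒y≈0 p eq

  x+y≈0⇒x≈0 : ∀ {x y} → 0# ≤ x → 0# ≤ y → x + y ≈ 0# → x ≈ 0#
  x+y≈0⇒x≈0 {x} {y} p q eq = 0≤x∧0≤-x⇒x≈0 p (0≤-cong y≈-x q)
    where
    y≈-x : y ≈ - x
    y≈-x = begin
      y            ≈⟨ solve 2 (λ x y → y := x :+ y :- x) refl x y ⟩
      x + y - x    ≈⟨ +-congʳ eq ⟩
      0# - x       ≈⟨ +-identityˡ _ ⟩
      - x          ∎

  Positive : Carrier → Set
  Positive x = 0# < x

  positive : ∀ {x} → 0# ≤ x → x ≉ 0# → Positive x
  positive p q = p , λ eq → q (sym eq)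

  Positive⇒≉0 : ∀ {x} → Positive x → x ≉ 0#
  Positive⇒≉0 p eq = proj₂ p (sym eq)

  Positive-cong : ∀ {x y} → x ≈ y → Positive x → Positive y
  Positive-cong eq (p , q) = 0≤-cong eq p , λ e → q (trans e (sym eq))

  1-positive : Positive 1#
  1-positive = positive 0≤1 1≉0

  +-positive : ∀ {x y} → Positive x → 0# ≤ y → Positive (x + y)
  +-positive p q = positive (+-nonneg (proj₁ p) q) λ eq → Positive⇒≉0 p (x+y≈0⇒x≈0 (proj₁ p) q eq)

  *-positive : ∀ {x y} → Positive x → Positive y → Positive (x * y)
  *-positive p q = positive (*-nonneg (proj₁ p) (proj₁ q)) (*-≉0 (Positive⇒≉0 p) (Positive⇒≉0 q))

  *-cancelˡ-nonneg : ∀ {x y} → Positive x → 0# ≤ x * y → 0# ≤ y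
  *-cancelˡ-nonneg {x} {y} p q with sign y
  ... | inj₁ r = r
  ... | inj₂ r = ≤-reflexive (sym (x*y≈0⇒y≈0 (Positive⇒≉0 p)
                   (0≤x∧0≤-x⇒x≈0 q (0≤-cong (solve 2 (λ x y → x :* :- y := :- (x :* y)) refl x y) (*-nonneg (proj₁ p) r)))))

  *-cancelˡ-positive : ∀ {x y} → Positive x → Positive (x * y) → Positive y
  *-cancelˡ-positive {x} {y} p q = positive (*-cancelˡ-nonneg p (proj₁ q))
    λ eq → Positive⇒≉0 q (trans (*-congˡ eq) (zeroʳ x))

  inverse-positive : ∀ {x} → Positive x → ∃ λ y → Positive y × x * y ≈ 1#
  inverse-positive {x} p with inverse x (Positive⇒≉0 p)
  ... | y , eq = y , *-cancelˡ-positive p (Positive-cong (sym eq) 1-positive) , eq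

  *-cancelˡ : ∀ {x y z} → x ≉ 0# → x * y ≈ x * z → y ≈ z
  *-cancelˡ {x} {y} {z} x≉0 eq = x-y≈0⇒x≈y (x*y≈0⇒y≈0 x≉0 (begin
    x * (y - z)     ≈⟨ solve 3 (λ x y z → x :* (y :- z) := x :* y :- x :* z) refl x y z ⟩
    x * y - x * z   ≈⟨ x≈y⇒x-y≈0 eq ⟩
    0#              ∎))

  private
    halving : ∃ λ y → Positive y × (1# + 1#) * y ≈ 1#
    halving = inverse-positive (+-positive 1-positive 0≤1)

  ½ : Carrier
  ½ = proj₁ halving

  ½+½≈1 : ½ + ½ ≈ 1#
  ½+½≈1 = trans (solve 1 (λ h → h :+ h := (:1 :+ :1) :* h) refl ½) (proj₂ (proj₂ halving))

  ½-positive : Positive ½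
  ½-positive = proj₁ (proj₂ halving)

  1-½≈½ : 1# - ½ ≈ ½
  1-½≈½ = trans (+-congʳ (sym ½+½≈1)) (solve 1 (λ h → h :+ h :- h := h) refl ½)

-- Linear algebra in space: elimination, orthogonality and annihilators.

module LinearAlgebra (ℝ : Reals) where

  open Reals ℝ hiding (zero)
  open Geometry ℝ
  open OrderedField ℝ
  open IntegerCoefficients commutativeRing
  open SemiringSum semiring using (sum; sum-cong-≋; sum-remove; ∑-distrib-+; *-distribˡ-sum; sum-replicate-zero)
  open SetoidReasoning setoid

  sum-zero : ∀ {n} {f : Vector Carrier n} → (∀ i → f i ≈ 0#) → sum f ≈ 0#
  sum-zero {n} eq = trans (sum-cong-≋ eq) (sum-replicate-zero n)

  sum-++ : ∀ m {n} (f : Vector Carrier (m ℕ.+ n)) →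
           sum f ≈ sum (λ i → f (i ↑ˡ n)) + sum (λ i → f (m ↑ʳ i))
  sum-++ zero    f = sym (+-identityˡ _)
  sum-++ (suc m) f = trans (+-congˡ (sum-++ m (tail f))) (sym (+-assoc _ _ _))

  LinearlyDependent : ∀ {m r} → Vector (Vector Carrier m) r → Set
  LinearlyDependent {m} {r} v = Σ[ w ∈ Vector Carrier r ] (∃ λ i → w i ≉ 0#) × (∀ k → sum (λ i → w i * v i k) ≈ 0#)

  LinearlyIndependent′ : ∀ {m r} → Vector (Vector Carrier m) r → Set
  LinearlyIndependent′ {m} {r} v = ∀ (w : Vector Carrier r) → (∀ k → sum (λ i → w i * v i k) ≈ 0#) → ∀ i → w i ≈ 0#

  private
    sum-elimination : ∀ {n} (w x y : Vector Carrier n) a b →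
      sum (λ j → w j * (a * x j - y j * b)) ≈ a * sum (λ j → w j * x j) - sum (λ j → w j * y j) * b
    sum-elimination {zero} w x y a b = solve 2 (λ a b → :0 := a :* :0 :- :0 :* b) refl a b
    sum-elimination {suc n} w x y a b = trans (+-congˡ (sum-elimination (tail w) (tail x) (tail y) a b))
      (solve 7 (λ w x y a b X Y → w :* (a :* x :- y :* b) :+ (a :* X :- Y :* b)
                               := a :* (w :* x :+ X) :- (w :* y :+ Y) :* b) refl
         (w 0F) (x 0F) (y 0F) a b _ _)

  -- Gaussian elimination.
  independent⊎dependent : ∀ {m r} (v : Vector (Vector Carrier m) r) →
                          (LinearlyIndependent′ v × r ℕ.≤ m) ⊎ LinearlyDependent v
  independent⊎dependent {zero}  {zero}  v = inj₁ ((λ _ _ ()) , ℕ.z≤n)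
  independent⊎dependent {zero}  {suc r} v = inj₂ ((λ _ → 1#) , (0F , 1≉0) , λ ())
  independent⊎dependent {suc m} {zero}  v = inj₁ ((λ _ _ ()) , ℕ.z≤n)
  independent⊎dependent {suc m} {suc r} v with Fin.any? (λ i → ¬? (v i 0F ≟ 0#))
  ... | no none = extend (independent⊎dependent (λ i → tail (v i)))
    where
    column≈0 : ∀ i → v i 0F ≈ 0#
    column≈0 i with v i 0F ≟ 0#
    ... | yes p = p
    ... | no  p = contradiction (i , p) none

    extend : (LinearlyIndependent′ (λ i → tail (v i)) × suc r ℕ.≤ m) ⊎ LinearlyDependent (λ i → tail (v i)) →
             (LinearlyIndependent′ v × suc r ℕ.≤ suc m) ⊎ LinearlyDependent v
    extend (inj₁ (indep , r≤m)) = inj₁ ((λ w eq → indep w (λ k → eq (suc k))) , ℕ.m≤n⇒m≤1+n r≤m)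
    extend (inj₂ (w , nonzero , eq)) = inj₂ (w , nonzero , λ
      { zero    → sum-zero (λ i → trans (*-congˡ (column≈0 i)) (zeroʳ (w i)))
      ; (suc k) → eq k })
  ... | yes (i , pivot) = extend (independent⊎dependent v′)
    where
    a = v i 0F

    -- Cross-multiplication with the pivot row clears the first coordinate without division; nothing
    -- is lost, as `a` is nonzero.
    v′ : Vector (Vector Carrier m) r
    v′ j k = a * v (punchIn i j) (suc k) - v (punchIn i j) 0F * v i (suc k)

    extend : (LinearlyIndependent′ v′ × r ℕ.≤ m) ⊎ LinearlyDependent v′ →
             (LinearlyIndependent′ v × suc r ℕ.≤ suc m) ⊎ LinearlyDependent v
    extend (inj₁ (indep , r≤m)) = inj₁ (independent , ℕ.s≤s r≤m)
      where
      module _ (w : Vector Carrier (suc r)) (eq : ∀ k → sum (λ i → w i * v i k) ≈ 0#) where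
        rest : Fin (suc m) → Carrier
        rest k = sum (λ j → w (punchIn i j) * v (punchIn i j) k)

        split : ∀ k → w i * v i k + rest k ≈ 0#
        split k = trans (sym (sum-remove {i = i} (λ i → w i * v i k))) (eq k)

        others : ∀ j → w (punchIn i j) ≈ 0#
        others = indep (w ∘ punchIn i) λ k → begin
          sum (λ j → w (punchIn i j) * v′ j k)
            ≈⟨ sum-elimination (w ∘ punchIn i) _ _ a (v i (suc k)) ⟩
          a * rest (suc k) - rest 0F * v i (suc k)
            ≈⟨ solve 5 (λ a b w R S → a :* R :- S :* b := a :* (w :* b :+ R) :- (w :* a :+ S) :* b) refl
                 a (v i (suc k)) (w i) _ _ ⟩
          a * (w i * v i (suc k) + rest (suc k)) - (w i * a + rest 0F) * v i (suc k)
            ≈⟨ +-cong (*-congˡ (split (suc k))) (-‿cong (*-congʳ (split 0F))) ⟩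
          a * 0# - 0# * v i (suc k)
            ≈⟨ solve 2 (λ a b → a :* :0 :- :0 :* b := :0) refl a (v i (suc k)) ⟩
          0# ∎

        at-pivot : w i ≈ 0#
        at-pivot = x*y≈0⇒y≈0 pivot (begin
          a * w i              ≈⟨ *-comm _ _ ⟩
          w i * a              ≈⟨ +-identityʳ _ ⟨
          w i * a + 0#         ≈⟨ +-congˡ (sum-zero (λ j → trans (*-congʳ (others j)) (zeroˡ _))) ⟨
          w i * a + rest 0F    ≈⟨ split 0F ⟩
          0#                   ∎)

        independent : ∀ j → w j ≈ 0#
        independent j with i Fin.≟ j
        ... | yes ≡.refl = at-pivot
        ... | no  i≢j    = ≡.subst (λ j → w j ≈ 0#) (Fin.punchIn-punchOut i≢j) (others (punchOut i≢j))

    extend (inj₂ (w′ , (j , nonzero) , eq)) = inj₂ (w , (punchIn i j , nonzero′) , dependent)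
      where
      S = sum (λ j → w′ j * v (punchIn i j) 0F)

      -- The factor `a` undoes the cross-multiplication, and the weight `- S` of the pivot row is
      -- the one that makes the first coordinate cancel.
      w : Vector Carrier (suc r)
      w = insertAt (λ j → a * w′ j) i (- S)

      w-pivot : w i ≈ - S
      w-pivot = reflexive (insertAt-lookup (λ j → a * w′ j) i (- S))

      w-other : ∀ j → w (punchIn i j) ≈ a * w′ j
      w-other j = reflexive (insertAt-punchIn (λ j → a * w′ j) i (- S) j)

      nonzero′ : w (punchIn i j) ≉ 0#
      nonzero′ p = *-≉0 pivot nonzero (trans (sym (w-other j)) p)

      split : ∀ k → sum (λ i → w i * v i k) ≈ a * sum (λ j → w′ j * v (punchIn i j) k) - S * v i k
      split k = begin
        sum (λ i → w i * v i k)
          ≈⟨ sum-remove {i = i} (λ i → w i * v i k) ⟩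
        w i * v i k + sum (λ j → w (punchIn i j) * v (punchIn i j) k)
          ≈⟨ +-cong (*-congʳ w-pivot)
               (sum-cong-≋ λ j → trans (*-congʳ (w-other j)) (*-assoc _ _ _)) ⟩
        - S * v i k + sum (λ j → a * (w′ j * v (punchIn i j) k))
          ≈⟨ +-congˡ (*-distribˡ-sum a (λ j → w′ j * v (punchIn i j) k)) ⟨
        - S * v i k + a * sum (λ j → w′ j * v (punchIn i j) k)
          ≈⟨ solve 4 (λ S b a X → (:- S) :* b :+ a :* X := a :* X :- S :* b) refl S (v i k) a _ ⟩
        a * sum (λ j → w′ j * v (punchIn i j) k) - S * v i k ∎

      dependent : ∀ k → sum (λ i → w i * v i k) ≈ 0#
      dependent zero    = trans (split zero) (solve 2 (λ a S → a :* S :- S :* a := :0) refl a S)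
      dependent (suc k) = trans (split (suc k))
        (trans (sym (sum-elimination w′ _ _ a (v i (suc k)))) (eq k))

  dependent : ∀ {r} (v : Vector Point (4 ℕ.+ r)) → LinearlyDependent v
  dependent v with independent⊎dependent v
  ... | inj₁ (_ , ℕ.s≤s (ℕ.s≤s (ℕ.s≤s ())))
  ... | inj₂ dep = dep

  ⟨⟩-cong : ∀ {u v p q} → u ≋ v → p ≋ q → ⟨ u , p ⟩ ≈ ⟨ v , q ⟩
  ⟨⟩-cong {u} {v} {p} {q} u≋v p≋q = sum-cong-≋ {x = λ k → u k * p k} {y = λ k → v k * q k} λ k → *-cong (u≋v k) (p≋q k)

  ⟨⟩-congˡ : ∀ {u p q} → p ≋ q → ⟨ u , p ⟩ ≈ ⟨ u , q ⟩
  ⟨⟩-congˡ {u} = ⟨⟩-cong {u} {u} (λ _ → refl)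

  ⟨⟩-congʳ : ∀ {u v p} → u ≋ v → ⟨ u , p ⟩ ≈ ⟨ v , p ⟩
  ⟨⟩-congʳ {u} {v} {p} eq = ⟨⟩-cong {u} {v} {p} {p} eq (λ _ → refl)

  ⟨⟩-comm : ∀ u p → ⟨ u , p ⟩ ≈ ⟨ p , u ⟩
  ⟨⟩-comm u p = sum-cong-≋ {x = λ k → u k * p k} {y = λ k → p k * u k} (λ k → *-comm (u k) (p k))

  ⟨⟩-zeroʳ : ∀ u → ⟨ u , 𝟎 ⟩ ≈ 0#
  ⟨⟩-zeroʳ u = sum-zero (λ k → zeroʳ (u k))

  ⟨⟩-combine : ∀ {m} u (w : Vector Carrier m) x → ⟨ u , combine w x ⟩ ≈ sum (λ i → w i * ⟨ u , x i ⟩)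
  ⟨⟩-combine {zero} u w x = ⟨⟩-zeroʳ u
  ⟨⟩-combine {suc m} u w x = trans
    (solve 10 (λ w₀ u₀ u₁ u₂ p₀ p₁ p₂ q₀ q₁ q₂ →
        u₀ :* (w₀ :* p₀ :+ q₀) :+ (u₁ :* (w₀ :* p₁ :+ q₁) :+ (u₂ :* (w₀ :* p₂ :+ q₂) :+ :0))
     := w₀ :* (u₀ :* p₀ :+ (u₁ :* p₁ :+ (u₂ :* p₂ :+ :0))) :+ (u₀ :* q₀ :+ (u₁ :* q₁ :+ (u₂ :* q₂ :+ :0))))
     refl (w 0F) (u 0F) (u 1F) (u 2F) (x 0F 0F) (x 0F 1F) (x 0F 2F) _ _ _)
    (+-congˡ (⟨⟩-combine u (tail w) (tail x)))

  ⟨⟩-⊕ : ∀ u p q → ⟨ u , p ⊕ q ⟩ ≈ ⟨ u , p ⟩ + ⟨ u , q ⟩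
  ⟨⟩-⊕ u p q = trans (sum-cong-≋ {x = λ k → u k * (p k + q k)} {y = λ k → u k * p k + u k * q k} (λ k → distribˡ (u k) (p k) (q k)))
    (∑-distrib-+ (λ k → u k * p k) (λ k → u k * q k))

  ⟨⟩-⊙ : ∀ u c p → ⟨ u , c ⊙ p ⟩ ≈ c * ⟨ u , p ⟩
  ⟨⟩-⊙ u c p = trans (sum-cong-≋ {x = λ k → u k * (c * p k)} {y = λ k → c * (u k * p k)}
      (λ k → solve 3 (λ u c p → u :* (c :* p) := c :* (u :* p)) refl (u k) c (p k)))
    (sym (*-distribˡ-sum c (λ k → u k * p k)))

  ⟨⟩-factor : ∀ {u v c} → u ≋ c ⊙ v → ∀ p → ⟨ u , p ⟩ ≈ c * ⟨ v , p ⟩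
  ⟨⟩-factor {u} {v} {c} eq p = trans (⟨⟩-comm u p) (trans (⟨⟩-congˡ {p} eq) (trans (⟨⟩-⊙ p c v) (*-congˡ (⟨⟩-comm p v))))

  ⟨⟩-⊖ : ∀ u p q → ⟨ u , p ⊖ q ⟩ ≈ ⟨ u , p ⟩ - ⟨ u , q ⟩
  ⟨⟩-⊖ u p q = solve 9 (λ u₀ u₁ u₂ p₀ p₁ p₂ q₀ q₁ q₂ →
        u₀ :* (p₀ :- q₀) :+ (u₁ :* (p₁ :- q₁) :+ (u₂ :* (p₂ :- q₂) :+ :0))
     := u₀ :* p₀ :+ (u₁ :* p₁ :+ (u₂ :* p₂ :+ :0)) :- (u₀ :* q₀ :+ (u₁ :* q₁ :+ (u₂ :* q₂ :+ :0))))
     refl (u 0F) (u 1F) (u 2F) (p 0F) (p 1F) (p 2F) (q 0F) (q 1F) (q 2F)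

  ⟨z,z⟩≈0⇒z≋𝟎 : ∀ z → ⟨ z , z ⟩ ≈ 0# → z ≋ 𝟎
  ⟨z,z⟩≈0⇒z≋𝟎 z eq = go
    where
    square : ∀ k → 0# ≤ z k * z k
    square k = x*x-nonneg (z k)

    tail≈0 : z 1F * z 1F + (z 2F * z 2F + 0#) ≈ 0#
    tail≈0 = x+y≈0⇒x≈0 (+-nonneg (square 1F) (+-nonneg (square 2F) ≤-refl)) (square 0F) (trans (+-comm _ _) eq)

    go : z ≋ 𝟎
    go 0F = x*x≈0⇒x≈0 (x+y≈0⇒x≈0 (square 0F) (+-nonneg (square 1F) (+-nonneg (square 2F) ≤-refl)) eq)
    go 1F = x*x≈0⇒x≈0 (x+y≈0⇒x≈0 (square 1F) (+-nonneg (square 2F) ≤-refl) tail≈0)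
    go 2F = x*x≈0⇒x≈0 (x+y≈0⇒x≈0 (square 2F) (square 1F)
              (trans (trans (+-comm _ _) (+-congˡ (sym (+-identityʳ _)))) tail≈0))

  infix 4 _⟂_

  _⟂_ : Point → Point → Set
  u ⟂ p = ⟨ u , p ⟩ ≈ 0#

  ⟂-sym : ∀ {u p} → u ⟂ p → p ⟂ u
  ⟂-sym {u} {p} eq = trans (⟨⟩-comm p u) eq

  ⟂-combine : ∀ {m u} {x : Vector Point m} w → (∀ i → u ⟂ x i) → u ⟂ combine w x
  ⟂-combine {u = u} {x} w eq = trans (⟨⟩-combine u w x)
    (sum-zero (λ i → trans (*-congˡ (eq i)) (zeroʳ (w i))))

  -- A linear relation among both families splits into two orthogonal sums which cancel,
  -- so that both vanish.
  orthogonal-dependent : ∀ {r s} {U : Vector Point r} {A : Vector Point s} → LinearlyIndependent A →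
    (∀ i j → U i ⟂ A j) → LinearlyDependent (U ++ A) → LinearlyDependent U
  orthogonal-dependent {r} {s} {U} {A} indep U⊥A (w , (l , wl≉0) , eq) = wU , nonzero , z≋𝟎
    where
    wU : Vector Carrier r
    wU i = w (i ↑ˡ s)

    wA : Vector Carrier s
    wA j = w (r ↑ʳ j)

    z y : Point
    z = combine wU U
    y = combine wA A

    z+y≋𝟎 : z ⊕ y ≋ 𝟎
    z+y≋𝟎 k = begin
      z k + y k
        ≈⟨ +-cong (sum-cong-≋ λ i → reflexive (≡.cong (λ p → wU i * p k) (lookup-++ˡ U A i)))
             (sum-cong-≋ λ j → reflexive (≡.cong (λ p → wA j * p k) (lookup-++ʳ U A j))) ⟨
      sum (λ i → wU i * (U ++ A) (i ↑ˡ s) k) + sum (λ j → wA j * (U ++ A) (r ↑ʳ j) k)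
        ≈⟨ sum-++ r (λ i → w i * (U ++ A) i k) ⟨
      sum (λ i → w i * (U ++ A) i k)
        ≈⟨ eq k ⟩
      0# ∎

    z⊥y : z ⟂ y
    z⊥y = ⟂-combine {u = z} {A} wA (λ j → ⟂-sym {A j} {z} (⟂-combine {u = A j} {U} wU (λ i → ⟂-sym {U i} {A j} (U⊥A i j))))

    z≋𝟎 : z ≋ 𝟎
    z≋𝟎 = ⟨z,z⟩≈0⇒z≋𝟎 z (begin
      ⟨ z , z ⟩              ≈⟨ +-identityʳ _ ⟨
      ⟨ z , z ⟩ + 0#         ≈⟨ +-congˡ z⊥y ⟨
      ⟨ z , z ⟩ + ⟨ z , y ⟩  ≈⟨ ⟨⟩-⊕ z z y ⟨
      ⟨ z , z ⊕ y ⟩          ≈⟨ ⟨⟩-congˡ {z} z+y≋𝟎 ⟩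
      ⟨ z , 𝟎 ⟩              ≈⟨ ⟨⟩-zeroʳ z ⟩
      0#                     ∎)

    wA≈0 : ∀ j → wA j ≈ 0#
    wA≈0 = indep wA λ k → trans (sym (trans (+-congʳ (z≋𝟎 k)) (+-identityˡ _))) (z+y≋𝟎 k)

    nonzero : ∃ λ i → wU i ≉ 0#
    nonzero with splitAt r l in split
    ... | inj₁ i = i , λ p → wl≉0 (trans (reflexive (≡.cong w (≡.sym (Fin.splitAt⁻¹-↑ˡ split)))) p)
    ... | inj₂ j = contradiction (trans (reflexive (≡.cong w (≡.sym (Fin.splitAt⁻¹-↑ʳ split)))) (wA≈0 j)) wl≉0

  -- The dual form of linear independence, for three vectors.
  Spanning : Vector Point 3 → Set
  Spanning v = ∀ u → (∀ m → u ⟂ v m) → u ≋ 𝟎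

  -- The four vectors `u`, `v 0F`, `v 1F`, `v 2F` are dependent in space; since `u` is orthogonal to
  -- the others, the relation can be taken to involve `u` alone.
  independent⇒spanning : ∀ {v : Vector Point 3} → LinearlyIndependent v → Spanning v
  independent⇒spanning {v} indep u u⊥v =
    zero-vector (orthogonal-dependent {1} {3} {u ∷ []} {v} indep (λ { 0F → u⊥v }) (dependent {0} ((u ∷ []) ++ v)))
    where
    zero-vector : LinearlyDependent (u ∷ []) → u ≋ 𝟎
    zero-vector (w , (0F , w≉0) , eq) k = x*y≈0⇒y≈0 w≉0 (trans (sym (+-identityʳ _)) (eq k))

  -- Elimination is applied to the transposed matrix: a relation among its rows is exactly a vector
  -- orthogonal to every `v m`.
  spanning? : (v : Vector Point 3) → Spanning v ⊎ ∃ λ u → ¬ (u ≋ 𝟎) × (∀ m → u ⟂ v m)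
  spanning? v with independent⊎dependent (λ k m → v m k)
  ... | inj₁ (indep , _) = inj₁ indep
  ... | inj₂ (u , (k , uk≉0) , u⊥v) = inj₂ (u , (λ eq → uk≉0 (eq k)) , u⊥v)

  -- The prescribed values `e` and the three coordinate rows of `v` are four vectors in a space of
  -- dimension three. `Spanning` forces a nonzero weight on `e` in a relation among them, so the
  -- relation can be solved for `e`.
  interpolate : ∀ {v} → Spanning v → (e : Vector Carrier 3) → ∃ λ t → ∀ m → ⟨ t , v m ⟩ ≈ e m
  interpolate {v} spanning e = solution (dependent {0} (e ∷ (λ k m → v m k)))
    where
    solution : LinearlyDependent (e ∷ (λ k m → v m k)) → ∃ λ t → ∀ m → ⟨ t , v m ⟩ ≈ e m
    solution (w , (i , wi≉0) , eq) = (- w₀⁻¹) ⊙ tail w , λ m → begin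
      ⟨ (- w₀⁻¹) ⊙ tail w , v m ⟩      ≈⟨ ⟨⟩-factor {(- w₀⁻¹) ⊙ tail w} {tail w} (λ _ → refl) (v m) ⟩
      - w₀⁻¹ * ⟨ tail w , v m ⟩
        ≈⟨ solve 4 (λ i w e X → (:- i) :* X := (w :* i) :* e :- i :* (w :* e :+ X)) refl w₀⁻¹ (w 0F) (e m) _ ⟩
      w 0F * w₀⁻¹ * e m - w₀⁻¹ * (w 0F * e m + ⟨ tail w , v m ⟩)
        ≈⟨ +-cong (*-congʳ (proj₂ (inverse (w 0F) w₀≉0))) (-‿cong (*-congˡ (eq m))) ⟩
      1# * e m - w₀⁻¹ * 0#             ≈⟨ solve 2 (λ i e → :1 :* e :- i :* :0 := e) refl w₀⁻¹ (e m) ⟩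
      e m ∎
      where
      vanishes : w 0F ≈ 0# → ∀ i → w i ≈ 0#
      vanishes w₀≈0 zero    = w₀≈0
      vanishes w₀≈0 (suc k) = spanning (tail w)
        (λ m → trans (sym (trans (+-congʳ (trans (*-congʳ w₀≈0) (zeroˡ (e m)))) (+-identityˡ _))) (eq m)) k

      w₀≉0 : w 0F ≉ 0#
      w₀≉0 w₀≈0 = wi≉0 (vanishes w₀≈0 i)

      w₀⁻¹ = proj₁ (inverse (w 0F) w₀≉0)

  proportional : ∀ {u v} → ¬ (u ≋ 𝟎) → LinearlyDependent (u ∷ v ∷ []) → Proportional v u
  proportional {u} {v} u≉𝟎 (w , (i , wi≉0) , eq) = - (w₁⁻¹ * w 0F) , λ k → begin
    v k                       ≈⟨ *-identityˡ _ ⟨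
    1# * v k                  ≈⟨ *-congʳ (proj₂ (inverse (w 1F) w₁≉0)) ⟨
    w 1F * w₁⁻¹ * v k
      ≈⟨ solve 5 (λ x y i u v → y :* i :* v := i :* (x :* u :+ (y :* v :+ :0)) :+ (:- (i :* x)) :* u) refl
           (w 0F) (w 1F) w₁⁻¹ (u k) (v k) ⟩
    w₁⁻¹ * (w 0F * u k + (w 1F * v k + 0#)) + - (w₁⁻¹ * w 0F) * u k
      ≈⟨ +-congʳ (trans (*-congˡ (eq k)) (zeroʳ _)) ⟩
    0# + - (w₁⁻¹ * w 0F) * u k   ≈⟨ +-identityˡ _ ⟩
    - (w₁⁻¹ * w 0F) * u k        ∎
    where
    w₀*u≈0 : w 1F ≈ 0# → ∀ k → w 0F * u k ≈ 0#
    w₀*u≈0 w₁≈0 k = begin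
      w 0F * u k                         ≈⟨ solve 2 (λ x v → x := x :+ (:0 :* v :+ :0)) refl (w 0F * u k) (v k) ⟩
      w 0F * u k + (0# * v k + 0#)       ≈⟨ +-congˡ (+-congʳ (*-congʳ w₁≈0)) ⟨
      w 0F * u k + (w 1F * v k + 0#)     ≈⟨ eq k ⟩
      0#                                 ∎

    vanishes : w 1F ≈ 0# → ∀ i → w i ≈ 0#
    vanishes w₁≈0 1F = w₁≈0
    vanishes w₁≈0 0F with w 0F ≟ 0#
    ... | yes p = p
    ... | no  p = contradiction (λ k → x*y≈0⇒y≈0 p (w₀*u≈0 w₁≈0 k)) u≉𝟎

    w₁≉0 : w 1F ≉ 0#
    w₁≉0 w₁≈0 = wi≉0 (vanishes w₁≈0 i)

    w₁⁻¹ = proj₁ (inverse (w 1F) w₁≉0)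

  independent⊎proportional : ∀ u v → ¬ (u ≋ 𝟎) → LinearlyIndependent (u ∷ v ∷ []) ⊎ Proportional v u
  independent⊎proportional u v u≉𝟎 with independent⊎dependent (u ∷ v ∷ [])
  ... | inj₁ (indep , _) = inj₁ indep
  ... | inj₂ dep         = inj₂ (proportional u≉𝟎 dep)

  -- The annihilator of a plane is a line: `u`, `v`, `a`, `b` are dependent, and by orthogonality
  -- there is a relation between `u` and `v` alone.
  annihilators-proportional : ∀ {a b u v} → LinearlyIndependent (a ∷ b ∷ []) → ¬ (u ≋ 𝟎) →
    u ⟂ a → u ⟂ b → v ⟂ a → v ⟂ b → Proportional v u
  annihilators-proportional {a} {b} {u} {v} indep u≉𝟎 u⊥a u⊥b v⊥a v⊥b =
    proportional u≉𝟎 (orthogonal-dependent {2} {2} {u ∷ v ∷ []} {a ∷ b ∷ []} indep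
      (λ { 0F 0F → u⊥a ; 0F 1F → u⊥b ; 1F 0F → v⊥a ; 1F 1F → v⊥b })
      (dependent {0} ((u ∷ v ∷ []) ++ (a ∷ b ∷ []))))

  relation : ∀ {r} {v : Vector Point r} {w} → (∀ k → sum (λ i → w i * v i k) ≈ 0#) →
             ∀ u → sum (λ i → w i * ⟨ u , v i ⟩) ≈ 0#
  relation {v = v} {w} eq u = trans (sym (⟨⟩-combine u w v)) (trans (⟨⟩-congˡ {u} eq) (⟨⟩-zeroʳ u))

-- Parallel supporting planes as affine functionals with values in the unit interval.

module Separation (ℝ : Reals) where

  open Reals ℝ hiding (zero)
  open Geometry ℝ
  open Segment
  open Plane
  open OrderedField ℝ
  open LinearAlgebra ℝ
  open IntegerCoefficients commutativeRing
  open SemiringSum semiring using (sum; sum-cong-≋; ∑-distrib-+; *-distribʳ-sum)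
  open SetoidReasoning setoid

  record Affine : Set where
    constructor affine
    infix 25 _·_
    field
      linear   : Point
      constant : Carrier

    _·_ : Point → Carrier
    _·_ p = ⟨ linear , p ⟩ + constant

  open Affine

  ·-cong : ∀ f {p q} → p ≋ q → f · p ≈ f · q
  ·-cong f p≋q = +-congʳ (⟨⟩-congˡ {linear f} p≋q)

  ·-⊖ : ∀ f p q → ⟨ linear f , p ⊖ q ⟩ ≈ f · p - f · q
  ·-⊖ f p q = trans (⟨⟩-⊖ (linear f) p q)
    (solve 3 (λ x y c → x :- y := x :+ c :- (y :+ c)) refl _ _ (constant f))

  ·-at : ∀ f s t → f · at s t ≈ (1# - t) * f · source s + t * f · target s
  ·-at f s t = begin
    ⟨ u , (1# - t) ⊙ source s ⊕ t ⊙ target s ⟩ + constant f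
      ≈⟨ +-congʳ (⟨⟩-⊕ u ((1# - t) ⊙ source s) (t ⊙ target s)) ⟩
    ⟨ u , (1# - t) ⊙ source s ⟩ + ⟨ u , t ⊙ target s ⟩ + constant f
      ≈⟨ +-congʳ (+-cong (⟨⟩-⊙ u (1# - t) (source s)) (⟨⟩-⊙ u t (target s))) ⟩
    (1# - t) * ⟨ u , source s ⟩ + t * ⟨ u , target s ⟩ + constant f
      ≈⟨ solve 4 (λ t a b c → (:1 :- t) :* a :+ t :* b :+ c := (:1 :- t) :* (a :+ c) :+ t :* (b :+ c)) refl
           t _ _ (constant f) ⟩
    (1# - t) * f · source s + t * f · target s ∎
    where u = linear f

  ·-combine : ∀ f {m} (w : Vector Carrier m) x → sum w ≈ 1# → f · combine w x ≈ sum (λ i → w i * f · x i)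
  ·-combine f w x Σw≈1 = begin
    ⟨ u , combine w x ⟩ + c                              ≈⟨ +-cong (⟨⟩-combine u w x) (trans (sym (*-identityˡ c)) (*-congʳ (sym Σw≈1))) ⟩
    sum (λ i → w i * ⟨ u , x i ⟩) + sum w * c            ≈⟨ +-congˡ (*-distribʳ-sum c w) ⟩
    sum (λ i → w i * ⟨ u , x i ⟩) + sum (λ i → w i * c)  ≈⟨ ∑-distrib-+ (λ i → w i * ⟨ u , x i ⟩) (λ i → w i * c) ⟨
    sum (λ i → w i * ⟨ u , x i ⟩ + w i * c)              ≈⟨ sum-cong-≋ {x = λ i → w i * ⟨ u , x i ⟩ + w i * c} {y = λ i → w i * f · x i} (λ i → sym (distribˡ (w i) ⟨ u , x i ⟩ c)) ⟩
    sum (λ i → w i * f · x i)                            ∎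
    where u = linear f
          c = constant f

  complement : Affine → Affine
  complement f = affine ((- 1#) ⊙ linear f) (1# - constant f)

  ·-complement : ∀ f p → complement f · p ≈ 1# - f · p
  ·-complement f p = begin
    ⟨ (- 1#) ⊙ linear f , p ⟩ + (1# - constant f)  ≈⟨ +-congʳ (⟨⟩-factor {(- 1#) ⊙ linear f} {linear f} (λ _ → refl) p) ⟩
    - 1# * ⟨ linear f , p ⟩ + (1# - constant f)    ≈⟨ solve 2 (λ x c → (:- :1) :* x :+ (:1 :- c) := :1 :- (x :+ c)) refl _ (constant f) ⟩
    1# - f · p                                     ∎

  source-∈ : ∀ s → source s ∈ ⟦ s ⟧
  source-∈ s = 0# , ≤-refl , 0≤1 , λ k → solve 2 (λ a b → a := (:1 :- :0) :* a :+ :0 :* b) refl (source s k) (target s k)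

  target-∈ : ∀ s → target s ∈ ⟦ s ⟧
  target-∈ s = 1# , 0≤1 , ≤-refl , λ k → solve 2 (λ a b → b := (:1 :- :1) :* a :+ :1 :* b) refl (source s k) (target s k)

  midpoint : Segment → Point
  midpoint s = at s ½

  midpoint-∈ : ∀ s → midpoint s ∈ ⟦ s ⟧
  midpoint-∈ s = ½ , proj₁ ½-positive , 0≤y-x⇒x≤y (0≤-cong (sym 1-½≈½) (proj₁ ½-positive)) , λ _ → refl

  direction≉𝟎 : ∀ s → ¬ (direction s ≋ 𝟎)
  direction≉𝟎 s eq = nondegenerate s λ k → sym (x-y≈0⇒x≈y (eq k))

  ∈-union : ∀ {n} (S : Vector Segment n) i {p} → p ∈ ⟦ S i ⟧ → p ∈ conv (union S)
  ∈-union S i {p} p∈S = 1 , (λ _ → 1#) , (λ _ → p) , (λ _ → i , p∈S) , (λ _ → 0≤1) , +-identityʳ 1# ,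
    λ k → solve 1 (λ x → x := :1 :* x :+ :0) refl (p k)

  sum-nonneg : ∀ {n} {x : Vector Carrier n} → (∀ i → 0# ≤ x i) → 0# ≤ sum x
  sum-nonneg {zero}  0≤x = ≤-refl
  sum-nonneg {suc n} 0≤x = +-nonneg (0≤x 0F) (sum-nonneg (0≤x ∘ suc))

  sum≈0⇒≈0 : ∀ {n} {x : Vector Carrier n} → (∀ i → 0# ≤ x i) → sum x ≈ 0# → ∀ i → x i ≈ 0#
  sum≈0⇒≈0 {suc n} {x} 0≤x eq zero    = x+y≈0⇒x≈0 (0≤x 0F) (sum-nonneg {n} {tail x} (0≤x ∘ suc)) eq
  sum≈0⇒≈0 {suc n} {x} 0≤x eq (suc i) = sum≈0⇒≈0 {n} {tail x} (0≤x ∘ suc)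
    (x+y≈0⇒x≈0 (sum-nonneg {n} {tail x} (0≤x ∘ suc)) (0≤x 0F) (trans (+-comm _ _) eq)) i

  conv-nonneg : ∀ f {X p} → (∀ {x} → x ∈ X → 0# ≤ f · x) → p ∈ conv X → 0# ≤ f · p
  conv-nonneg f 0≤f (m , w , x , x∈X , 0≤w , Σw≈1 , p≋) = 0≤-cong
    (sym (trans (·-cong f p≋) (·-combine f w x Σw≈1)))
    (sum-nonneg {m} (λ i → *-nonneg (0≤w i) (0≤f (x∈X i))))

  -- Points of weight zero may be anywhere.
  segment-convex : ∀ s {m} (w : Vector Carrier m) (x : Vector Point m) → (∀ i → w i ≈ 0# ⊎ x i ∈ ⟦ s ⟧) →
                   (∀ i → 0# ≤ w i) → sum w ≈ 1# → combine w x ∈ ⟦ s ⟧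
  segment-convex s {m} w x position 0≤w Σw≈1 = T , 0≤T , T≤1 , combination
    where
    parameter : ∀ {i} → w i ≈ 0# ⊎ x i ∈ ⟦ s ⟧ → Carrier
    -- A point of weight zero may have no parameter on `s`; the default is harmless because it is
    -- only used multiplied by that weight.
    parameter (inj₁ _)       = 0#
    parameter (inj₂ (t , _)) = t

    t : Vector Carrier m
    t i = parameter {i} (position i)

    T = sum (λ i → w i * t i)

    lower : ∀ {i} (pos : w i ≈ 0# ⊎ x i ∈ ⟦ s ⟧) → 0# ≤ parameter {i} pos
    lower (inj₁ _)               = ≤-refl
    lower (inj₂ (_ , 0≤t , _))   = 0≤t

    upper : ∀ {i} (pos : w i ≈ 0# ⊎ x i ∈ ⟦ s ⟧) → 0# ≤ 1# - parameter {i} pos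
    upper (inj₁ _)                 = x≤y⇒0≤y-x 0≤1
    upper (inj₂ (_ , _ , t≤1 , _)) = x≤y⇒0≤y-x t≤1

    1-T : 1# - T ≈ sum (λ i → w i * (1# - t i))
    1-T = begin
      1# - T                                   ≈⟨ +-congʳ Σw≈1 ⟨
      sum w - T                                ≈⟨ sum-difference w t ⟩
      sum (λ i → w i * (1# - t i))             ∎
      where
      sum-difference : ∀ {m} (w t : Vector Carrier m) →
        sum w - sum (λ i → w i * t i) ≈ sum (λ i → w i * (1# - t i))
      sum-difference {zero}  w t = -‿inverseʳ 0#
      sum-difference {suc m} w t = trans
        (solve 4 (λ w t W R → w :+ W :- (w :* t :+ R) := w :* (:1 :- t) :+ (W :- R)) refl (w 0F) (t 0F) _ _)
        (+-congˡ (sum-difference (tail w) (tail t)))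

    0≤T : 0# ≤ T
    0≤T = sum-nonneg {m} (λ i → *-nonneg (0≤w i) (lower {i} (position i)))

    T≤1 : T ≤ 1#
    T≤1 = 0≤y-x⇒x≤y (0≤-cong (sym 1-T) (sum-nonneg {m} (λ i → *-nonneg (0≤w i) (upper {i} (position i)))))

    term : ∀ i (pos : w i ≈ 0# ⊎ x i ∈ ⟦ s ⟧) k →
      w i * x i k ≈ w i * (1# - parameter {i} pos) * source s k + w i * parameter {i} pos * target s k
    term i (inj₁ wi≈0) k = trans (trans (*-congʳ wi≈0) (zeroˡ (x i k)))
      (sym (trans (+-cong (*-congʳ (*-congʳ wi≈0)) (*-congʳ (*-congʳ wi≈0)))
        (solve 3 (λ z a b → :0 :* z :* a :+ :0 :* :0 :* b := :0) refl (1# - 0#) (source s k) (target s k))))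
    term i (inj₂ (t , _ , _ , x≋)) k = trans (*-congˡ (x≋ k))
      (solve 4 (λ w t a b → w :* ((:1 :- t) :* a :+ t :* b) := w :* (:1 :- t) :* a :+ w :* t :* b) refl
        (w i) t (source s k) (target s k))

    combination : combine w x ≋ at s T
    combination k = begin
      sum (λ i → w i * x i k)
        ≈⟨ sum-cong-≋ {x = λ i → w i * x i k} {y = λ i → w i * (1# - t i) * a + w i * t i * b}
             (λ i → term i (position i) k) ⟩
      sum (λ i → w i * (1# - t i) * a + w i * t i * b)
        ≈⟨ ∑-distrib-+ (λ i → w i * (1# - t i) * a) (λ i → w i * t i * b) ⟩
      sum (λ i → w i * (1# - t i) * a) + sum (λ i → w i * t i * b)
        ≈⟨ +-cong (*-distribʳ-sum a (λ i → w i * (1# - t i))) (*-distribʳ-sum b (λ i → w i * t i)) ⟨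
      sum (λ i → w i * (1# - t i)) * a + T * b
        ≈⟨ +-congʳ (*-congʳ 1-T) ⟨
      (1# - T) * a + T * b ∎
      where a = source s k
            b = target s k

  -- The bounds concern points of the segments only; `conv-nonneg` carries them over to the hull.
  -- The upper bound is written as nonnegativity of `1# - f · p`, so that `complement` exchanges it
  -- with the lower one.
  record Separator {n} (S : Vector Segment n) (i j : Fin n) : Set where
    field
      f    : Affine
      ≈0   : ∀ {p} → p ∈ ⟦ S i ⟧ → f · p ≈ 0#
      ≈1   : ∀ {p} → p ∈ ⟦ S j ⟧ → f · p ≈ 1#
      ≥0   : ∀ k {p} → p ∈ ⟦ S k ⟧ → 0# ≤ f · p
      ≤1   : ∀ k {p} → p ∈ ⟦ S k ⟧ → 0# ≤ 1# - f · p

    source≈0 : f · source (S i) ≈ 0#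
    source≈0 = ≈0 (source-∈ (S i))

    source≈1 : f · source (S j) ≈ 1#
    source≈1 = ≈1 (source-∈ (S j))

    source≥0 : ∀ k → 0# ≤ f · source (S k)
    source≥0 k = ≥0 k (source-∈ (S k))

    source≤1 : ∀ k → 0# ≤ 1# - f · source (S k)
    source≤1 k = ≤1 k (source-∈ (S k))

    ⟂ⁱ : linear f ⟂ direction (S i)
    ⟂ⁱ = trans (·-⊖ f (target (S i)) (source (S i)))
           (x≈y⇒x-y≈0 (trans (≈0 (target-∈ (S i))) (sym source≈0)))

    ⟂ʲ : linear f ⟂ direction (S j)
    ⟂ʲ = trans (·-⊖ f (target (S j)) (source (S j)))
           (x≈y⇒x-y≈0 (trans (≈1 (target-∈ (S j))) (sym source≈1)))

    rise : ⟨ linear f , source (S j) ⊖ source (S i) ⟩ ≈ 1#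
    rise = trans (·-⊖ f (source (S j)) (source (S i)))
      (trans (+-cong source≈1 (-‿cong source≈0))
        1-0≈1)

    linear≉𝟎 : ¬ (linear f ≋ 𝟎)
    linear≉𝟎 u≋𝟎 = 1≉0 (trans (sym rise)
      (trans (⟨⟩-congʳ {linear f} {𝟎} {source (S j) ⊖ source (S i)} u≋𝟎)
        (trans (⟨⟩-comm 𝟎 (source (S j) ⊖ source (S i))) (⟨⟩-zeroʳ (source (S j) ⊖ source (S i))))))

  reverse : ∀ {n} {S : Vector Segment n} {i j} → Separator S i j → Separator S j i
  reverse {S = S} sep = record
    { f    = complement f
    ; ≈0 = λ {p} p∈ → trans (·-complement f p) (x≈y⇒x-y≈0 (sym (≈1 p∈)))
    ; ≈1  = λ {p} p∈ → trans (·-complement f p) (trans (+-congˡ (-‿cong (≈0 p∈))) 1-0≈1)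
    ; ≥0   = λ k {p} p∈ → 0≤-cong (sym (·-complement f p)) (≤1 k p∈)
    ; ≤1   = λ k {p} p∈ → 0≤-cong (trans (x≈1-[1-x] (f · p))
                                     (+-congˡ (-‿cong (sym (·-complement f p))))) (≥0 k p∈)
    }
    where open Separator sep

  -- The two inequations ensure that the faces of the hull on which `f` is 0 or 1 contain nothing
  -- beyond the two segments.
  record StrictSeparator {n} (S : Vector Segment n) (i j : Fin n) : Set where
    field
      separator : Separator S i j

    open Separator separator public

    field
      ≉0 : ∀ {k p} → k ≢ i → p ∈ ⟦ S k ⟧ → f · p ≉ 0#
      ≉1 : ∀ {k p} → k ≢ j → p ∈ ⟦ S k ⟧ → f · p ≉ 1#

  reverse-strict : ∀ {n} {S : Vector Segment n} {i j} → StrictSeparator S i j → StrictSeparator S j i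
  reverse-strict sep = record
    { separator = reverse separator
    ; ≉0 = λ {_} {p} k≢j p∈ eq → ≉1 k≢j p∈ (sym (x-y≈0⇒x≈y (trans (sym (·-complement f p)) eq)))
    ; ≉1 = λ {_} {p} k≢i p∈ eq → ≉0 k≢i p∈ (begin
        f · p                  ≈⟨ x≈1-[1-x] (f · p) ⟩
        1# - (1# - f · p)      ≈⟨ +-congˡ (-‿cong (trans (sym (·-complement f p)) eq)) ⟩
        1# - 1#                ≈⟨ -‿inverseʳ 1# ⟩
        0#                     ∎)
    }
    where open StrictSeparator sep

  -- A convex combination of nonnegative values is zero only if each term is zero. Points outside
  -- `S i` have a nonzero value, hence weight zero, and the remaining ones combine to a point of the
  -- segment.
  zero-set : ∀ {n} {S : Vector Segment n} {i j} (sep : StrictSeparator S i j) →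
    ∀ {p} → p ∈ conv (union S) → StrictSeparator.f sep · p ≈ 0# → p ∈ ⟦ S i ⟧
  zero-set {n} {S} {i} sep {p} (m , w , x , x∈ , 0≤w , Σw≈1 , p≋) fp≈0 =
    let t , 0≤t , t≤1 , ≋at = segment-convex (S i) w x position 0≤w Σw≈1
    in t , 0≤t , t≤1 , λ k → trans (p≋ k) (≋at k)
    where
    open StrictSeparator sep

    term : ∀ l → w l * f · x l ≈ 0#
    term = sum≈0⇒≈0 (λ l → *-nonneg (0≤w l) (≥0 (proj₁ (x∈ l)) (proj₂ (x∈ l))))
      (trans (sym (·-combine f w x Σw≈1)) (trans (sym (·-cong f p≋)) fp≈0))

    position : ∀ l → w l ≈ 0# ⊎ x l ∈ ⟦ S i ⟧
    position l = decide (x∈ l) (proj₁ (x∈ l) Fin.≟ i)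
      where
      decide : (x∈S : x l ∈ union S) → Dec (proj₁ x∈S ≡ i) → w l ≈ 0# ⊎ x l ∈ ⟦ S i ⟧
      decide (k , x∈S) (yes ≡.refl) = inj₂ x∈S
      decide (k , x∈S) (no k≢i)     = inj₁ (x*y≈0⇒y≈0 (≉0 k≢i x∈S) (trans (*-comm _ _) (term l)))

  Separated : ∀ {n} → Vector Segment n → Set
  Separated S = ∀ i j → i ≢ j → Separator S i j

  StrictlySeparated : ∀ {n} → Vector Segment n → Set
  StrictlySeparated S = ∀ i j → i ≢ j → StrictSeparator S i j

  strictly-separated⇒separated : ∀ {n} {S : Vector Segment n} → StrictlySeparated S → Separated S
  strictly-separated⇒separated sep i j i≢j = StrictSeparator.separator (sep i j i≢j)

  module _ {n} {S : Vector Segment n} {i j} (sep : Separator S i j) where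
    open Separator sep

    lowerPlane upperPlane : Plane
    lowerPlane = plane (linear f) (- constant f) linear≉𝟎
    upperPlane = plane (linear f) (1# - constant f) linear≉𝟎

    lowerPlane⇒0 : ∀ {p} → p ∈ planeSet lowerPlane → f · p ≈ 0#
    lowerPlane⇒0 eq = trans (+-congʳ eq) (-‿inverseˡ (constant f))

    0⇒lowerPlane : ∀ {p} → f · p ≈ 0# → p ∈ planeSet lowerPlane
    0⇒lowerPlane {p} eq = x-y≈0⇒x≈y (trans (solve 2 (λ x c → x :- (:- c) := x :+ c) refl _ (constant f)) eq)

    upperPlane⇒1 : ∀ {p} → p ∈ planeSet upperPlane → f · p ≈ 1#
    upperPlane⇒1 eq = trans (+-congʳ eq) (solve 1 (λ c → :1 :- c :+ c := :1) refl (constant f))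

    1⇒upperPlane : ∀ {p} → f · p ≈ 1# → p ∈ planeSet upperPlane
    1⇒upperPlane {p} eq = x-y≈0⇒x≈y
      (trans (solve 2 (λ x c → x :- (:1 :- c) := x :+ c :- :1) refl _ (constant f)) (x≈y⇒x-y≈0 eq))

    parallel-supports : ParallelSupports (conv (union S)) lowerPlane upperPlane
    parallel-supports = record
      { different = λ (lower⊆upper , _) → 1≉0 (trans (sym (upperPlane⇒1 {source (S i)}
          (lower⊆upper {source (S i)} (0⇒lowerPlane {source (S i)} source≈0))))
          source≈0)
      ; parallel  = 1# , λ k → sym (*-identityˡ _)
      ; supports  = (source (S i) , ∈-union S i (source-∈ (S i)) , 0⇒lowerPlane {source (S i)} source≈0) ,
          inj₂ (λ {p} p∈ → 0≤y-x⇒x≤y (0≤-cong (solve 2 (λ x c → x :+ c := x :- (:- c)) refl ⟨ linear f , p ⟩ (constant f))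
                 (conv-nonneg f {union S} (λ (k , x∈) → ≥0 k x∈) p∈)))
      ; supports′ = (source (S j) , ∈-union S j (source-∈ (S j)) , 1⇒upperPlane {source (S j)} source≈1) ,
          inj₁ (λ {p} p∈ → 0≤y-x⇒x≤y (0≤-cong
                 (trans (·-complement f p) (solve 2 (λ x c → :1 :- (x :+ c) := :1 :- c :- x) refl ⟨ linear f , p ⟩ (constant f)))
                 (conv-nonneg (complement f) {union S} (λ {x} (k , x∈) → 0≤-cong (sym (·-complement f x)) (≤1 k x∈)) p∈)))
      }

  separated⇒antipodal : ∀ {n} {S : Vector Segment n} → Separated S → Antipodal S
  separated⇒antipodal sep i j i≢j =
    lowerPlane s , upperPlane s , parallel-supports s ,
    (λ {p} p∈ → 0⇒lowerPlane s {p} (Separator.≈0 s p∈)) , (λ {p} p∈ → 1⇒upperPlane s {p} (Separator.≈1 s p∈))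
    where s = sep i j i≢j

  strictly-separated⇒strictly-antipodal : ∀ {n} {S : Vector Segment n} → StrictlySeparated S → StrictlyAntipodal S
  strictly-separated⇒strictly-antipodal {S = S} sep i j i≢j =
    lowerPlane s , upperPlane s , parallel-supports s ,
    ((λ {p} p∈ → ∈-union S i p∈ , 0⇒lowerPlane s {p} (≈0 p∈)) ,
     (λ {p} (p∈P , p∈H) → zero-set (sep i j i≢j) p∈P (lowerPlane⇒0 s {p} p∈H))) ,
    ((λ {p} p∈ → ∈-union S j p∈ , 1⇒upperPlane s {p} (≈1 p∈)) ,
     (λ {p} (p∈P , p∈H) → zero-set (reverse-strict (sep i j i≢j)) p∈P
        (trans (·-complement f p) (x≈y⇒x-y≈0 (sym (upperPlane⇒1 s {p} p∈H))))))
    where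
    s = StrictSeparator.separator (sep i j i≢j)
    open Separator s

  private
    -- The factor `κ` has the sign of `y₀`. Both signs occur, since a supporting plane may bound the
    -- body from either side.
    same-sign : ∀ {κ y₀ y} → κ * y₀ ≈ 1# → (0# ≤ y₀ × 0# ≤ y) ⊎ (0# ≤ - y₀ × 0# ≤ - y) → 0# ≤ κ * y
    same-sign {κ} {y₀} {y} eq = λ where
        (inj₁ (p , q)) → *-cancelˡ-nonneg (positive p y₀≉0) (0≤-cong (sym y₀*κy≈y) q)
        (inj₂ (p , q)) → *-cancelˡ-nonneg (positive p λ -y₀≈0 → y₀≉0 (-x≈0⇒x≈0 -y₀≈0))
                           (0≤-cong (trans (-‿cong (sym y₀*κy≈y)) (solve 2 (λ x z → :- (x :* z) := (:- x) :* z) refl y₀ (κ * y))) q)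
      where
      y₀≉0 : y₀ ≉ 0#
      y₀≉0 y₀≈0 = 1≉0 (trans (sym eq) (trans (*-congˡ y₀≈0) (zeroʳ κ)))

      y₀*κy≈y : y₀ * (κ * y) ≈ y
      y₀*κy≈y = trans (solve 3 (λ κ x y → x :* (κ :* y) := κ :* x :* y) refl κ y₀ y) (trans (*-congʳ eq) (*-identityˡ y))

    same-side : ∀ H {P} → Supports H P → ∀ {p q} → p ∈ P → q ∈ P →
      let g = λ x → ⟨ normal H , x ⟩ - offset H in (0# ≤ g p × 0# ≤ g q) ⊎ (0# ≤ - g p × 0# ≤ - g q)
    same-side H (_ , inj₁ lower) {p} {q} p∈ q∈ = inj₂ (negative p (lower p∈) , negative q (lower q∈))
      where
      negative : ∀ x → ⟨ normal H , x ⟩ ≤ offset H → 0# ≤ - (⟨ normal H , x ⟩ - offset H)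
      negative x le = 0≤-cong (solve 2 (λ a b → b :- a := :- (a :- b)) refl ⟨ normal H , x ⟩ (offset H)) (x≤y⇒0≤y-x le)
    same-side H (_ , inj₂ upper) p∈ q∈ = inj₁ (x≤y⇒0≤y-x (upper p∈) , x≤y⇒0≤y-x (upper q∈))

  -- Both planes are level sets of `u`, at the heights `a` and `c * b`. They differ, so `δ` is
  -- invertible and rescaling by `κ` moves the heights to 0 and 1. The segment `S j` tells on which
  -- side of `H` the body lies, and `S i` does the same for `H′`. The inclusions of the level sets
  -- in `H` and `H′` serve the strict case.
  planes⇒separator : ∀ {n} {S : Vector Segment n} i j {H H′} → ParallelSupports (conv (union S)) H H′ →
    ⟦ S i ⟧ ⊆ planeSet H → ⟦ S j ⟧ ⊆ planeSet H′ →
    Σ[ sep ∈ Separator S i j ]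
      (∀ {p} → Separator.f sep · p ≈ 0# → p ∈ planeSet H) × (∀ {p} → Separator.f sep · p ≈ 1# → p ∈ planeSet H′)
  planes⇒separator {n} {S} i j {H} {H′} ps Si⊆H Sj⊆H′ = record
    { f    = affine (κ ⊙ u) (- (κ * a))
    ; ≈0 = λ {p} p∈ → trans (value p) (trans (*-congˡ (x≈y⇒x-y≈0 (Si⊆H p∈))) (zeroʳ κ))
    ; ≈1  = λ {p} p∈ → trans (value p) (trans (*-congˡ (+-congʳ (trans (u≈cu′ p) (*-congˡ (Sj⊆H′ p∈))))) κ*δ≈1)
    ; ≥0   = λ k {p} p∈ → 0≤-cong (sym (value p))
        (same-sign (trans (*-congˡ (+-congʳ (trans (u≈cu′ q) (*-congˡ (Sj⊆H′ (source-∈ (S j))))))) κ*δ≈1)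
          (same-side H supports (∈-union S j (source-∈ (S j))) (∈-union S k p∈)))
    ; ≤1   = λ k {p} p∈ → 0≤-cong (sym (value′ p))
        (same-sign (trans (sym (value′ o)) (trans (+-congˡ (-‿cong (trans (value o) (trans (*-congˡ (x≈y⇒x-y≈0 (Si⊆H (source-∈ (S i))))) (zeroʳ κ))))) 1-0≈1))
          (same-side H′ supports′ (∈-union S i (source-∈ (S i))) (∈-union S k p∈)))
    }
    , (λ {p} eq → x-y≈0⇒x≈y (x*y≈0⇒y≈0 κ≉0 (trans (sym (value p)) eq)))
    , (λ {p} eq → x-y≈0⇒x≈y (x*y≈0⇒y≈0 -κc≉0 (trans (sym (value′ p)) (x≈y⇒x-y≈0 (sym eq)))))
    where
    open ParallelSupports ps
    u = normal H
    a = offset H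
    u′ = normal H′
    b = offset H′
    c = proj₁ parallel
    o = source (S i)
    q = source (S j)

    u≈cu′ : ∀ p → ⟨ u , p ⟩ ≈ c * ⟨ u′ , p ⟩
    u≈cu′ = ⟨⟩-factor {u} {u′} (proj₂ parallel)

    c≉0 : c ≉ 0#
    c≉0 c≈0 = nonzero H λ k → trans (proj₂ parallel k) (trans (*-congʳ c≈0) (zeroˡ (u′ k)))

    δ = c * b - a

    δ≉0 : δ ≉ 0#
    δ≉0 δ≈0 = different
      ( (λ {p} p∈H → *-cancelˡ c≉0 (trans (sym (u≈cu′ p)) (trans p∈H (sym cb≈a))))
      , (λ {p} p∈H′ → trans (u≈cu′ p) (trans (*-congˡ p∈H′) cb≈a)))
      where
      cb≈a : c * b ≈ a
      cb≈a = x-y≈0⇒x≈y δ≈0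

    κ = proj₁ (inverse δ δ≉0)

    κ*δ≈1 : κ * δ ≈ 1#
    κ*δ≈1 = trans (*-comm κ δ) (proj₂ (inverse δ δ≉0))

    value : ∀ p → affine (κ ⊙ u) (- (κ * a)) · p ≈ κ * (⟨ u , p ⟩ - a)
    value p = trans (+-congʳ (⟨⟩-factor {κ ⊙ u} {u} (λ _ → refl) p))
      (solve 3 (λ κ x a → κ :* x :+ (:- (κ :* a)) := κ :* (x :- a)) refl κ ⟨ u , p ⟩ a)

    value′ : ∀ p → 1# - affine (κ ⊙ u) (- (κ * a)) · p ≈ - (κ * c) * (⟨ u′ , p ⟩ - b)
    value′ p = begin
      1# - affine (κ ⊙ u) (- (κ * a)) · p      ≈⟨ +-cong (sym κ*δ≈1) (-‿cong (trans (value p) (*-congˡ (+-congʳ (u≈cu′ p))))) ⟩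
      κ * δ - κ * (c * ⟨ u′ , p ⟩ - a)         ≈⟨ solve 5 (λ κ c b a x → κ :* (c :* b :- a) :- κ :* (c :* x :- a)
                                                                     := (:- (κ :* c)) :* (x :- b)) refl κ c b a ⟨ u′ , p ⟩ ⟩
      - (κ * c) * (⟨ u′ , p ⟩ - b)             ∎

    κ≉0 : κ ≉ 0#
    κ≉0 κ≈0 = 1≉0 (trans (sym κ*δ≈1) (trans (*-congʳ κ≈0) (zeroˡ δ)))

    -κc≉0 : - (κ * c) ≉ 0#
    -κc≉0 eq = *-≉0 κ≉0 c≉0 (-x≈0⇒x≈0 eq)

  antipodal⇒separated : ∀ {n} {S : Vector Segment n} → Antipodal S → Separated S
  antipodal⇒separated anti i j i≢j =
    let _ , _ , ps , Si⊆H , Sj⊆H′ = anti i j i≢j in proj₁ (planes⇒separator i j ps Si⊆H Sj⊆H′)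

  strictly-antipodal⇒antipodal : ∀ {n} {S : Vector Segment n} → StrictlyAntipodal S → Antipodal S
  strictly-antipodal⇒antipodal anti i j i≢j =
    let H , H′ , ps , (Si⊆ , _) , (Sj⊆ , _) = anti i j i≢j
    in H , H′ , ps , (λ p∈ → proj₂ (Si⊆ p∈)) , (λ p∈ → proj₂ (Sj⊆ p∈))

  separated⇒disjoint : ∀ {n} {S : Vector Segment n} → Separated S → ∀ {i j p} → i ≢ j → p ∈ ⟦ S i ⟧ → ¬ (p ∈ ⟦ S j ⟧)
  separated⇒disjoint sep {i} {j} i≢j p∈Si p∈Sj = 1≉0 (trans (sym (≈1 p∈Sj)) (≈0 p∈Si))
    where open Separator (sep i j i≢j)

  -- A point of another segment at height 0 lies both in the hull and in `H`, hence on `S i`; but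
  -- distinct segments are disjoint because their separator takes the values 0 and 1 on them. Height
  -- 1 is analogous.
  strictly-antipodal⇒strictly-separated : ∀ {n} {S : Vector Segment n} → StrictlyAntipodal S → StrictlySeparated S
  strictly-antipodal⇒strictly-separated {S = S} anti i j i≢j =
    let H , H′ , ps , (Si⊆ , Si⊇) , (Sj⊆ , Sj⊇) = anti i j i≢j
        sep , zero⇒H , one⇒H′ = planes⇒separator {S = S} i j {H} {H′} ps (λ p∈ → proj₂ (Si⊆ p∈)) (λ p∈ → proj₂ (Sj⊆ p∈))
    in record
      { separator = sep
      ; ≉0 = λ {k} {p} k≢i p∈ eq → separated⇒disjoint separated k≢i p∈ (Si⊇ (∈-union S k p∈ , zero⇒H {p} eq))
      ; ≉1 = λ {k} {p} k≢j p∈ eq → separated⇒disjoint separated k≢j p∈ (Sj⊇ (∈-union S k p∈ , one⇒H′ {p} eq))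
      }
    where
    separated : Separated S
    separated = antipodal⇒separated {S = S} (strictly-antipodal⇒antipodal {S = S} anti)

  restrict : ∀ {m n} {S : Vector Segment n} (ι : Fin m → Fin n) → (∀ {i j} → ι i ≡ ι j → i ≡ j) →
             Separated S → Separated (S ∘ ι)
  restrict ι injective sep i j i≢j = record
    { f = f ; ≈0 = ≈0 ; ≈1 = ≈1 ; ≥0 = λ k → ≥0 (ι k) ; ≤1 = λ k → ≤1 (ι k) }
    where open Separator (sep (ι i) (ι j) (i≢j ∘ injective))

  restrict-strict : ∀ {m n} {S : Vector Segment n} (ι : Fin m → Fin n) → (∀ {i j} → ι i ≡ ι j → i ≡ j) →
                    StrictlySeparated S → StrictlySeparated (S ∘ ι)
  restrict-strict {S = S} ι injective sep i j i≢j = record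
    { separator = restrict {S = S} ι injective (strictly-separated⇒separated {S = S} sep) i j i≢j
    ; ≉0 = λ k≢i → ≉0 (k≢i ∘ injective)
    ; ≉1 = λ k≢j → ≉1 (k≢j ∘ injective)
    }
    where open StrictSeparator (sep (ι i) (ι j) (i≢j ∘ injective))

-- Inconsistency of the comparisons between four points under differences of four functions.

module Tournaments (ℝ : Reals) (T : Fin 4 → Fin 4 → Reals.Carrier ℝ) where

  open Reals ℝ hiding (zero)
  open OrderedField ℝ
  open IntegerCoefficients commutativeRing

  -- The index `k` names a function and also a point: the values of `T _ k - T _ l` at the points
  -- `i` and `k` are compared. The comparison with the point `l` is `Δ i l k`, up to sign.
  Δ : Fin 4 → Fin 4 → Fin 4 → Carrier
  Δ i k l = (T i k - T i l) - (T k k - T k l)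

  -- The difference T _ k - T _ l is strictly largest at i and strictly smallest at j.
  record Above (i j k l : Fin 4) : Set where
    constructor above
    field
      Δikl : Positive (Δ i k l)
      Δilk : Positive (- Δ i l k)
      Δjkl : Positive (- Δ j k l)
      Δjlk : Positive (Δ j l k)

  open Above

  -- `Above i j k l` is read as the arc `k > l` of the tournament at `i`, and by `flip` it is also
  -- the arc `l > k` of the tournament at `j`.
  Dichotomy : (i j k l : Fin 4) → Set
  Dichotomy i j k l = Above i j k l ⊎ Above i j l k

  flip : ∀ {i j k l} → Above i j k l → Above j i l k
  flip (above a b c d) = above d c b a

  swap : ∀ {i j k l} → Dichotomy i j k l → Dichotomy j i k l
  swap (inj₁ a) = inj₂ (flip a)
  swap (inj₂ a) = inj₁ (flip a)

  -- In the cycle `k > l > m > k` at `i`, the differences of the functions `k` and `l`, `l` and `m`,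
  -- `m` and `k` are each larger at the point `i` than at the point `m`, although their sum is
  -- identically zero.
  acyclic : ∀ {i k l m} → Above i m k l → Above i k l m → Above i l m k → ⊥
  acyclic {i} {k} {l} {m} a b c =
    Positive⇒≉0 (+-positive (Δjkl a) (+-nonneg (proj₁ (Δikl a)) (+-nonneg (proj₁ (Δilk b)) (proj₁ (Δikl c)))))
      (solve 8 (λ mk ml kk kl ik il im mm →
          (:- (mk :- ml :- (kk :- kl))) :+ (ik :- il :- (kk :- kl) :+
            ((:- (im :- il :- (mm :- ml))) :+ (im :- ik :- (mm :- mk)))) := :0)
        refl (T m k) (T m l) (T k k) (T k l) (T i k) (T i l) (T i m) (T m m))

  private
    -- Here `t`, `m`, `b` are the top, the middle and the bottom of a linear order at `i`. Adding
    -- the excess for `t > m` to that for `m > b` cancels `T i m`.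
    spread : Fin 4 → Fin 4 → Fin 4 → Fin 4 → Carrier
    spread i t m b = Δ i t m - Δ i b m

    spread-positive : ∀ {i j j′ t m b} → Above i j t m → Above i j′ m b → Positive (spread i t m b)
    spread-positive a b = +-positive (Δikl a) (proj₁ (Δilk b))

    no-spreads : ∀ {w x y z} → Positive w → Positive x → Positive y → Positive z → w + (x + (y + z)) ≈ 0# → ⊥
    no-spreads w x y z = Positive⇒≉0 (+-positive w (+-nonneg (proj₁ x) (+-nonneg (proj₁ y) (proj₁ z))))

    :spread : ∀ {n} (it im ib tt tm bb bm : Polynomial n) → Polynomial n
    :spread it im ib tt tm bb bm = ((it :- im) :- (tt :- tm)) :- ((ib :- im) :- (bb :- bm))

  -- If k > l > m at i, then the three remaining comparisons admit eight outcomes.  Five of them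
  -- create a cycle; in the other three all orders are linear and their four spreads cancel.
  linear-impossible : ∀ {i k l m} → Above i m k l → Above i k l m → Above i l k m →
    Dichotomy m l i k → Dichotomy m k i l → Dichotomy l k i m → ⊥
  linear-impossible {i} {k} {l} {m} kl lm km = λ where
      -- The first three clauses find a cycle at `l`, at `k` and at `m`, respectively.
      (inj₁ ik) _         (inj₁ im) → acyclic (flip ik) im (flip km)
      (inj₁ ik) (inj₁ il) (inj₂ mi) → acyclic (flip il) (flip mi) (flip lm)
      (inj₂ ki) (inj₁ il) _         → acyclic ki il (flip kl)
      -- The spreads belong to the orders at `i`, `k`, `l`, `m`, which are here `k > l > m`,
      -- `i > m > l`, `m > k > i` and `l > i > k`.
      (inj₁ ik) (inj₂ li) (inj₂ mi) → no-spreads (spread-positive kl lm)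
        (spread-positive (flip mi) (flip lm)) (spread-positive (flip km) (flip ik)) (spread-positive li ik)
        (identity₁ (T i i) (T i k) (T i l) (T i m) (T k i) (T k k) (T k l) (T k m)
                   (T l i) (T l k) (T l l) (T l m) (T m i) (T m k) (T m l) (T m m))
      (inj₂ ki) (inj₂ li) (inj₁ im) → no-spreads (spread-positive kl lm)
        (spread-positive (flip im) (flip li)) (spread-positive im (flip km)) (spread-positive (flip kl) ki)
        (identity₂ (T i i) (T i k) (T i l) (T i m) (T k i) (T k k) (T k l) (T k m)
                   (T l i) (T l k) (T l l) (T l m) (T m i) (T m k) (T m l) (T m m))
      (inj₂ ki) (inj₂ li) (inj₂ mi) → no-spreads (spread-positive kl lm)
        (spread-positive (flip mi) (flip lm)) (spread-positive mi (flip ki)) (spread-positive (flip kl) ki)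
        (identity₃ (T i i) (T i k) (T i l) (T i m) (T k i) (T k k) (T k l) (T k m)
                   (T l i) (T l k) (T l l) (T l m) (T m i) (T m k) (T m l) (T m m))
    where
    identity₁ = solve 16 (λ ii ik il im ki kk kl km li lk ll lm mi mk ml mm →
      :spread ik il im kk kl mm ml :+ (:spread ki km kl ii im ll lm :+
        (:spread lm lk li mm mk ii ik :+ :spread ml mi mk ll li kk ki)) := :0) refl
    identity₂ = solve 16 (λ ii ik il im ki kk kl km li lk ll lm mi mk ml mm →
      :spread ik il im kk kl mm ml :+ (:spread km ki kl mm mi ll li :+
        (:spread li lm lk ii im kk km :+ :spread ml mk mi ll lk ii ik)) := :0) refl
    identity₃ = solve 16 (λ ii ik il im ki kk kl km li lk ll lm mi mk ml mm →
      :spread ik il im kk kl mm ml :+ (:spread ki km kl ii im ll lm :+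
        (:spread lm li lk mm mi kk ki :+ :spread ml mk mi ll lk ii ik)) := :0) refl

  -- There is one hypothesis for each pair of points. The first three form the tournament at `0F`:
  -- it is a cycle, or the indices are renamed so that its order is `k > l > m`.
  impossible : Dichotomy 0F 3F 1F 2F → Dichotomy 0F 1F 2F 3F → Dichotomy 0F 2F 1F 3F →
               Dichotomy 3F 2F 0F 1F → Dichotomy 3F 1F 0F 2F → Dichotomy 2F 1F 0F 3F → ⊥
  impossible at₁₂ at₂₃ at₁₃ at₀₁ at₀₂ at₀₃ = compare at₁₂ at₂₃ at₁₃
    where
    compare : Dichotomy 0F 3F 1F 2F → Dichotomy 0F 1F 2F 3F → Dichotomy 0F 2F 1F 3F → ⊥
    compare (inj₁ 12>) (inj₁ 23>) (inj₁ 13>) = linear-impossible 12> 23> 13> at₀₁ at₀₂ at₀₃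
    compare (inj₁ 12>) (inj₁ 23>) (inj₂ 31>) = acyclic 12> 23> 31>
    compare (inj₁ 12>) (inj₂ 32>) (inj₁ 13>) = linear-impossible 13> 32> 12> (swap at₀₁) at₀₃ at₀₂
    compare (inj₁ 12>) (inj₂ 32>) (inj₂ 31>) = linear-impossible 31> 12> 32> at₀₃ (swap at₀₁) (swap at₀₂)
    compare (inj₂ 21>) (inj₁ 23>) (inj₁ 13>) = linear-impossible 21> 13> 23> at₀₂ at₀₁ (swap at₀₃)
    compare (inj₂ 21>) (inj₁ 23>) (inj₂ 31>) = linear-impossible 23> 31> 21> (swap at₀₂) (swap at₀₃) at₀₁
    compare (inj₂ 21>) (inj₂ 32>) (inj₁ 13>) = acyclic 13> 32> 21>
    compare (inj₂ 21>) (inj₂ 32>) (inj₂ 31>) = linear-impossible 32> 21> 31> (swap at₀₃) (swap at₀₂) (swap at₀₁)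

-- Consequences of linear relations between the directions.

module Directions (ℝ : Reals) where

  open Reals ℝ hiding (zero)
  open Geometry ℝ
  open Segment
  open OrderedField ℝ
  open LinearAlgebra ℝ
  open Separation ℝ
  open Affine
  open IntegerCoefficients commutativeRing
  open SemiringSum semiring using (sum; sum-cong-≋)
  open SetoidReasoning setoid

  ⟂-proportional : ∀ {u a b} → Proportional b a → u ⟂ a → u ⟂ b
  ⟂-proportional {u} {a} (c , eq) u⟂a = trans (⟨⟩-congˡ {u} eq) (trans (⟨⟩-⊙ u c a) (trans (*-congˡ u⟂a) (zeroʳ c)))

  proportional-⟂ : ∀ {u v p} → Proportional u v → v ⟂ p → u ⟂ p
  proportional-⟂ {u} {v} {p} (c , eq) v⟂p = trans (⟨⟩-factor {u} {v} eq p) (trans (*-congˡ v⟂p) (zeroʳ c))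

  proportional-sym : ∀ {a b} → ¬ (b ≋ 𝟎) → Proportional b a → Proportional a b
  proportional-sym {a} {b} b≉𝟎 (c , eq) = c⁻¹ , λ k → begin
    a k                ≈⟨ *-identityˡ (a k) ⟨
    1# * a k           ≈⟨ *-congʳ (proj₂ (inverse c c≉0)) ⟨
    c * c⁻¹ * a k      ≈⟨ solve 3 (λ c i x → c :* i :* x := i :* (c :* x)) refl c c⁻¹ (a k) ⟩
    c⁻¹ * (c * a k)    ≈⟨ *-congˡ (eq k) ⟨
    c⁻¹ * b k          ∎
    where
    c≉0 : c ≉ 0#
    c≉0 c≈0 = b≉𝟎 λ k → trans (eq k) (trans (*-congʳ c≈0) (zeroˡ (a k)))

    c⁻¹ = proj₁ (inverse c c≉0)

  unit : Fin 3 → Vector Carrier 3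
  unit 0F = 1# ∷ 0# ∷ 0# ∷ []
  unit 1F = 0# ∷ 1# ∷ 0# ∷ []
  unit 2F = 0# ∷ 0# ∷ 1# ∷ []

  select : ∀ (w : Vector Carrier 3) i → sum (λ m → w m * unit i m) ≈ w i
  select w 0F = solve 3 (λ x y z → x :* :1 :+ (y :* :0 :+ (z :* :0 :+ :0)) := x) refl (w 0F) (w 1F) (w 2F)
  select w 1F = solve 3 (λ x y z → x :* :0 :+ (y :* :1 :+ (z :* :0 :+ :0)) := y) refl (w 0F) (w 1F) (w 2F)
  select w 2F = solve 3 (λ x y z → x :* :0 :+ (y :* :0 :+ (z :* :1 :+ :0)) := z) refl (w 0F) (w 1F) (w 2F)

  unit-sym : ∀ i m → unit i m ≈ unit m i
  unit-sym 0F 0F = refl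
  unit-sym 0F 1F = refl
  unit-sym 0F 2F = refl
  unit-sym 1F 0F = refl
  unit-sym 1F 1F = refl
  unit-sym 1F 2F = refl
  unit-sym 2F 0F = refl
  unit-sym 2F 1F = refl
  unit-sym 2F 2F = refl

  module DualBasis {v : Vector Point 3} (spanning : Spanning v) where

    dual : Vector Point 3
    dual k = proj₁ (interpolate {v} spanning (unit k))

    coefficient : ∀ w m → ⟨ v m , combine w dual ⟩ ≈ w m
    coefficient w m = begin
      ⟨ v m , combine w dual ⟩
        ≈⟨ ⟨⟩-combine (v m) w dual ⟩
      sum (λ i → w i * ⟨ v m , dual i ⟩)
        ≈⟨ sum-cong-≋ {x = λ i → w i * ⟨ v m , dual i ⟩} {y = λ i → w i * unit m i}
             (λ i → *-congˡ (trans (⟨⟩-comm (v m) (dual i)) (trans (proj₂ (interpolate {v} spanning (unit i)) m) (unit-sym i m)))) ⟩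
      sum (λ i → w i * unit m i)
        ≈⟨ select w m ⟩
      w m ∎

    expansion : ∀ u → u ≋ combine (λ m → ⟨ v m , u ⟩) dual
    expansion u k = x-y≈0⇒x≈y (spanning (u ⊖ combine w dual) (λ m → ⟂-sym {v m} {u ⊖ combine w dual}
      (trans (⟨⟩-⊖ (v m) u (combine w dual)) (x≈y⇒x-y≈0 (sym (coefficient w m))))) k)
      where
      w : Vector Carrier 3
      w m = ⟨ v m , u ⟩

  spanning⇒independent : ∀ {v} → Spanning v → LinearlyIndependent v
  spanning⇒independent {v} spanning w eq i = begin
    w i
      ≈⟨ sym (select w i) ⟩
    w 0F * unit i 0F + (w 1F * unit i 1F + (w 2F * unit i 2F + 0#))
      ≈⟨ sum-cong-≋ {x = λ m → w m * unit i m} {y = λ m → w m * ⟨ t , v m ⟩} (λ m → *-congˡ (sym (t-v m))) ⟩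
    sum (λ m → w m * ⟨ t , v m ⟩)
      ≈⟨ relation {v = v} {w} eq t ⟩
    0# ∎
    where
    t = proj₁ (interpolate {v} spanning (unit i))

    t-v : ∀ m → ⟨ t , v m ⟩ ≈ unit i m
    t-v = proj₂ (interpolate {v} spanning (unit i))

  -- The matrix of the pairings with `x₀`, `x₁`, `x₂` is triangular with nonzero diagonal, so the
  -- weights of a relation vanish one after the other.
  triangular-independent : ∀ {u₀ u₁ u₂ x₀ x₁ x₂} →
    ⟨ u₀ , x₀ ⟩ ≉ 0# → u₁ ⟂ x₀ → u₂ ⟂ x₀ → ⟨ u₁ , x₁ ⟩ ≉ 0# → u₂ ⟂ x₁ → ⟨ u₂ , x₂ ⟩ ≉ 0# →
    LinearlyIndependent (u₀ ∷ u₁ ∷ u₂ ∷ [])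
  triangular-independent {u₀} {u₁} {u₂} {x₀} {x₁} {x₂} u₀x₀ u₁x₀ u₂x₀ u₁x₁ u₂x₁ u₂x₂ w eq = weights
    where
    at-point : ∀ x → w 0F * ⟨ u₀ , x ⟩ + (w 1F * ⟨ u₁ , x ⟩ + (w 2F * ⟨ u₂ , x ⟩ + 0#)) ≈ 0#
    at-point x = trans (+-cong (*-congˡ (⟨⟩-comm u₀ x)) (+-cong (*-congˡ (⟨⟩-comm u₁ x)) (+-congʳ (*-congˡ (⟨⟩-comm u₂ x)))))
      (relation {v = u₀ ∷ u₁ ∷ u₂ ∷ []} {w} eq x)

    w₀≈0 : w 0F ≈ 0#
    w₀≈0 = x*y≈0⇒y≈0 u₀x₀ (trans
      (solve 4 (λ u x y z → u :* x := x :* u :+ (y :* :0 :+ (z :* :0 :+ :0))) refl ⟨ u₀ , x₀ ⟩ (w 0F) (w 1F) (w 2F))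
      (trans (+-congˡ (+-cong (*-congˡ (sym u₁x₀)) (+-congʳ (*-congˡ (sym u₂x₀))))) (at-point x₀)))

    w₁≈0 : w 1F ≈ 0#
    w₁≈0 = x*y≈0⇒y≈0 u₁x₁ (trans
      (solve 4 (λ u v y z → u :* y := :0 :* v :+ (y :* u :+ (z :* :0 :+ :0))) refl ⟨ u₁ , x₁ ⟩ ⟨ u₀ , x₁ ⟩ (w 1F) (w 2F))
      (trans (+-cong (*-congʳ (sym w₀≈0)) (+-congˡ (+-congʳ (*-congˡ (sym u₂x₁))))) (at-point x₁)))

    w₂≈0 : w 2F ≈ 0#
    w₂≈0 = x*y≈0⇒y≈0 u₂x₂ (trans
      (solve 4 (λ u v v′ z → u :* z := :0 :* v :+ (:0 :* v′ :+ (z :* u :+ :0))) refl ⟨ u₂ , x₂ ⟩ ⟨ u₀ , x₂ ⟩ ⟨ u₁ , x₂ ⟩ (w 2F))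
      (trans (+-cong (*-congʳ (sym w₀≈0)) (+-congʳ (*-congʳ (sym w₁≈0)))) (at-point x₂)))

    weights : ∀ m → w m ≈ 0#
    weights 0F = w₀≈0
    weights 1F = w₁≈0
    weights 2F = w₂≈0

  independent-pair : ∀ {a b c} → LinearlyIndependent (a ∷ b ∷ c ∷ []) → LinearlyIndependent (a ∷ b ∷ [])
  independent-pair {a} {b} {c} indep w eq i = case i
    where
    all : ∀ j → (w 0F ∷ w 1F ∷ 0# ∷ []) j ≈ 0#
    all = indep (w 0F ∷ w 1F ∷ 0# ∷ []) λ k → trans
      (solve 3 (λ x y c → x :+ (y :+ (:0 :* c :+ :0)) := x :+ (y :+ :0)) refl (w 0F * a k) (w 1F * b k) (c k)) (eq k)

    case : ∀ i → w i ≈ 0#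
    case 0F = all 0F
    case 1F = all 1F

  independent⇒¬proportional : ∀ {a b} → LinearlyIndependent (a ∷ b ∷ []) → ¬ Proportional b a
  independent⇒¬proportional {a} {b} indep (c , eq) = 1≉0 (-x≈0⇒x≈0 (indep (c ∷ (- 1#) ∷ []) (λ k → trans
    (+-congˡ (+-congʳ (*-congˡ (eq k)))) (solve 2 (λ c a → c :* a :+ ((:- :1) :* (c :* a) :+ :0) := :0) refl c (a k))) 1F))

  -- The product of the nonnegative numbers `y` and `1# - x` is `y - 1#`, which together with the
  -- bound on `y` leaves only equality.
  unit-product : ∀ {x y} → 0# ≤ y → 0# ≤ 1# - x → 0# ≤ 1# - y → x * y ≈ 1# → y ≈ 1#
  unit-product {x} {y} 0≤y x≤1 y≤1 xy≈1 = sym (x-y≈0⇒x≈y (0≤x∧0≤-x⇒x≈0 y≤1 (0≤-cong (begin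
    y * (1# - x)    ≈⟨ solve 2 (λ x y → y :* (:1 :- x) := y :- x :* y) refl x y ⟩
    y - x * y       ≈⟨ +-congˡ (-‿cong xy≈1) ⟩
    y - 1#          ≈⟨ solve 1 (λ y → y :- :1 := :- (:1 :- y)) refl y ⟩
    - (1# - y)      ∎) (*-nonneg 0≤y x≤1))))

  module _ {n} {S : Vector Segment n} where

    private
      p d : Fin n → Point
      p i = source (S i)
      d i = direction (S i)

    constant-along : ∀ f {k q} → linear f ⟂ d k → q ∈ ⟦ S k ⟧ → f · q ≈ f · p k
    constant-along f {k} {q} f⟂d (t , _ , _ , q≋) = begin
      f · q                                             ≈⟨ ·-cong f q≋ ⟩
      f · at (S k) t                                    ≈⟨ ·-at f (S k) t ⟩
      (1# - t) * f · p k + t * f · target (S k)         ≈⟨ +-congˡ (*-congˡ target≈) ⟩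
      (1# - t) * f · p k + t * f · p k                  ≈⟨ solve 2 (λ t x → (:1 :- t) :* x :+ t :* x := x) refl t (f · p k) ⟩
      f · p k                                           ∎
      where
      target≈ : f · target (S k) ≈ f · p k
      target≈ = x-y≈0⇒x≈y (trans (sym (·-⊖ f (target (S k)) (p k))) f⟂d)

    difference : ∀ {i j} (σ : Separator S i j) q → ⟨ linear (Separator.f σ) , q ⊖ p i ⟩ ≈ Separator.f σ · q
    difference {i} σ q = trans (·-⊖ f q (p i)) (trans (+-congˡ (-‿cong source≈0))
      (solve 1 (λ x → x :- :0 := x) refl (f · q)))
      where open Separator σ

    -- Both functionals vanish on `S i`, so one is `c` times the other as an affine function. The
    -- bound of the second on `S j` gives `c` at most 1, while `c` times the value sought is 1; this
    -- value, being at most 1, is then 1.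
    proportional⇒one : ∀ {i j k} (σ : Separator S i j) (τ : Separator S i k) →
      Proportional (linear (Separator.f τ)) (linear (Separator.f σ)) → Separator.f σ · p k ≈ 1#
    proportional⇒one {i} {j} {k} σ τ (c , eq) =
      unit-product (σ.source≥0 k) (0≤-cong (+-congˡ (-‿cong (sym c≈))) (τ.source≤1 j))
        (σ.source≤1 k) (trans (sym (factor (p k))) τ.source≈1)
      where
      module σ = Separator σ
      module τ = Separator τ

      factor : ∀ q → τ.f · q ≈ c * σ.f · q
      factor q = trans (sym (difference τ q)) (trans (⟨⟩-factor {linear τ.f} {linear σ.f} eq (q ⊖ p i)) (*-congˡ (difference σ q)))

      c≈ : c ≈ τ.f · p j
      c≈ = sym (trans (factor (p j)) (trans (*-congˡ σ.source≈1) (*-identityʳ c)))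

    reverse-one⇒zero : ∀ {i j} (σ : Separator S i j) q → Separator.f (reverse σ) · q ≈ 1# → Separator.f σ · q ≈ 0#
    reverse-one⇒zero σ q eq = begin
      f · q                ≈⟨ x≈1-[1-x] (f · q) ⟩
      1# - (1# - f · q)    ≈⟨ +-congˡ (-‿cong (trans (sym (·-complement f q)) eq)) ⟩
      1# - 1#              ≈⟨ -‿inverseʳ 1# ⟩
      0#                   ∎
      where open Separator σ

    -- The separator of `j` and `k` kills `d j` and `d i`, just as that of `j` and `i` does. Both
    -- vanish on `S j` and are proportional, so the latter is 1 on `S k`, and its complement is 0.
    parallel⇒zero : ∀ {i j k} (σ : Separator S i j) → Separator S j k →
      LinearlyIndependent (d i ∷ d j ∷ []) → Proportional (d k) (d i) → Separator.f σ · p k ≈ 0#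
    parallel⇒zero {i} {j} {k} σ τ indep dk∥di = reverse-one⇒zero σ (p k) (proportional⇒one (reverse σ) τ
      (annihilators-proportional {d i} {d j} indep (Separator.linear≉𝟎 (reverse σ))
        (Separator.⟂ʲ (reverse σ)) (Separator.⟂ⁱ (reverse σ))
        (⟂-proportional {linear (Separator.f τ)} {d k} {d i} (proportional-sym {d i} {d k} (direction≉𝟎 (S k)) dk∥di) (Separator.⟂ʲ τ)) (Separator.⟂ⁱ τ)))

    module _ (sep : Separated S) where

      -- The separator of `i` and `j` also kills `d k`. If `d k` is not parallel to `d i`, then the
      -- separator of `i` and `k` is proportional to it and gives it the value 1 at `p k`; if `d k`
      -- is not parallel to `d j`, the value is 0 by the same argument from the other end. Both
      -- cannot happen at once.
      coplanar⇒parallel : ∀ {i j k} (i≢j : i ≢ j) → i ≢ k → j ≢ k → LinearlyIndependent (d i ∷ d j ∷ []) →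
        (∃ λ v → ¬ (v ≋ 𝟎) × (∀ m → v ⟂ (d i ∷ d j ∷ d k ∷ []) m)) →
        (Proportional (d k) (d i) × Separator.f (sep i j i≢j) · p k ≈ 0#) ⊎
        (Proportional (d k) (d j) × Separator.f (sep i j i≢j) · p k ≈ 1#)
      coplanar⇒parallel {i} {j} {k} i≢j i≢k j≢k indep (v , v≉𝟎 , v⟂) =
        cases (independent⊎proportional (d i) (d k) (direction≉𝟎 (S i)))
              (independent⊎proportional (d j) (d k) (direction≉𝟎 (S j)))
        where
        σ = sep i j i≢j
        f = Separator.f σ

        f⟂dk : linear f ⟂ d k
        f⟂dk = proportional-⟂ {linear f} {v} {d k}
          (annihilators-proportional {d i} {d j} indep v≉𝟎 (v⟂ 0F) (v⟂ 1F) (Separator.⟂ⁱ σ) (Separator.⟂ʲ σ)) (v⟂ 2F)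

        at-one : LinearlyIndependent (d i ∷ d k ∷ []) → f · p k ≈ 1#
        at-one indep′ = proportional⇒one σ τ (annihilators-proportional {d i} {d k} indep′ (Separator.linear≉𝟎 σ)
          (Separator.⟂ⁱ σ) f⟂dk (Separator.⟂ⁱ τ) (Separator.⟂ʲ τ))
          where τ = sep i k i≢k

        at-zero : LinearlyIndependent (d j ∷ d k ∷ []) → f · p k ≈ 0#
        at-zero indep′ = reverse-one⇒zero σ (p k) (proportional⇒one (reverse σ) τ
          (annihilators-proportional {d j} {d k} indep′ (Separator.linear≉𝟎 (reverse σ)) (Separator.⟂ⁱ (reverse σ))
            (trans (⟨⟩-factor {linear (complement f)} {linear f} (λ _ → refl) (d k)) (trans (*-congˡ f⟂dk) (zeroʳ (- 1#))))
            (Separator.⟂ⁱ τ) (Separator.⟂ʲ τ)))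
          where τ = sep j k j≢k

        cases : LinearlyIndependent (d i ∷ d k ∷ []) ⊎ Proportional (d k) (d i) →
                LinearlyIndependent (d j ∷ d k ∷ []) ⊎ Proportional (d k) (d j) →
                (Proportional (d k) (d i) × f · p k ≈ 0#) ⊎ (Proportional (d k) (d j) × f · p k ≈ 1#)
        cases (inj₂ dk∥di)  _             = inj₁ (dk∥di , parallel⇒zero σ (sep j k j≢k) indep dk∥di)
        cases (inj₁ indep′) (inj₂ dk∥dj)  = inj₂ (dk∥dj , at-one indep′)
        cases (inj₁ indep′) (inj₁ indep″) = contradiction (trans (sym (at-one indep′)) (at-zero indep″)) 1≉0

      -- Otherwise the three segments project along `d i` to collinear points. Evaluating a relation
      -- at the separators of `i`, `k` and of `i`, `l` gives `s * t ≈ 1#` unless the weights vanish,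
      -- which makes `p k` and `p l` project to the same point; the separator of `k` and `l`
      -- excludes this.
      parallel-independent : ∀ {i k l} → i ≢ k → i ≢ l → k ≢ l → Proportional (d k) (d i) → Proportional (d l) (d i) →
        LinearlyIndependent (p k ⊖ p i ∷ p l ⊖ p i ∷ d i ∷ [])
      parallel-independent {i} {k} {l} i≢k i≢l k≢l dk∥di dl∥di w eq = weights
        where
        module ik = Separator (sep i k i≢k)
        module il = Separator (sep i l i≢l)
        module kl = Separator (sep k l k≢l)

        at-functional : ∀ u → u ⟂ d i → w 0F * ⟨ u , p k ⊖ p i ⟩ + w 1F * ⟨ u , p l ⊖ p i ⟩ ≈ 0#
        at-functional u u⟂d = trans
          (sym (trans (+-congˡ (+-congˡ (trans (+-identityʳ _) (trans (*-congˡ u⟂d) (zeroʳ (w 2F)))))) (+-congˡ (+-identityʳ _))))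
          (relation {v = p k ⊖ p i ∷ p l ⊖ p i ∷ d i ∷ []} {w} eq u)

        s t : Carrier
        s = il.f · p k
        t = ik.f · p l

        eq-ik : w 0F + w 1F * t ≈ 0#
        eq-ik = trans (+-cong (sym (trans (*-congˡ ik.rise) (*-identityʳ _))) (*-congˡ (sym (difference (sep i k i≢k) (p l)))))
                  (at-functional (linear ik.f) ik.⟂ⁱ)

        eq-il : w 0F * s + w 1F ≈ 0#
        eq-il = trans (+-cong (*-congˡ (sym (difference (sep i l i≢l) (p k)))) (sym (trans (*-congˡ il.rise) (*-identityʳ _))))
                  (at-functional (linear il.f) il.⟂ⁱ)

        w₀≉0⇒t≈1 : w 0F ≉ 0# → t ≈ 1#
        w₀≉0⇒t≈1 w₀≉0 = unit-product (ik.source≥0 l) (il.source≤1 k) (ik.source≤1 l)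
          (sym (x-y≈0⇒x≈y (x*y≈0⇒y≈0 w₀≉0 (begin
            w 0F * (1# - s * t)
              ≈⟨ solve 4 (λ x y s t → x :* (:1 :- s :* t) := (x :+ y :* t) :- (x :* s :+ y) :* t) refl (w 0F) (w 1F) s t ⟩
            (w 0F + w 1F * t) - (w 0F * s + w 1F) * t
              ≈⟨ +-cong eq-ik (-‿cong (*-congʳ eq-il)) ⟩
            0# - 0# * t
              ≈⟨ solve 1 (λ t → :0 :- :0 :* t := :0) refl t ⟩
            0# ∎))))

        eq-kl : w 0F * - (kl.f · p i) + w 1F * (1# - kl.f · p i) ≈ 0#
        eq-kl = trans (+-cong
            (*-congˡ (sym (trans (·-⊖ kl.f (p k) (p i)) (trans (+-congʳ kl.source≈0) (+-identityˡ _)))))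
            (*-congˡ (sym (trans (·-⊖ kl.f (p l) (p i)) (+-congʳ kl.source≈1)))))
          (at-functional (linear kl.f)
            (⟂-proportional {linear kl.f} {d k} {d i} (proportional-sym {d i} {d k} (direction≉𝟎 (S k)) dk∥di) kl.⟂ⁱ))

        w₀≈0 : w 0F ≈ 0#
        w₀≈0 with w 0F ≟ 0#
        ... | yes w₀≈0 = w₀≈0
        ... | no  w₀≉0 = begin
          w 0F
            ≈⟨ solve 3 (λ x y z → x := (:1 :- z) :* (x :+ y :* :1) :- (x :* (:- z) :+ y :* (:1 :- z))) refl (w 0F) (w 1F) (kl.f · p i) ⟩
          (1# - kl.f · p i) * (w 0F + w 1F * 1#) - (w 0F * - (kl.f · p i) + w 1F * (1# - kl.f · p i))
            ≈⟨ +-cong (*-congˡ (trans (+-congˡ (*-congˡ (sym (w₀≉0⇒t≈1 w₀≉0)))) eq-ik)) (-‿cong eq-kl) ⟩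
          (1# - kl.f · p i) * 0# - 0#
            ≈⟨ solve 1 (λ z → (:1 :- z) :* :0 :- :0 := :0) refl (kl.f · p i) ⟩
          0# ∎

        w₁≈0 : w 1F ≈ 0#
        w₁≈0 = begin
          w 1F                         ≈⟨ solve 3 (λ x y s → y := x :* s :+ y :- x :* s) refl (w 0F) (w 1F) s ⟩
          w 0F * s + w 1F - w 0F * s   ≈⟨ +-cong eq-il (-‿cong (*-congʳ w₀≈0)) ⟩
          0# - 0# * s                  ≈⟨ solve 1 (λ s → :0 :- :0 :* s := :0) refl s ⟩
          0#                           ∎

        w₂d≈0 : ∀ c → w 2F * d i c ≈ 0#
        w₂d≈0 c = begin
          w 2F * d i c
            ≈⟨ solve 3 (λ z a b → z := :0 :* a :+ (:0 :* b :+ (z :+ :0))) refl (w 2F * d i c) ((p k ⊖ p i) c) ((p l ⊖ p i) c) ⟩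
          0# * (p k ⊖ p i) c + (0# * (p l ⊖ p i) c + (w 2F * d i c + 0#))
            ≈⟨ +-cong (*-congʳ w₀≈0) (+-congʳ (*-congʳ w₁≈0)) ⟨
          w 0F * (p k ⊖ p i) c + (w 1F * (p l ⊖ p i) c + (w 2F * d i c + 0#))
            ≈⟨ eq c ⟩
          0# ∎

        weights : ∀ m → w m ≈ 0#
        weights 0F = w₀≈0
        weights 1F = w₁≈0
        weights 2F with w 2F ≟ 0#
        ... | yes w₂≈0 = w₂≈0
        ... | no  w₂≉0 = contradiction (λ c → x*y≈0⇒y≈0 w₂≉0 (w₂d≈0 c)) (direction≉𝟎 (S i))

      -- The linear part of `f` would vanish on the basis supplied by `parallel-independent`.
      no-three-coplanar : ∀ {i k l} → i ≢ k → i ≢ l → k ≢ l → Proportional (d k) (d i) → Proportional (d l) (d i) →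
        ∀ {f} → ¬ (linear f ≋ 𝟎) → linear f ⟂ d i → f · p k ≈ f · p i → f · p l ≈ f · p i → ⊥
      no-three-coplanar {i} {k} {l} i≢k i≢l k≢l dk∥di dl∥di {f} f≉𝟎 f⟂d fk fl = f≉𝟎
        (independent⇒spanning {p k ⊖ p i ∷ p l ⊖ p i ∷ d i ∷ []} (parallel-independent i≢k i≢l k≢l dk∥di dl∥di) (linear f)
          λ { 0F → trans (·-⊖ f (p k) (p i)) (x≈y⇒x-y≈0 fk) ; 1F → trans (·-⊖ f (p l) (p i)) (x≈y⇒x-y≈0 fl) ; 2F → f⟂d })

      -- The separators of `i` with `j`, `k` and `l` have linear parts that kill `d i`, so they
      -- cannot be independent. But the first two vanish on `S l`, where the third is 1, and this
      -- makes the pairing matrix triangular.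
      spanning-parallel-impossible : ∀ {i j k l} → i ≢ j → i ≢ k → i ≢ l → j ≢ l → k ≢ l →
        Spanning (d i ∷ d j ∷ d k ∷ []) → Proportional (d l) (d i) → ⊥
      spanning-parallel-impossible {i} {j} {k} {l} i≢j i≢k i≢l j≢l k≢l spanning dl∥di =
        direction≉𝟎 (S i) (independent⇒spanning {linear il.f ∷ linear ij.f ∷ linear ik.f ∷ []}
          (triangular-independent {x₀ = p l ⊖ p i} {d k} {d j}
            (λ eq → 1≉0 (trans (sym il.rise) eq))
            (trans (difference (sep i j i≢j) (p l)) fij≈0) (trans (difference (sep i k i≢k) (p l)) fik≈0)
            (λ eq → ij.linear≉𝟎 (spanning (linear ij.f) λ { 0F → ij.⟂ⁱ ; 1F → ij.⟂ʲ ; 2F → eq })) ik.⟂ʲ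
            (λ eq → ik.linear≉𝟎 (spanning (linear ik.f) λ { 0F → ik.⟂ⁱ ; 1F → eq ; 2F → ik.⟂ʲ })))
          (d i) λ { 0F → ⟂-sym {linear il.f} {d i} il.⟂ⁱ ; 1F → ⟂-sym {linear ij.f} {d i} ij.⟂ⁱ ; 2F → ⟂-sym {linear ik.f} {d i} ik.⟂ⁱ })
        where
        module ij = Separator (sep i j i≢j)
        module ik = Separator (sep i k i≢k)
        module il = Separator (sep i l i≢l)

        swapped : Spanning (d i ∷ d k ∷ d j ∷ [])
        swapped u h = spanning u λ { 0F → h 0F ; 1F → h 2F ; 2F → h 1F }

        fij≈0 : ij.f · p l ≈ 0#
        fij≈0 = parallel⇒zero (sep i j i≢j) (sep j l j≢l) (independent-pair {d i} {d j} {d k} (spanning⇒independent {d i ∷ d j ∷ d k ∷ []} spanning)) dl∥di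

        fik≈0 : ik.f · p l ≈ 0#
        fik≈0 = parallel⇒zero (sep i k i≢k) (sep k l k≢l) (independent-pair {d i} {d k} {d j} (spanning⇒independent {d i ∷ d k ∷ d j ∷ []} swapped)) dl∥di

-- Four segments whose directions are in general position.

module FourSegments (ℝ : Reals) where

  open Reals ℝ hiding (zero)
  open Geometry ℝ
  open Segment
  open OrderedField ℝ
  open LinearAlgebra ℝ
  open Separation ℝ
  open Directions ℝ
  open Affine
  open IntegerCoefficients commutativeRing
  open SemiringSum semiring using (sum; sum-cong-≋)
  open SetoidReasoning setoid

  -- That `i`, `j`, `k`, `l` is a permutation of the indices, encoded by its only use: reordering
  -- sums of four terms.
  Enumerates : (i j k l : Fin 4) → Set
  Enumerates i j k l = ∀ (h : Vector Carrier 4) → h i + (h j + (h k + h l)) ≈ sum h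

  enumerates : Enumerates 0F 1F 2F 3F
  enumerates h = solve 4 (λ a b c d → a :+ (b :+ (c :+ d)) := a :+ (b :+ (c :+ (d :+ :0)))) refl (h 0F) (h 1F) (h 2F) (h 3F)

  swap₁₂ : ∀ {i j k l} → Enumerates i j k l → Enumerates j i k l
  swap₁₂ {i} {j} enum h = trans (solve 3 (λ a b x → b :+ (a :+ x) := a :+ (b :+ x)) refl (h i) (h j) _) (enum h)

  swap₂₃ : ∀ {i j k l} → Enumerates i j k l → Enumerates i k j l
  swap₂₃ {i} {j} {k} {l} enum h = trans
    (solve 4 (λ a b c d → a :+ (c :+ (b :+ d)) := a :+ (b :+ (c :+ d))) refl (h i) (h j) (h k) (h l)) (enum h)

  swap₃₄ : ∀ {i j k l} → Enumerates i j k l → Enumerates i j l k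
  swap₃₄ enum h = trans (+-congˡ (+-congˡ (+-comm _ _))) (enum h)

  module Independent {S : Vector Segment 4} (sep : Separated S)
    (spanning : Spanning (direction (S 0F) ∷ direction (S 1F) ∷ direction (S 2F) ∷ []))
    (w : Vector Carrier 4) (w≉0 : ∀ m → w m ≉ 0#)
    (balanced : ∀ u → sum (λ m → w m * ⟨ u , direction (S m) ⟩) ≈ 0#) where

    private
      d e : Fin 4 → Point
      d m = direction (S m)
      e m = w m ⊙ d m

      basis : Vector Point 3
      basis = e 0F ∷ e 1F ∷ e 2F ∷ []

      ⟂e⇒⟂d : ∀ u m → u ⟂ e m → u ⟂ d m
      ⟂e⇒⟂d u m eq = x*y≈0⇒y≈0 (w≉0 m) (trans (sym (⟨⟩-⊙ u (w m) (d m))) eq)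

      basis-spanning : Spanning basis
      basis-spanning u h = spanning u λ { 0F → ⟂e⇒⟂d u 0F (h 0F) ; 1F → ⟂e⇒⟂d u 1F (h 1F) ; 2F → ⟂e⇒⟂d u 2F (h 2F) }

      open DualBasis {basis} basis-spanning

    -- The sum of the e m vanishes, and t k - t l takes the values 1, -1 at e k, e l and
    -- vanishes at the other two.
    t : Fin 4 → Point
    t 0F = dual 0F
    t 1F = dual 1F
    t 2F = dual 2F
    t 3F = 𝟎

    T : Fin 4 → Fin 4 → Carrier
    T i k = ⟨ t k , midpoint (S i) ⟩

    open Tournaments ℝ T

    expand : ∀ u x → ⟨ u , x ⟩ ≈ sum (λ m → ⟨ u , e m ⟩ * ⟨ t m , x ⟩)
    expand u x = begin
      ⟨ u , x ⟩
        ≈⟨ ⟨⟩-comm u x ⟩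
      ⟨ x , u ⟩
        ≈⟨ ⟨⟩-congˡ {x} (expansion u) ⟩
      ⟨ x , combine (λ m → ⟨ basis m , u ⟩) dual ⟩
        ≈⟨ ⟨⟩-combine x (λ m → ⟨ basis m , u ⟩) dual ⟩
      sum (λ m → ⟨ basis m , u ⟩ * ⟨ x , dual m ⟩)
        ≈⟨ +-cong (exchange 0F) (+-cong (exchange 1F) (+-cong (exchange 2F)
             (trans (solve 1 (λ z → :0 := z :* :0 :+ :0) refl ⟨ u , e 3F ⟩) (+-congʳ (*-congˡ (sym (trans (⟨⟩-comm 𝟎 x) (⟨⟩-zeroʳ x)))))))) ⟩
      sum (λ m → ⟨ u , e m ⟩ * ⟨ t m , x ⟩) ∎
      where
      exchange : ∀ m → ⟨ basis m , u ⟩ * ⟨ x , dual m ⟩ ≈ ⟨ u , basis m ⟩ * ⟨ dual m , x ⟩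
      exchange m = *-cong (⟨⟩-comm (basis m) u) (⟨⟩-comm x (dual m))

    -- A functional that is nonnegative at both ends and zero at the midpoint is zero at both ends,
    -- hence constant along the segment. This strictness is the reason for working with midpoints.
    interior : ∀ {i j k} (σ : Separator S i j) → ⟨ linear (Separator.f σ) , d k ⟩ ≉ 0# → Positive (Separator.f σ · midpoint (S k))
    interior {i} {j} {k} σ f∤d = positive (≥0 k (midpoint-∈ (S k))) λ eq → f∤d
      (trans (·-⊖ f (target (S k)) (source (S k))) (x≈y⇒x-y≈0 (trans
        (end≈0 (≥0 k (target-∈ (S k))) (source≥0 k) (trans (+-comm _ _) (trans (sym mid) eq)))
        (sym (end≈0 (source≥0 k) (≥0 k (target-∈ (S k))) (trans (sym mid) eq))))))
      where
      open Separator σ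

      mid : f · midpoint (S k) ≈ ½ * f · source (S k) + ½ * f · target (S k)
      mid = trans (·-at f (S k) ½) (+-congʳ (*-congʳ 1-½≈½))

      end≈0 : ∀ {x y} → 0# ≤ x → 0# ≤ y → ½ * x + ½ * y ≈ 0# → x ≈ 0#
      end≈0 0≤x 0≤y eq = x*y≈0⇒y≈0 (Positive⇒≉0 ½-positive)
        (x+y≈0⇒x≈0 (*-nonneg (proj₁ ½-positive) 0≤x) (*-nonneg (proj₁ ½-positive) 0≤y) eq)

    -- Evaluating the balanced relation at `u` shows that `u` takes the values `c` and `- c` at
    -- `e k` and `e l`, so `u` is `c` times `t k - t l`. The separator is least at `i`, greatest at
    -- `j` and strictly between at the midpoints of the other two.
    dichotomy : ∀ {i j k l} → i ≢ j → Enumerates i j k l → Dichotomy i j k l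
    dichotomy {i} {j} {k} {l} i≢j enum = by-sign (sign c)
      where
      σ = sep i j i≢j
      open Separator σ

      u = linear f
      c = ⟨ u , e k ⟩

      u⟂e : ∀ {m} → u ⟂ d m → ⟨ u , e m ⟩ ≈ 0#
      u⟂e {m} eq = trans (⟨⟩-⊙ u (w m) (d m)) (trans (*-congˡ eq) (zeroʳ (w m)))

      -c : ⟨ u , e l ⟩ ≈ - c
      -c = x-y≈0⇒x≈y (begin
        ⟨ u , e l ⟩ - - c
          ≈⟨ solve 2 (λ c x → x :- (:- c) := :0 :+ (:0 :+ (c :+ x))) refl c ⟨ u , e l ⟩ ⟩
        0# + (0# + (c + ⟨ u , e l ⟩))
          ≈⟨ sym (+-cong (u⟂e ⟂ⁱ) (+-congʳ (u⟂e ⟂ʲ))) ⟩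
        ⟨ u , e i ⟩ + (⟨ u , e j ⟩ + (c + ⟨ u , e l ⟩))
          ≈⟨ enum (λ m → ⟨ u , e m ⟩) ⟩
        sum (λ m → ⟨ u , e m ⟩)
          ≈⟨ sum-cong-≋ {x = λ m → ⟨ u , e m ⟩} {y = λ m → w m * ⟨ u , d m ⟩} (λ m → ⟨⟩-⊙ u (w m) (d m)) ⟩
        sum (λ m → w m * ⟨ u , d m ⟩)
          ≈⟨ balanced u ⟩
        0# ∎)

      factor : ∀ x → ⟨ u , x ⟩ ≈ c * (⟨ t k , x ⟩ - ⟨ t l , x ⟩)
      factor x = begin
        ⟨ u , x ⟩
          ≈⟨ expand u x ⟩
        sum (λ m → ⟨ u , e m ⟩ * ⟨ t m , x ⟩)
          ≈⟨ sym (enum (λ m → ⟨ u , e m ⟩ * ⟨ t m , x ⟩)) ⟩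
        ⟨ u , e i ⟩ * ⟨ t i , x ⟩ + (⟨ u , e j ⟩ * ⟨ t j , x ⟩ + (c * ⟨ t k , x ⟩ + ⟨ u , e l ⟩ * ⟨ t l , x ⟩))
          ≈⟨ +-cong (*-congʳ (u⟂e ⟂ⁱ)) (+-cong (*-congʳ (u⟂e ⟂ʲ)) (+-congˡ (*-congʳ -c))) ⟩
        0# * ⟨ t i , x ⟩ + (0# * ⟨ t j , x ⟩ + (c * ⟨ t k , x ⟩ + - c * ⟨ t l , x ⟩))
          ≈⟨ solve 5 (λ a b c x y → :0 :* a :+ (:0 :* b :+ (c :* x :+ (:- c) :* y)) := c :* (x :- y)) refl _ _ c _ _ ⟩
        c * (⟨ t k , x ⟩ - ⟨ t l , x ⟩) ∎

      step : ∀ a b → f · midpoint (S a) - f · midpoint (S b) ≈ c * ((T a k - T a l) - (T b k - T b l))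
      step a b = begin
        f · midpoint (S a) - f · midpoint (S b)
          ≈⟨ solve 3 (λ x y z → x :+ z :- (y :+ z) := x :- y) refl _ _ (constant f) ⟩
        ⟨ u , midpoint (S a) ⟩ - ⟨ u , midpoint (S b) ⟩
          ≈⟨ +-cong (factor (midpoint (S a))) (-‿cong (factor (midpoint (S b)))) ⟩
        c * (T a k - T a l) - c * (T b k - T b l)
          ≈⟨ solve 3 (λ c x y → c :* x :- c :* y := c :* (x :- y)) refl c _ _ ⟩
        c * ((T a k - T a l) - (T b k - T b l)) ∎

      c≉0 : c ≉ 0#
      c≉0 c≈0 = 1≉0 (begin
        1#                                          ≈⟨ sym 1-0≈1 ⟩
        1# - 0#                                     ≈⟨ +-cong (≈1 (midpoint-∈ (S j))) (-‿cong (≈0 (midpoint-∈ (S i)))) ⟨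
        f · midpoint (S j) - f · midpoint (S i)     ≈⟨ step j i ⟩
        c * ((T j k - T j l) - (T i k - T i l))     ≈⟨ trans (*-congʳ c≈0) (zeroˡ _) ⟩
        0#                                          ∎)

      u∤dk : ⟨ u , d k ⟩ ≉ 0#
      u∤dk eq = c≉0 (u⟂e eq)

      u∤dl : ⟨ u , d l ⟩ ≉ 0#
      u∤dl eq = c≉0 (-x≈0⇒x≈0 (trans (sym -c) (u⟂e eq)))

      from-i : ∀ m → ⟨ u , d m ⟩ ≉ 0# → Positive (c * ((T m k - T m l) - (T i k - T i l)))
      from-i m u∤d = Positive-cong (trans (solve 1 (λ x → x := x :- :0) refl _)
        (trans (+-congˡ (-‿cong (sym (≈0 (midpoint-∈ (S i)))))) (step m i))) (interior σ u∤d)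

      to-j : ∀ m → ⟨ u , d m ⟩ ≉ 0# → Positive (c * ((T j k - T j l) - (T m k - T m l)))
      to-j m u∤d = Positive-cong (trans (·-complement f (midpoint (S m)))
          (trans (+-congʳ (sym (≈1 (midpoint-∈ (S j))))) (step j m)))
        (interior (reverse σ) λ eq → u∤d (begin
          ⟨ u , d m ⟩                                ≈⟨ solve 1 (λ x → x := (:- :1) :* ((:- :1) :* x)) refl ⟨ u , d m ⟩ ⟩
          - 1# * (- 1# * ⟨ u , d m ⟩)                ≈⟨ sym (*-congˡ (⟨⟩-factor {linear (complement f)} {u} (λ _ → refl) (d m))) ⟩
          - 1# * ⟨ linear (complement f) , d m ⟩     ≈⟨ trans (*-congˡ eq) (zeroʳ (- 1#)) ⟩
          0#                                         ∎))

      Δikl : Positive (c * - Δ i k l)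
      Δikl = Positive-cong (solve 5 (λ c a b x y → c :* ((x :- y) :- (a :- b)) := c :* (:- ((a :- b) :- (x :- y)))) refl
        c (T i k) (T i l) (T k k) (T k l)) (from-i k u∤dk)

      Δilk : Positive (c * Δ i l k)
      Δilk = Positive-cong (solve 5 (λ c a b x y → c :* ((x :- y) :- (a :- b)) := c :* ((b :- a) :- (y :- x))) refl
        c (T i k) (T i l) (T l k) (T l l)) (from-i l u∤dl)

      Δjkl : Positive (c * Δ j k l)
      Δjkl = to-j k u∤dk

      Δjlk : Positive (c * - Δ j l k)
      Δjlk = Positive-cong (solve 5 (λ c a b x y → c :* ((a :- b) :- (x :- y)) := c :* (:- ((b :- a) :- (y :- x)))) refl
        c (T j k) (T j l) (T l k) (T l l)) (to-j l u∤dl)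

      by-sign : 0# ≤ c ⊎ 0# ≤ - c → Dichotomy i j k l
      -- For positive `c` the difference `t k - t l` increases with `f` and is thus least at `i`,
      -- which is the second alternative.
      by-sign (inj₁ 0≤c) = inj₂ (above (cancel Δilk) (cancel Δikl) (cancel Δjlk) (cancel Δjkl))
        where
        cancel : ∀ {x} → Positive (c * x) → Positive x
        cancel = *-cancelˡ-positive (positive 0≤c c≉0)
      by-sign (inj₂ 0≤-c) = inj₁ (above (cancel Δikl) (flip-sign Δilk) (flip-sign Δjkl) (cancel Δjlk))
        where
        flip-sign : ∀ {x} → Positive (c * x) → Positive (- x)
        flip-sign {x} h = *-cancelˡ-positive (positive 0≤-c (c≉0 ∘ -x≈0⇒x≈0))
          (Positive-cong (solve 2 (λ c x → c :* x := (:- c) :* (:- x)) refl c x) h)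

        cancel : ∀ {x} → Positive (c * - x) → Positive x
        cancel {x} h = Positive-cong (solve 1 (λ x → :- (:- x) := x) refl x) (flip-sign h)

    contradictory : ⊥
    contradictory = impossible
      (dichotomy (λ ()) (swap₂₃ (swap₃₄ enumerates)))
      (dichotomy (λ ()) enumerates)
      (dichotomy (λ ()) (swap₂₃ enumerates))
      (dichotomy (λ ()) (swap₂₃ (swap₃₄ (swap₁₂ (swap₂₃ (swap₃₄ enumerates))))))
      (dichotomy (λ ()) (swap₂₃ (swap₁₂ (swap₂₃ (swap₃₄ enumerates)))))
      (dichotomy (λ ()) (swap₂₃ (swap₁₂ (swap₂₃ enumerates))))

-- Exclusion of four spanning directions, and the parallelograms formed by parallel segments.

module Classification (ℝ : Reals) where

  open Reals ℝ hiding (zero)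
  open Geometry ℝ
  open Segment
  open OrderedField ℝ
  open LinearAlgebra ℝ
  open Separation ℝ
  open Directions ℝ
  open FourSegments ℝ
  open Affine
  open IntegerCoefficients commutativeRing
  open SemiringSum semiring using (sum; sum-remove)
  open RingProperties ring using (+-cancelˡ)
  open SetoidReasoning setoid

  -- If two of the first three directions are coplanar with the last, then the last is parallel to
  -- one of them, which `not-parallel` forbids. Otherwise every three of the directions span, and a
  -- relation among all four meets the requirements of `Independent`.
  no-four-spanning : ∀ {S : Vector Segment 4} → Separated S →
    Spanning (direction (S 0F) ∷ direction (S 1F) ∷ direction (S 2F) ∷ []) → ⊥
  no-four-spanning {S} sep spanning = decide (spanning? (d ∘ punchIn 0F)) (spanning? (d ∘ punchIn 1F)) (spanning? (d ∘ punchIn 2F))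
    where
    d : Fin 4 → Point
    d m = direction (S m)

    not-parallel : ∀ m → m ≢ 3F → Proportional (d 3F) (d m) → ⊥
    not-parallel 0F _ = spanning-parallel-impossible sep {0F} {1F} {2F} {3F} (λ ()) (λ ()) (λ ()) (λ ()) (λ ()) spanning
    not-parallel 1F _ = spanning-parallel-impossible sep {1F} {0F} {2F} {3F} (λ ()) (λ ()) (λ ()) (λ ()) (λ ())
      λ u h → spanning u λ { 0F → h 1F ; 1F → h 0F ; 2F → h 2F }
    not-parallel 2F _ = spanning-parallel-impossible sep {2F} {0F} {1F} {3F} (λ ()) (λ ()) (λ ()) (λ ()) (λ ())
      λ u h → spanning u λ { 0F → h 1F ; 1F → h 2F ; 2F → h 0F }
    not-parallel 3F 3≢3 = contradiction ≡.refl 3≢3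

    independent : LinearlyIndependent (d 0F ∷ d 1F ∷ d 2F ∷ [])
    independent = spanning⇒independent {d 0F ∷ d 1F ∷ d 2F ∷ []} spanning

    independent₀₂ : LinearlyIndependent (d 0F ∷ d 2F ∷ d 1F ∷ [])
    independent₀₂ = spanning⇒independent {d 0F ∷ d 2F ∷ d 1F ∷ []} λ u h → spanning u λ { 0F → h 0F ; 1F → h 2F ; 2F → h 1F }

    independent₁₂ : LinearlyIndependent (d 1F ∷ d 2F ∷ d 0F ∷ [])
    independent₁₂ = spanning⇒independent {d 1F ∷ d 2F ∷ d 0F ∷ []} λ u h → spanning u λ { 0F → h 2F ; 1F → h 0F ; 2F → h 1F }

    all-spanning : (∀ x → Spanning (d ∘ punchIn x)) → ⊥
    all-spanning every = from (dependent {0} d)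
      where
      from : LinearlyDependent d → ⊥
      from (w , (i , wi≉0) , eq) = Independent.contradictory sep spanning w w≉0 (relation {v = d} {w} eq)
        where
        -- A zero weight would leave a nontrivial relation among the three other directions, which
        -- are independent.
        w≉0 : ∀ x → w x ≉ 0#
        w≉0 x wx≈0 = wi≉0 (vanishes i)
          where
          others : ∀ j → w (punchIn x j) ≈ 0#
          others = spanning⇒independent {d ∘ punchIn x} (every x) (w ∘ punchIn x) λ k → begin
            sum (λ j → w (punchIn x j) * d (punchIn x j) k)
              ≈⟨ solve 2 (λ s a → s := :0 :* a :+ s) refl _ (d x k) ⟩
            0# * d x k + sum (λ j → w (punchIn x j) * d (punchIn x j) k)
              ≈⟨ +-congʳ (*-congʳ wx≈0) ⟨
            w x * d x k + sum (λ j → w (punchIn x j) * d (punchIn x j) k)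
              ≈⟨ sum-remove {i = x} (λ i → w i * d i k) ⟨
            sum (λ i → w i * d i k)
              ≈⟨ eq k ⟩
            0# ∎

          vanishes : ∀ i → w i ≈ 0#
          vanishes i with x Fin.≟ i
          ... | yes ≡.refl = wx≈0
          ... | no  x≢i    = ≡.subst (λ i → w i ≈ 0#) (Fin.punchIn-punchOut x≢i) (others (punchOut x≢i))

    Degenerate : Fin 4 → Set
    Degenerate x = ∃ λ u → ¬ (u ≋ 𝟎) × (∀ m → u ⟂ d (punchIn x m))

    decide : Spanning (d ∘ punchIn 0F) ⊎ Degenerate 0F → Spanning (d ∘ punchIn 1F) ⊎ Degenerate 1F →
             Spanning (d ∘ punchIn 2F) ⊎ Degenerate 2F → ⊥
    decide (inj₁ s₀) (inj₁ s₁) (inj₁ s₂) = all-spanning λ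
      { 0F → s₀ ; 1F → s₁ ; 2F → s₂ ; 3F → λ u h → spanning u λ { 0F → h 0F ; 1F → h 1F ; 2F → h 2F } }
    decide (inj₂ (u , u≉𝟎 , h)) _ _ =
      [ (λ (par , _) → not-parallel 1F (λ ()) par) , (λ (par , _) → not-parallel 2F (λ ()) par) ]′
        (coplanar⇒parallel sep {1F} {2F} {3F} (λ ()) (λ ()) (λ ()) (independent-pair {d 1F} {d 2F} {d 0F} independent₁₂)
          (u , u≉𝟎 , λ { 0F → h 0F ; 1F → h 1F ; 2F → h 2F }))
    decide (inj₁ _) (inj₂ (u , u≉𝟎 , h)) _ =
      [ (λ (par , _) → not-parallel 0F (λ ()) par) , (λ (par , _) → not-parallel 2F (λ ()) par) ]′
        (coplanar⇒parallel sep {0F} {2F} {3F} (λ ()) (λ ()) (λ ()) (independent-pair {d 0F} {d 2F} {d 1F} independent₀₂)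
          (u , u≉𝟎 , λ { 0F → h 0F ; 1F → h 1F ; 2F → h 2F }))
    decide (inj₁ _) (inj₁ _) (inj₂ (u , u≉𝟎 , h)) =
      [ (λ (par , _) → not-parallel 0F (λ ()) par) , (λ (par , _) → not-parallel 1F (λ ()) par) ]′
        (coplanar⇒parallel sep {0F} {1F} {3F} (λ ()) (λ ()) (λ ()) (independent-pair {d 0F} {d 1F} {d 2F} independent)
          (u , u≉𝟎 , λ { 0F → h 0F ; 1F → h 1F ; 2F → h 2F }))

  Covers : (a b c e : Fin 4) → Set
  Covers a b c e = ∀ m → m ≡ a ⊎ m ≡ b ⊎ m ≡ c ⊎ m ≡ e

  covers? : ∀ a b c e → Dec (Covers a b c e)
  covers? a b c e = Fin.all? λ m → (m Fin.≟ a) ⊎-dec (m Fin.≟ b) ⊎-dec (m Fin.≟ c) ⊎-dec (m Fin.≟ e)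

  -- Affine functionals that kill `d` are the functions on the projection along `d`. In this
  -- projection the pairs `a`, `c` and `b`, `e` have a common midpoint, so they are the diagonals of
  -- a parallelogram, possibly degenerate.
  Diagonals : Vector Point 4 → Point → (a c b e : Fin 4) → Set
  Diagonals p d a c b e = ∀ f → linear f ⟂ d → f · p a + f · p c ≈ f · p b + f · p e

  record AffineRelation (p : Vector Point 4) (d : Point) : Set where
    field
      weight   : Vector Carrier 4
      nonzero  : ¬ (∀ m → weight m ≈ 0#)
      total≈0  : sum weight ≈ 0#
      balanced : ∀ f → linear f ⟂ d → sum (λ m → weight m * f · p m) ≈ 0#

  opposite : ∀ {p d} → AffineRelation p d → AffineRelation p d
  opposite {p} rel = record
    { weight   = λ m → - weight m
    ; nonzero  = λ vanishes → nonzero (λ m → -x≈0⇒x≈0 (vanishes m))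
    ; total≈0  = trans (solve 4 (λ a b c d → (:- a) :+ ((:- b) :+ ((:- c) :+ ((:- d) :+ :0))) := :- (a :+ (b :+ (c :+ (d :+ :0)))))
                   refl (weight 0F) (weight 1F) (weight 2F) (weight 3F)) (x≈0⇒-x≈0 total≈0)
    ; balanced = λ f f⟂d → trans (solve 8 (λ a b c d x y z t → (:- a) :* x :+ ((:- b) :* y :+ ((:- c) :* z :+ ((:- d) :* t :+ :0)))
                                            := :- (a :* x :+ (b :* y :+ (c :* z :+ (d :* t :+ :0)))))
                   refl (weight 0F) (weight 1F) (weight 2F) (weight 3F) (f · p 0F) (f · p 1F) (f · p 2F) (f · p 3F))
                   (x≈0⇒-x≈0 (balanced f f⟂d))
    }
    where open AffineRelation rel

  -- In homogeneous coordinates the four points and the point at infinity `d` are five vectors in a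
  -- space of dimension four. Since `d` is nonzero, a relation among them cannot be supported on `d`
  -- alone.
  affine-relation : ∀ p d → ¬ (d ≋ 𝟎) → AffineRelation p d
  affine-relation p d d≉𝟎 = from (independent⊎dependent V)
    where
    V : Vector (Vector Carrier 4) 5
    V = (1# ∷ p 0F) ∷ (1# ∷ p 1F) ∷ (1# ∷ p 2F) ∷ (1# ∷ p 3F) ∷ (0# ∷ d) ∷ []

    from : (LinearlyIndependent′ V × 5 ℕ.≤ 4) ⊎ LinearlyDependent V → AffineRelation p d
    from (inj₁ (_ , ℕ.s≤s (ℕ.s≤s (ℕ.s≤s (ℕ.s≤s ())))))
    from (inj₂ (w , (i , wi≉0) , eq)) = record
      { weight   = W
      ; nonzero  = λ W≈0 → wi≉0 (vanishes W≈0 i)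
      ; total≈0  = trans (solve 5 (λ a b c d e → a :+ (b :+ (c :+ (d :+ :0)))
                     := a :* :1 :+ (b :* :1 :+ (c :* :1 :+ (d :* :1 :+ (e :* :0 :+ :0))))) refl (w 0F) (w 1F) (w 2F) (w 3F) (w 4F)) (eq 0F)
      ; balanced = balanced
      }
      where
      W : Vector Carrier 4
      W = w 0F ∷ w 1F ∷ w 2F ∷ w 3F ∷ []

      coordinates : ∀ k → sum (λ i → w i * V i (suc k)) ≈ 0#
      coordinates k = eq (suc k)

      V′ : Vector Point 5
      V′ = p 0F ∷ p 1F ∷ p 2F ∷ p 3F ∷ d ∷ []

      balanced : ∀ f → linear f ⟂ d → sum (λ m → W m * f · p m) ≈ 0#
      balanced f f⟂d = begin
        w 0F * (x₀ + c) + (w 1F * (x₁ + c) + (w 2F * (x₂ + c) + (w 3F * (x₃ + c) + 0#)))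
          ≈⟨ solve 10 (λ w₀ w₁ w₂ w₃ w₄ x₀ x₁ x₂ x₃ c →
                w₀ :* (x₀ :+ c) :+ (w₁ :* (x₁ :+ c) :+ (w₂ :* (x₂ :+ c) :+ (w₃ :* (x₃ :+ c) :+ :0)))
             := w₀ :* x₀ :+ (w₁ :* x₁ :+ (w₂ :* x₂ :+ (w₃ :* x₃ :+ (w₄ :* :0 :+ :0))))
                :+ c :* (w₀ :* :1 :+ (w₁ :* :1 :+ (w₂ :* :1 :+ (w₃ :* :1 :+ (w₄ :* :0 :+ :0))))))
             refl (w 0F) (w 1F) (w 2F) (w 3F) (w 4F) x₀ x₁ x₂ x₃ c ⟩
        w 0F * x₀ + (w 1F * x₁ + (w 2F * x₂ + (w 3F * x₃ + (w 4F * 0# + 0#))))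
          + c * sum (λ i → w i * V i 0F)
          ≈⟨ +-cong (+-congˡ (+-congˡ (+-congˡ (+-congˡ (+-congʳ (*-congˡ (sym f⟂d))))))) (trans (*-congˡ (eq 0F)) (zeroʳ c)) ⟩
        sum (λ i → w i * ⟨ linear f , V′ i ⟩) + 0#
          ≈⟨ +-identityʳ _ ⟩
        sum (λ i → w i * ⟨ linear f , V′ i ⟩)
          ≈⟨ relation {v = V′} {w} coordinates (linear f) ⟩
        0# ∎
        where
        c = constant f
        x₀ = ⟨ linear f , p 0F ⟩
        x₁ = ⟨ linear f , p 1F ⟩
        x₂ = ⟨ linear f , p 2F ⟩
        x₃ = ⟨ linear f , p 3F ⟩

      vanishes : (∀ m → W m ≈ 0#) → ∀ i → w i ≈ 0#
      vanishes W≈0 0F = W≈0 0F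
      vanishes W≈0 1F = W≈0 1F
      vanishes W≈0 2F = W≈0 2F
      vanishes W≈0 3F = W≈0 3F
      vanishes W≈0 4F with w 4F ≟ 0#
      ... | yes w₄≈0 = w₄≈0
      ... | no  w₄≉0 = contradiction (λ k → x*y≈0⇒y≈0 w₄≉0 (begin
        w 4F * d k
          ≈⟨ solve 5 (λ x a b c e → x := :0 :* a :+ (:0 :* b :+ (:0 :* c :+ (:0 :* e :+ (x :+ :0))))) refl (w 4F * d k) (p 0F k) (p 1F k) (p 2F k) (p 3F k) ⟩
        0# * p 0F k + (0# * p 1F k + (0# * p 2F k + (0# * p 3F k + (w 4F * d k + 0#))))
          ≈⟨ +-cong (*-congʳ (W≈0 0F)) (+-cong (*-congʳ (W≈0 1F)) (+-cong (*-congʳ (W≈0 2F)) (+-congʳ (*-congʳ (W≈0 3F))))) ⟨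
        sum (λ i → w i * V i (suc k))
          ≈⟨ coordinates k ⟩
        0# ∎)) d≉𝟎

  module Parallel {S : Vector Segment 4} (sep : Separated S)
    (parallel : ∀ k → Proportional (direction (S k)) (direction (S 0F))) where

    private
      p : Fin 4 → Point
      p m = source (S m)

      d = direction (S 0F)

      f⟂d : ∀ {i j} (σ : Separator S i j) → linear (Separator.f σ) ⟂ d
      f⟂d {i} σ = ⟂-proportional {linear (Separator.f σ)} {direction (S i)} {d}
        (proportional-sym {d} {direction (S i)} (direction≉𝟎 (S i)) (parallel i)) (Separator.⟂ⁱ σ)

    module _ (rel : AffineRelation p d) where
      open AffineRelation rel renaming (weight to W)

      private
        evaluate : ∀ {a b c e} (a≢b : a ≢ b) → Enumerates a b c e →
          let f = Separator.f (sep a b a≢b) in W b + (W c * f · p c + W e * f · p e) ≈ 0#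
        evaluate {a} {b} {c} {e} a≢b enum = begin
          W b + (W c * f · p c + W e * f · p e)
            ≈⟨ solve 4 (λ a b c e → b :+ (c :+ e) := a :* :0 :+ (b :* :1 :+ (c :+ e))) refl (W a) (W b) (W c * f · p c) (W e * f · p e) ⟩
          W a * 0# + (W b * 1# + (W c * f · p c + W e * f · p e))
            ≈⟨ +-cong (*-congˡ source≈0) (+-congʳ (*-congˡ source≈1)) ⟨
          W a * f · p a + (W b * f · p b + (W c * f · p c + W e * f · p e))
            ≈⟨ enum (λ m → W m * f · p m) ⟩
          sum (λ m → W m * f · p m)
            ≈⟨ balanced f (f⟂d (sep a b a≢b)) ⟩
          0# ∎
          where open Separator (sep a b a≢b)

        -- At the separator of `a` and `b` the relation turns `W b + W c` into a sum of two
        -- nonnegative products, one from the upper bound at `c`, the other from the lower bound at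
        -- `e`.
        opposite-nonneg : ∀ {a b c e} → a ≢ b → Enumerates a b c e → 0# ≤ W c → 0# ≤ - W e → 0# ≤ W b + W c
        opposite-nonneg {a} {b} {c} {e} a≢b enum 0≤Wc 0≤-We = 0≤-cong (begin
          W c * (1# - f · p c) + - W e * f · p e
            ≈⟨ solve 5 (λ b c e x y → c :* (:1 :- x) :+ (:- e) :* y := b :+ c :- (b :+ (c :* x :+ e :* y))) refl (W b) (W c) (W e) (f · p c) (f · p e) ⟩
          W b + W c - (W b + (W c * f · p c + W e * f · p e))
            ≈⟨ +-congˡ (-‿cong (evaluate a≢b enum)) ⟩
          W b + W c - 0#
            ≈⟨ solve 1 (λ x → x :- :0 := x) refl (W b + W c) ⟩
          W b + W c ∎) (+-nonneg (*-nonneg 0≤Wc (source≤1 c)) (*-nonneg 0≤-We (source≥0 e)))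
          where open Separator (sep a b a≢b)

        lone-zero : ∀ {a b c e} → a ≢ b → Enumerates a b c e → 0# ≤ - W b → 0# ≤ - W c → 0# ≤ - W e → W b ≈ 0#
        lone-zero {a} {b} {c} {e} a≢b enum 0≤-Wb 0≤-Wc 0≤-We = -x≈0⇒x≈0 (x+y≈0⇒x≈0 0≤-Wb
          (+-nonneg (*-nonneg 0≤-Wc (source≥0 c)) (*-nonneg 0≤-We (source≥0 e)))
          (trans (solve 5 (λ b c e x y → (:- b) :+ ((:- c) :* x :+ (:- e) :* y) := :- (b :+ (c :* x :+ e :* y))) refl (W b) (W c) (W e) (f · p c) (f · p e))
            (x≈0⇒-x≈0 (evaluate a≢b enum))))
          where open Separator (sep a b a≢b)

      all-zero : ∀ {a b c e} → Covers a b c e → W a ≈ 0# → W b ≈ 0# → W c ≈ 0# → W e ≈ 0# → ⊥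
      all-zero cover Wa Wb Wc We = nonzero λ m → case cover m of λ where
        (inj₁ ≡.refl)               → Wa
        (inj₂ (inj₁ ≡.refl))        → Wb
        (inj₂ (inj₂ (inj₁ ≡.refl))) → Wc
        (inj₂ (inj₂ (inj₂ ≡.refl))) → We

      -- Geometrically, `p a` would project into the convex hull of the projections of the other
      -- three. A separator that is 0 at `a` and 1 at another point makes the relation a sum of
      -- nonpositive terms, which forces the weight at that point to vanish.
      one-positive : ∀ {a b c e} → Covers a b c e → a ≢ b → a ≢ c → a ≢ e → Enumerates a b c e →
        0# ≤ - W b → 0# ≤ - W c → 0# ≤ - W e → ⊥
      one-positive {a} {b} {c} {e} cover a≢b a≢c a≢e enum 0≤-Wb 0≤-Wc 0≤-We = all-zero cover Wa Wb Wc We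
        where
        Wb : W b ≈ 0#
        Wb = lone-zero a≢b enum 0≤-Wb 0≤-Wc 0≤-We

        Wc : W c ≈ 0#
        Wc = lone-zero a≢c (swap₂₃ enum) 0≤-Wc 0≤-Wb 0≤-We

        We : W e ≈ 0#
        We = lone-zero a≢e (swap₂₃ (swap₃₄ enum)) 0≤-We 0≤-Wb 0≤-Wc

        Wa : W a ≈ 0#
        Wa = begin
          W a                        ≈⟨ solve 1 (λ a → a := a :+ (:0 :+ (:0 :+ :0))) refl (W a) ⟩
          W a + (0# + (0# + 0#))     ≈⟨ +-congˡ (+-cong Wb (+-cong Wc We)) ⟨
          W a + (W b + (W c + W e))  ≈⟨ enum W ⟩
          sum W                      ≈⟨ total≈0 ⟩
          0#                         ∎

      -- Each sum of a weight from `a`, `c` and a weight from `b`, `e` is nonnegative, and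
      -- complementary sums add up to the total, which is zero. Hence all these sums vanish and the
      -- weights are `W a` with alternating signs.
      two-positive : ∀ {a b c e} → Covers a b c e → a ≢ b → a ≢ e → c ≢ b → c ≢ e → Enumerates a b c e →
        0# ≤ W a → 0# ≤ - W b → 0# ≤ W c → 0# ≤ - W e → Diagonals p d a c b e
      two-positive {a} {b} {c} {e} cover a≢b a≢e c≢b c≢e enum 0≤Wa 0≤-Wb 0≤Wc 0≤-We f f⟂ = x-y≈0⇒x≈y (x*y≈0⇒y≈0 Wa≉0 (begin
        W a * (f · p a + f · p c - (f · p b + f · p e))
          ≈⟨ solve 5 (λ w x y z t → w :* (x :+ z :- (y :+ t)) := w :* x :+ ((:- w) :* y :+ (w :* z :+ (:- w) :* t))) refl (W a) (f · p a) (f · p b) (f · p c) (f · p e) ⟩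
        W a * f · p a + (- W a * f · p b + (W a * f · p c + - W a * f · p e))
          ≈⟨ +-congˡ (+-cong (*-congʳ Wb≈) (+-cong (*-congʳ Wc≈) (*-congʳ We≈))) ⟨
        W a * f · p a + (W b * f · p b + (W c * f · p c + W e * f · p e))
          ≈⟨ enum (λ m → W m * f · p m) ⟩
        sum (λ m → W m * f · p m)
          ≈⟨ balanced f f⟂ ⟩
        0# ∎))
        where
        Wb+Wc = opposite-nonneg a≢b enum 0≤Wc 0≤-We
        Wb+Wa = opposite-nonneg c≢b (swap₁₂ (swap₂₃ (swap₁₂ enum))) 0≤Wa 0≤-We
        We+Wc = opposite-nonneg a≢e (swap₂₃ (swap₃₄ (swap₂₃ enum))) 0≤Wc 0≤-Wb
        We+Wa = opposite-nonneg c≢e (swap₂₃ (swap₃₄ (swap₁₂ (swap₂₃ enum)))) 0≤Wa 0≤-Wb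

        ΣW≈0 : W a + (W b + (W c + W e)) ≈ 0#
        ΣW≈0 = trans (enum W) total≈0

        Wb+Wa≈0 : W b + W a ≈ 0#
        Wb+Wa≈0 = x+y≈0⇒x≈0 Wb+Wa We+Wc (trans (solve 4 (λ a b c e → b :+ a :+ (e :+ c) := a :+ (b :+ (c :+ e))) refl (W a) (W b) (W c) (W e)) ΣW≈0)

        We+Wa≈0 : W e + W a ≈ 0#
        We+Wa≈0 = x+y≈0⇒x≈0 We+Wa Wb+Wc (trans (solve 4 (λ a b c e → e :+ a :+ (b :+ c) := a :+ (b :+ (c :+ e))) refl (W a) (W b) (W c) (W e)) ΣW≈0)

        Wb≈ : W b ≈ - W a
        Wb≈ = x-y≈0⇒x≈y (trans (solve 2 (λ a b → b :- (:- a) := b :+ a) refl (W a) (W b)) Wb+Wa≈0)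

        We≈ : W e ≈ - W a
        We≈ = x-y≈0⇒x≈y (trans (solve 2 (λ a b → b :- (:- a) := b :+ a) refl (W a) (W e)) We+Wa≈0)

        Wc≈ : W c ≈ W a
        Wc≈ = x-y≈0⇒x≈y (trans (solve 4 (λ a b c e → c :- a := a :+ (b :+ (c :+ e)) :- (b :+ a) :- (e :+ a)) refl (W a) (W b) (W c) (W e))
          (trans (+-cong (+-cong ΣW≈0 (-‿cong Wb+Wa≈0)) (-‿cong We+Wa≈0)) (solve 0 (:0 :- :0 :- :0 := :0) refl)))

        Wa≉0 : W a ≉ 0#
        Wa≉0 Wa≈0 = all-zero cover Wa≈0 (trans Wb≈ -Wa≈0) (trans Wc≈ Wa≈0) (trans We≈ -Wa≈0)
          where
          -Wa≈0 : - W a ≈ 0#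
          -Wa≈0 = x≈0⇒-x≈0 Wa≈0

    parallelogram : Diagonals p d 0F 1F 2F 3F ⊎ Diagonals p d 0F 2F 1F 3F ⊎ Diagonals p d 0F 3F 1F 2F
    parallelogram = orient (affine-relation p d (direction≉𝟎 (S 0F)))
      where
      Result = Diagonals p d 0F 1F 2F 3F ⊎ Diagonals p d 0F 2F 1F 3F ⊎ Diagonals p d 0F 3F 1F 2F

      double-negation : ∀ {x} → 0# ≤ x → 0# ≤ - - x
      double-negation {x} = 0≤-cong (solve 1 (λ x → x := :- (:- x)) refl x)

      module _ (rel : AffineRelation p d) where
        open AffineRelation rel renaming (weight to W)

        -- Passing to the opposite relation permits the assumption on the first weight. Only two
        -- weights of each sign survive, and the index that shares the sign of `0F` is the other end
        -- of its diagonal.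
        by-signs : 0# ≤ W 0F → 0# ≤ W 1F ⊎ 0# ≤ - W 1F → 0# ≤ W 2F ⊎ 0# ≤ - W 2F → 0# ≤ W 3F ⊎ 0# ≤ - W 3F → Result
        by-signs s₀ (inj₁ s₁) (inj₁ s₂) (inj₁ s₃) = contradiction
          (sum≈0⇒≈0 {4} {W} (λ { 0F → s₀ ; 1F → s₁ ; 2F → s₂ ; 3F → s₃ }) total≈0) nonzero
        by-signs s₀ (inj₁ s₁) (inj₁ s₂) (inj₂ s₃) = ⊥-elim (one-positive (opposite rel) {3F} {0F} {1F} {2F}
          (from-yes (covers? 3F 0F 1F 2F)) (λ ()) (λ ()) (λ ()) (swap₁₂ (swap₂₃ (swap₃₄ enumerates)))
          (double-negation s₀) (double-negation s₁) (double-negation s₂))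
        by-signs s₀ (inj₁ s₁) (inj₂ s₂) (inj₁ s₃) = ⊥-elim (one-positive (opposite rel) {2F} {0F} {1F} {3F}
          (from-yes (covers? 2F 0F 1F 3F)) (λ ()) (λ ()) (λ ()) (swap₁₂ (swap₂₃ enumerates))
          (double-negation s₀) (double-negation s₁) (double-negation s₃))
        by-signs s₀ (inj₂ s₁) (inj₁ s₂) (inj₁ s₃) = ⊥-elim (one-positive (opposite rel) {1F} {0F} {2F} {3F}
          (from-yes (covers? 1F 0F 2F 3F)) (λ ()) (λ ()) (λ ()) (swap₁₂ enumerates)
          (double-negation s₀) (double-negation s₂) (double-negation s₃))
        by-signs s₀ (inj₂ s₁) (inj₂ s₂) (inj₂ s₃) = ⊥-elim (one-positive rel {0F} {1F} {2F} {3F}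
          (from-yes (covers? 0F 1F 2F 3F)) (λ ()) (λ ()) (λ ()) enumerates
          s₁ s₂ s₃)
        by-signs s₀ (inj₁ s₁) (inj₂ s₂) (inj₂ s₃) = inj₁ (two-positive rel {0F} {2F} {1F} {3F}
          (from-yes (covers? 0F 2F 1F 3F)) (λ ()) (λ ()) (λ ()) (λ ()) (swap₂₃ enumerates)
          s₀ s₂ s₁ s₃)
        by-signs s₀ (inj₂ s₁) (inj₁ s₂) (inj₂ s₃) = inj₂ (inj₁ (two-positive rel {0F} {1F} {2F} {3F}
          (from-yes (covers? 0F 1F 2F 3F)) (λ ()) (λ ()) (λ ()) (λ ()) enumerates
          s₀ s₁ s₂ s₃))
        by-signs s₀ (inj₂ s₁) (inj₂ s₂) (inj₁ s₃) = inj₂ (inj₂ (two-positive rel {0F} {1F} {3F} {2F}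
          (from-yes (covers? 0F 1F 3F 2F)) (λ ()) (λ ()) (λ ()) (λ ()) (swap₃₄ enumerates)
          s₀ s₁ s₃ s₂))

        nonneg-first : 0# ≤ W 0F → Result
        nonneg-first s₀ = by-signs s₀ (sign (W 1F)) (sign (W 2F)) (sign (W 3F))

      orient : AffineRelation p d → Result
      orient rel = [ nonneg-first rel , nonneg-first (opposite rel) ]′ (sign (AffineRelation.weight rel 0F))

  injective? : ∀ {m n} (ι : Fin m → Fin n) → Dec (∀ i j → ι i ≡ ι j → i ≡ j)
  injective? ι = Fin.all? λ i → Fin.all? λ j → (ι i Fin.≟ ι j) →-dec (i Fin.≟ j)

  -- Two parallelograms on the same three points either share the fourth vertex or have fourth
  -- vertices whose midpoint is one of the three.
  no-five-parallel : ∀ {S : Vector Segment 5} → Separated S →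
    (∀ k → Proportional (direction (S k)) (direction (S 0F))) → ⊥
  no-five-parallel {S} sep parallel = compare
    (Parallel.parallelogram (restrict {S = S} ι₃ ι₃-injective sep) (λ { 0F → parallel 0F ; 1F → parallel 1F ; 2F → parallel 2F ; 3F → parallel 3F }))
    (Parallel.parallelogram (restrict {S = S} ι₄ ι₄-injective sep) (λ { 0F → parallel 0F ; 1F → parallel 1F ; 2F → parallel 2F ; 3F → parallel 4F }))
    where
    p : Fin 5 → Point
    p m = source (S m)

    d = direction (S 0F)

    ι₃ ι₄ : Vector (Fin 5) 4
    ι₃ = 0F ∷ 1F ∷ 2F ∷ 3F ∷ []
    ι₄ = 0F ∷ 1F ∷ 2F ∷ 4F ∷ []

    ι₃-injective : ∀ {i j} → ι₃ i ≡ ι₃ j → i ≡ j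
    ι₃-injective = from-yes (injective? ι₃) _ _

    ι₄-injective : ∀ {i j} → ι₄ i ≡ ι₄ j → i ≡ j
    ι₄-injective = from-yes (injective? ι₄) _ _

    f⟂d : ∀ {i j} (σ : Separator S i j) → linear (Separator.f σ) ⟂ d
    f⟂d {i} σ = ⟂-proportional {linear (Separator.f σ)} {direction (S i)} {d}
      (proportional-sym {d} {direction (S i)} (direction≉𝟎 (S i)) (parallel i)) (Separator.⟂ⁱ σ)

    same : (∀ f → linear f ⟂ d → f · p 3F ≈ f · p 4F) → ⊥
    same eq = 1≉0 (trans (sym source≈1) (trans (sym (eq f (f⟂d σ))) source≈0))
      where
      σ = sep 3F 4F (λ ())
      open Separator σ

    between : ∀ x → x ≢ 3F → (∀ f → linear f ⟂ d → f · p 3F + f · p 4F ≈ f · p x + f · p x) → ⊥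
    between x x≢3 eq = Positive⇒≉0 (+-positive 1-positive (source≥0 4F)) (begin
      1# + f · p 4F
        ≈⟨ +-congʳ source≈1 ⟨
      f · p 3F + f · p 4F
        ≈⟨ eq f (f⟂d σ) ⟩
      f · p x + f · p x
        ≈⟨ trans (+-cong source≈0 source≈0) (+-identityʳ 0#) ⟩
      0# ∎)
      where
      σ = sep x 3F x≢3
      open Separator σ

    Options : Vector Point 4 → Set
    Options q = Diagonals q d 0F 1F 2F 3F ⊎ Diagonals q d 0F 2F 1F 3F ⊎ Diagonals q d 0F 3F 1F 2F

    fourth-unique : ∀ {z s t} → z + s ≈ z + t → s ≈ t
    fourth-unique = +-cancelˡ _ _ _

    fourth-opposite : ∀ {x y z s t} → x + y ≈ z + s → x + z ≈ y + t → s + t ≈ x + x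
    fourth-opposite {x} {y} {z} {s} {t} eq₁ eq₂ = x-y≈0⇒x≈y (trans
      (solve 5 (λ x y z s t → s :+ t :- (x :+ x) := (z :+ s :- (x :+ y)) :+ (y :+ t :- (x :+ z))) refl x y z s t)
      (trans (+-cong (x≈y⇒x-y≈0 (sym eq₁)) (x≈y⇒x-y≈0 (sym eq₂))) (+-identityʳ 0#)))

    compare : Options (p ∘ ι₃) → Options (p ∘ ι₄) → ⊥
    compare (inj₁ a)        (inj₁ b)        = same λ f h → fourth-unique (trans (sym (a f h)) (b f h))
    compare (inj₁ a)        (inj₂ (inj₁ b)) = between 0F (λ ()) λ f h → fourth-opposite (a f h) (b f h)
    compare (inj₁ a)        (inj₂ (inj₂ b)) = between 1F (λ ()) λ f h →
      fourth-opposite (trans (+-comm _ _) (a f h)) (sym (b f h))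
    compare (inj₂ (inj₁ a)) (inj₁ b)        = between 0F (λ ()) λ f h →
      trans (+-comm _ _) (fourth-opposite (b f h) (a f h))
    compare (inj₂ (inj₁ a)) (inj₂ (inj₁ b)) = same λ f h → fourth-unique (trans (sym (a f h)) (b f h))
    compare (inj₂ (inj₁ a)) (inj₂ (inj₂ b)) = between 2F (λ ()) λ f h →
      fourth-opposite (trans (+-comm _ _) (a f h)) (trans (+-comm _ _) (sym (b f h)))
    compare (inj₂ (inj₂ a)) (inj₁ b)        = between 1F (λ ()) λ f h →
      trans (+-comm _ _) (fourth-opposite (trans (+-comm _ _) (b f h)) (sym (a f h)))
    compare (inj₂ (inj₂ a)) (inj₂ (inj₁ b)) = between 2F (λ ()) λ f h →
      trans (+-comm _ _) (fourth-opposite (trans (+-comm _ _) (b f h)) (trans (+-comm _ _) (sym (a f h))))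
    compare (inj₂ (inj₂ a)) (inj₂ (inj₂ b)) = same λ f h → fourth-unique (trans (a f h) (sym (b f h)))

-- Affine coordinates of a parallelepiped and of its edges.

module Boxes (ℝ : Reals) where

  open Reals ℝ hiding (zero)
  open Geometry ℝ
  open Segment
  open OrderedField ℝ
  open LinearAlgebra ℝ
  open Separation ℝ
  open Directions ℝ
  open Affine
  open IntegerCoefficients commutativeRing
  open SemiringSum semiring using (sum; sum-cong-≋)
  open SetoidReasoning setoid

  combine-cong : ∀ {m} {w w′ : Vector Carrier m} {x : Vector Point m} → (∀ i → w i ≈ w′ i) → combine w x ≋ combine w′ x
  combine-cong {w = w} {w′} {x} eq k = sum-cong-≋ {x = λ i → w i * x i k} {y = λ i → w′ i * x i k} (λ i → *-congʳ (eq i))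

  bit-distinct : ∀ b → bit b ≉ bit (not b)
  bit-distinct false eq = 1≉0 (sym eq)
  bit-distinct true  eq = 1≉0 eq

  bit-injective : ∀ {b b′} → bit b ≈ bit b′ → b ≡ b′
  bit-injective {false} {false} _  = ≡.refl
  bit-injective {true}  {true}  _  = ≡.refl
  bit-injective {false} {true}  eq = contradiction (sym eq) 1≉0
  bit-injective {true}  {false} eq = contradiction eq 1≉0

  0≤bit : ∀ b → 0# ≤ bit b
  0≤bit false = ≤-refl
  0≤bit true  = 0≤1

  bit≤1 : ∀ b → bit b ≤ 1#
  bit≤1 false = 0≤1
  bit≤1 true  = ≤-refl

  sum-mix : ∀ {n} (x y a : Vector Carrier n) t →
    (1# - t) * sum (λ i → x i * a i) + t * sum (λ i → y i * a i) ≈ sum (λ i → ((1# - t) * x i + t * y i) * a i)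
  sum-mix {zero}  x y a t = solve 1 (λ t → (:1 :- t) :* :0 :+ t :* :0 := :0) refl t
  sum-mix {suc n} x y a t = trans
    (solve 6 (λ t x y a X Y → (:1 :- t) :* (x :* a :+ X) :+ t :* (y :* a :+ Y)
        := ((:1 :- t) :* x :+ t :* y) :* a :+ ((:1 :- t) :* X :+ t :* Y)) refl t (x 0F) (y 0F) (a 0F) _ _)
    (+-congˡ (sum-mix (tail x) (tail y) (tail a) t))

  module Box (Q : Parallelepiped) where

    open Parallelepiped Q

    point : Vector Carrier 3 → Point
    point w = origin ⊕ combine w axis

    point-cong : ∀ {w w′} → (∀ i → w i ≈ w′ i) → point w ≋ point w′
    point-cong {w} {w′} eq k = +-congˡ (combine-cong {w = w} {w′} {axis} eq k)

    -- The affine inverse of `point`, obtained from the dual basis of the axes.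
    coordinate : Fin 3 → Affine
    coordinate m = affine A (- ⟨ A , origin ⟩)
      where A = proj₁ (interpolate {axis} (independent⇒spanning {axis} independent) (unit m))

    coordinate-point : ∀ m w → coordinate m · point w ≈ w m
    coordinate-point m w = begin
      ⟨ A , origin ⊕ combine w axis ⟩ - ⟨ A , origin ⟩
        ≈⟨ +-congʳ (⟨⟩-⊕ A origin (combine w axis)) ⟩
      ⟨ A , origin ⟩ + ⟨ A , combine w axis ⟩ - ⟨ A , origin ⟩
        ≈⟨ solve 2 (λ x y → x :+ y :- x := y) refl _ _ ⟩
      ⟨ A , combine w axis ⟩
        ≈⟨ ⟨⟩-combine A w axis ⟩
      sum (λ i → w i * ⟨ A , axis i ⟩)
        ≈⟨ sum-cong-≋ {x = λ i → w i * ⟨ A , axis i ⟩} {y = λ i → w i * unit m i} (λ i → *-congˡ (dual i)) ⟩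
      sum (λ i → w i * unit m i)
        ≈⟨ select w m ⟩
      w m ∎
      where
      A = linear (coordinate m)

      dual : ∀ i → ⟨ A , axis i ⟩ ≈ unit m i
      dual = proj₂ (interpolate {axis} (independent⇒spanning {axis} independent) (unit m))

    free : EdgeLabel → Fin 3
    free = proj₁

    -- Meaningless at the free coordinate.
    value : EdgeLabel → Fin 3 → Bool
    value (k , c) m = lookup (Vec.insertAt c k false) m

    weights : EdgeLabel → Carrier → Vector Carrier 3
    weights (k , c) t m = (1# - t) * bit (lookup (Vec.insertAt c k false) m) + t * bit (lookup (Vec.insertAt c k true) m)

    weights-free : ∀ e t → weights e t (free e) ≈ t
    weights-free (k , c) t
      rewrite Vec.insertAt-lookup c k false | Vec.insertAt-lookup c k true =
      solve 1 (λ t → (:1 :- t) :* :0 :+ t :* :1 := t) refl t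

    weights-fixed : ∀ e t {m} → m ≢ free e → weights e t m ≈ bit (value e m)
    weights-fixed (k , c) t {m} m≢k = trans
      (+-congˡ (*-congˡ (reflexive (≡.cong bit (≡.trans (entry true) (≡.sym (entry false)))))))
      (solve 2 (λ t b → (:1 :- t) :* b :+ t :* b := b) refl t (bit (value (k , c) m)))
      where
      entry : ∀ b → lookup (Vec.insertAt c k b) m ≡ lookup c (punchOut (m≢k ∘ ≡.sym))
      entry b = ≡.trans (≡.cong (lookup (Vec.insertAt c k b)) (≡.sym (Fin.punchIn-punchOut (m≢k ∘ ≡.sym))))
                        (Vec.insertAt-punchIn c k b (punchOut (m≢k ∘ ≡.sym)))

    at-edge : ∀ e t → at (edge e) t ≋ point (weights e t)
    at-edge (k , c) t j = trans
      (solve 4 (λ t o X Y → (:1 :- t) :* (o :+ X) :+ t :* (o :+ Y) := o :+ ((:1 :- t) :* X :+ t :* Y)) refl t (origin j) _ _)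
      (+-congˡ (sum-mix x y (λ i → axis i j) t))
      where
      x y : Fin 3 → Carrier
      x m = bit (lookup (Vec.insertAt c k false) m)
      y m = bit (lookup (Vec.insertAt c k true) m)

    coordinate-edge : ∀ e {p t} → p ≋ at (edge e) t → ∀ m → coordinate m · p ≈ weights e t m
    coordinate-edge e {p} {t} eq m = trans (·-cong (coordinate m) (λ k → trans (eq k) (at-edge e t k)))
      (coordinate-point m (weights e t))

    coordinate-fixed : ∀ e {p} → p ∈ line (edge e) → ∀ {m} → m ≢ free e → coordinate m · p ≈ bit (value e m)
    coordinate-fixed e (t , eq) {m} m≢k = trans (coordinate-edge e eq m) (weights-fixed e t m≢k)

    coordinate-free : ∀ e {p t} → p ≋ at (edge e) t → coordinate (free e) · p ≈ t
    coordinate-free e {p} {t} eq = trans (coordinate-edge e eq (free e)) (weights-free e t)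

    ⟦⟧⊆line : ∀ s {p} → p ∈ ⟦ s ⟧ → p ∈ line s
    ⟦⟧⊆line s (t , _ , _ , eq) = t , eq

    coordinate-bounds : ∀ e m {p} → p ∈ ⟦ edge e ⟧ → 0# ≤ coordinate m · p × coordinate m · p ≤ 1#
    coordinate-bounds e m {p} p∈@(t , 0≤t , t≤1 , eq) = by-cases (m Fin.≟ free e)
      where
      within : ∀ {x} → coordinate m · p ≈ x → 0# ≤ x → x ≤ 1# → 0# ≤ coordinate m · p × coordinate m · p ≤ 1#
      within eq lower upper = 0≤-cong (sym eq) lower , ≤-respˡ-≈ (sym eq) upper

      by-cases : Dec (m ≡ free e) → 0# ≤ coordinate m · p × coordinate m · p ≤ 1#
      by-cases (yes m≡k) = within (trans (reflexive (≡.cong (λ m → coordinate m · p) m≡k)) (coordinate-free e {p} {t} eq)) 0≤t t≤1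
      by-cases (no m≢k)  = within (coordinate-fixed e {p} (⟦⟧⊆line (edge e) p∈) {m} m≢k) (0≤bit (value e m)) (bit≤1 (value e m))

    on-edge : ∀ e {p w} → p ≋ point w → (∀ m → m ≢ free e → w m ≈ bit (value e m)) → p ≋ at (edge e) (w (free e))
    on-edge e {p} {w} p≋ fixed k = trans (p≋ k) (trans (point-cong {w} {weights e (w (free e))} same k) (sym (at-edge e (w (free e)) k)))
      where
      same : ∀ m → w m ≈ weights e (w (free e)) m
      same m = by-cases (m Fin.≟ free e)
        where
        by-cases : Dec (m ≡ free e) → w m ≈ weights e (w (free e)) m
        by-cases (yes m≡k) = trans (reflexive (≡.cong w m≡k))
          (sym (trans (reflexive (≡.cong (weights e (w (free e))) m≡k)) (weights-free e (w (free e)))))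
        by-cases (no m≢k)  = trans (fixed m m≢k) (sym (weights-fixed e (w (free e)) m≢k))

    edge⊆face : ∀ e m → m ≢ free e → ⟦ edge e ⟧ ⊆ face m (value e m)
    edge⊆face e m m≢k {p} (t , 0≤t , t≤1 , eq) = weights e t , bounds , weights-fixed e t m≢k , λ k → trans (eq k) (at-edge e t k)
      where
      bounds : ∀ i → 0# ≤ weights e t i × weights e t i ≤ 1#
      bounds i = 0≤-cong (coordinate-edge e {p} {t} eq i) (proj₁ within) , ≤-respˡ-≈ (coordinate-edge e {p} {t} eq i) (proj₂ within)
        where within = coordinate-bounds e i {p} (t , 0≤t , t≤1 , eq)

    coordinate-face : ∀ m b {p} → p ∈ face m b → coordinate m · p ≈ bit b
    coordinate-face m b {p} (w , _ , wm≈ , eq) = trans (·-cong (coordinate m) eq) (trans (coordinate-point m w) wm≈)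

    direction-edge : ∀ e → direction (edge e) ≋ axis (free e)
    direction-edge (0F , x ∷ᵥ y ∷ᵥ []ᵥ) j = solve 6 (λ o x y a₀ a₁ a₂ → o :+ (:1 :* a₀ :+ (x :* a₁ :+ (y :* a₂ :+ :0))) :- (o :+ (:0 :* a₀ :+ (x :* a₁ :+ (y :* a₂ :+ :0)))) := a₀)
      refl (origin j) (bit x) (bit y) (axis 0F j) (axis 1F j) (axis 2F j)
    direction-edge (1F , x ∷ᵥ y ∷ᵥ []ᵥ) j = solve 6 (λ o x y a₀ a₁ a₂ → o :+ (x :* a₀ :+ (:1 :* a₁ :+ (y :* a₂ :+ :0))) :- (o :+ (x :* a₀ :+ (:0 :* a₁ :+ (y :* a₂ :+ :0)))) := a₁)
      refl (origin j) (bit x) (bit y) (axis 0F j) (axis 1F j) (axis 2F j)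
    direction-edge (2F , x ∷ᵥ y ∷ᵥ []ᵥ) j = solve 6 (λ o x y a₀ a₁ a₂ → o :+ (x :* a₀ :+ (y :* a₁ :+ (:1 :* a₂ :+ :0))) :- (o :+ (x :* a₀ :+ (y :* a₁ :+ (:0 :* a₂ :+ :0)))) := a₂)
      refl (origin j) (bit x) (bit y) (axis 0F j) (axis 1F j) (axis 2F j)

    same-free⇒parallel : ∀ e e′ → free e ≡ free e′ → Parallel (edge e) (edge e′)
    same-free⇒parallel e e′ eq = 1# , λ j → trans (direction-edge e j)
      (trans (reflexive (≡.cong (λ k → axis k j) eq)) (trans (sym (direction-edge e′ j)) (sym (*-identityˡ _))))

    -- The coordinate that varies on `e` rises by 1 along `e`, but would be fixed along `e′` if the
    -- free coordinates differed.
    parallel⇒same-free : ∀ e e′ → Parallel (edge e) (edge e′) → free e ≡ free e′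
    parallel⇒same-free e e′ (c , eq) = by-cases (free e Fin.≟ free e′)
      where
      f = coordinate (free e)

      impossible : free e ≢ free e′ → 1# ≈ 0#
      impossible k≢k′ = begin
        1#                                    ≈⟨ sym 1-0≈1 ⟩
        1# - 0#                               ≈⟨ +-cong (coordinate-free e {target (edge e)} {1#} (proj₂ (proj₂ (proj₂ (target-∈ (edge e))))))
                                                   (-‿cong (coordinate-free e {source (edge e)} {0#} (proj₂ (proj₂ (proj₂ (source-∈ (edge e))))))) ⟨
        f · target (edge e) - f · source (edge e)    ≈⟨ ·-⊖ f (target (edge e)) (source (edge e)) ⟨
        ⟨ linear f , direction (edge e) ⟩     ≈⟨ ⟨⟩-congˡ {linear f} {direction (edge e)} {c ⊙ direction (edge e′)} eq ⟩
        ⟨ linear f , c ⊙ direction (edge e′) ⟩  ≈⟨ ⟨⟩-⊙ (linear f) c (direction (edge e′)) ⟩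
        c * ⟨ linear f , direction (edge e′) ⟩  ≈⟨ *-congˡ (trans (·-⊖ f (target (edge e′)) (source (edge e′)))
                                                    (x≈y⇒x-y≈0 (trans (fixed (⟦⟧⊆line (edge e′) (target-∈ (edge e′)))) (sym (fixed (⟦⟧⊆line (edge e′) (source-∈ (edge e′)))))))) ⟩
        c * 0#                                ≈⟨ zeroʳ c ⟩
        0#                                    ∎
        where
        fixed : ∀ {p} → p ∈ line (edge e′) → f · p ≈ bit (value e′ (free e))
        fixed {p} p∈ = coordinate-fixed e′ {p} p∈ {free e} k≢k′

      by-cases : Dec (free e ≡ free e′) → free e ≡ free e′
      by-cases (yes k≡k′) = k≡k′
      by-cases (no k≢k′)  = contradiction (impossible k≢k′) 1≉0

    different-values⇒disjoint : ∀ e e′ {m} → m ≢ free e → m ≢ free e′ → value e m ≢ value e′ m →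
      ¬ (∃ λ p → p ∈ line (edge e) × p ∈ line (edge e′))
    different-values⇒disjoint e e′ {m} m≢k m≢k′ v≢v′ (p , p∈ , p∈′) = v≢v′ (bit-injective
      (trans (sym (coordinate-fixed e {p} p∈ {m} m≢k)) (coordinate-fixed e′ {p} p∈′ {m} m≢k′)))

  -- The parallelepiped cut out by 0 ≤ f m ≤ 1.
  module FromFunctionals (f : Fin 3 → Affine) (spanning : Spanning (linear ∘ f)) where

    private
      corner = interpolate {linear ∘ f} spanning (λ m → - constant (f m))

      open DualBasis {linear ∘ f} spanning

    box : Parallelepiped
    box = record
      { origin      = proj₁ corner
      ; axis        = dual
      ; independent = λ w eq m → trans (sym (coefficient w m)) (trans (⟨⟩-congˡ {linear (f m)} eq) (⟨⟩-zeroʳ (linear (f m))))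
      }

    open Box box public

    represent : ∀ p → p ≋ point (λ m → f m · p)
    represent p k = x-y≈0⇒x≈y (spanning (p ⊖ point w) (λ m → trans (⟨⟩-comm (p ⊖ point w) (linear (f m))) (begin
      ⟨ linear (f m) , p ⊖ point w ⟩
        ≈⟨ ·-⊖ (f m) p (point w) ⟩
      f m · p - (⟨ linear (f m) , point w ⟩ + constant (f m))
        ≈⟨ +-congˡ (-‿cong (+-congʳ (trans (⟨⟩-⊕ (linear (f m)) (proj₁ corner) (combine w dual))
             (+-cong (trans (⟨⟩-comm (linear (f m)) (proj₁ corner)) (proj₂ corner m)) (coefficient w m))))) ⟩
      f m · p - (- constant (f m) + f m · p + constant (f m))
        ≈⟨ solve 2 (λ x c → x :- ((:- c) :+ x :+ c) := :0) refl (f m · p) (constant (f m)) ⟩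
      0# ∎)) k)
      where
      w : Vector Carrier 3
      w m = f m · p

    ∈-edge : ∀ e {p} → (∀ m → m ≢ free e → f m · p ≈ bit (value e m)) → 0# ≤ f (free e) · p → f (free e) · p ≤ 1# →
      p ∈ ⟦ Parallelepiped.edge box e ⟧
    ∈-edge e {p} fixed lower upper = f (free e) · p , lower , upper , on-edge e {p} {λ m → f m · p} (represent p) fixed

    ∈-relint : ∀ e {p} → (∀ m → m ≢ free e → f m · p ≈ bit (value e m)) → 0# < f (free e) · p → f (free e) · p < 1# →
      p ∈ relint (Parallelepiped.edge box e)
    ∈-relint e {p} fixed lower upper = f (free e) · p , lower , upper , on-edge e {p} {λ m → f m · p} (represent p) fixed

-- The extremal configurations are antipodal, respectively strictly antipodal.

module Converse (ℝ : Reals) where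

  open Reals ℝ hiding (zero)
  open Geometry ℝ
  open Segment
  open OrderedField ℝ
  open LinearAlgebra ℝ
  open Separation ℝ
  open Affine
  open Directions ℝ
  open Boxes ℝ
  open IntegerCoefficients commutativeRing
  open SetoidReasoning setoid

  injective : ∀ {m n} (π : Permutation m n) {i j} → i ≢ j → π ⟨$⟩ʳ i ≢ π ⟨$⟩ʳ j
  injective π i≢j eq = i≢j (≡.trans (≡.sym (inverseˡ π)) (≡.trans (≡.cong (π ⟨$⟩ˡ_) eq) (inverseˡ π)))

  orient : Bool → Affine → Affine
  orient false f = f
  orient true  f = complement f

  orient-start : ∀ b f {p} → f · p ≈ bit b → orient b f · p ≈ 0#
  orient-start false f eq = eq
  orient-start true  f {p} eq = trans (·-complement f p) (x≈y⇒x-y≈0 (sym eq))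

  orient-end : ∀ b f {p} → f · p ≈ bit (not b) → orient b f · p ≈ 1#
  orient-end false f eq = eq
  orient-end true  f {p} eq = trans (·-complement f p) (trans (+-congˡ (-‿cong eq)) 1-0≈1)

  orient-≥0 : ∀ b f {p} → 0# ≤ f · p → f · p ≤ 1# → 0# ≤ orient b f · p
  orient-≥0 false f lower upper = lower
  orient-≥0 true  f {p} lower upper = 0≤-cong (sym (·-complement f p)) (x≤y⇒0≤y-x upper)

  orient-≤1 : ∀ b f {p} → 0# ≤ f · p → f · p ≤ 1# → 0# ≤ 1# - orient b f · p
  orient-≤1 false f lower upper = x≤y⇒0≤y-x upper
  orient-≤1 true  f {p} lower upper = 0≤-cong (trans (x≈1-[1-x] (f · p))
    (+-congˡ (-‿cong (sym (·-complement f p))))) lower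

  orient≈0 : ∀ b f {p} → orient b f · p ≈ 0# → f · p ≈ bit b
  orient≈0 false f eq = eq
  orient≈0 true  f {p} eq = sym (x-y≈0⇒x≈y (trans (sym (·-complement f p)) eq))

  orient≈1 : ∀ b f {p} → orient b f · p ≈ 1# → f · p ≈ bit (not b)
  orient≈1 false f eq = eq
  orient≈1 true  f {p} eq = trans (x≈1-[1-x] (f · p))
    (trans (+-congˡ (-‿cong (trans (sym (·-complement f p)) eq))) (-‿inverseʳ 1#))

  module Edges (Q : Parallelepiped) where

    open Parallelepiped Q
    open Box Q

    -- A coordinate of the box serves as separator; `b` tells at which end the first edge lies, and
    -- so whether `orient` has to reverse it.
    EdgeSeparated : EdgeLabel → EdgeLabel → Set
    EdgeSeparated e e′ = Σ[ m ∈ Fin 3 ] Σ[ b ∈ Bool ]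
      (∀ {p} → p ∈ ⟦ edge e ⟧ → coordinate m · p ≈ bit b) × (∀ {p} → p ∈ ⟦ edge e′ ⟧ → coordinate m · p ≈ bit (not b))

    edge-separated-sym : ∀ e e′ → EdgeSeparated e e′ → EdgeSeparated e′ e
    edge-separated-sym e e′ (m , b , start , end) = m , not b , end ,
      λ {p} p∈ → trans (start p∈) (reflexive (≡.cong bit (≡.sym (Bool.not-involutive b))))

    edge-separated⇒separated : ∀ {m n} (e : Vector EdgeLabel m) {S : Vector Segment n} →
      OneInEach S (λ i → ⟦ edge (e i) ⟧) → (∀ a b → a ≢ b → EdgeSeparated (e a) (e b)) → Separated S
    edge-separated⇒separated e {S} (π , S⊆) sep i j i≢j = from (sep (π ⟨$⟩ʳ i) (π ⟨$⟩ʳ j) (injective π i≢j))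
      where
      from : EdgeSeparated (e (π ⟨$⟩ʳ i)) (e (π ⟨$⟩ʳ j)) → Separator S i j
      from (m , b , start , end) = record
        { f  = orient b (coordinate m)
        ; ≈0 = λ {p} p∈ → orient-start b (coordinate m) {p} (start (S⊆ i p∈))
        ; ≈1 = λ {p} p∈ → orient-end b (coordinate m) {p} (end (S⊆ j p∈))
        ; ≥0 = λ k {p} p∈ → let within = coordinate-bounds (e (π ⟨$⟩ʳ k)) m {p} (S⊆ k p∈)
                            in orient-≥0 b (coordinate m) {p} (proj₁ within) (proj₂ within)
        ; ≤1 = λ k {p} p∈ → let within = coordinate-bounds (e (π ⟨$⟩ʳ k)) m {p} (S⊆ k p∈)
                            in orient-≤1 b (coordinate m) {p} (proj₁ within) (proj₂ within)
        }

    -- Distinct labels with the same free coordinate differ in one of the two fixed coordinates, and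
    -- that coordinate separates the edges.
    parallel-separated : ∀ e e′ → e ≢ e′ → Parallel (edge e) (edge e′) → EdgeSeparated e e′
    parallel-separated e e′ e≢e′ par = by-label e e′ e≢e′ (parallel⇒same-free e e′ par)
      where
      separate : ∀ k c c′ i → lookup c i ≢ lookup c′ i → EdgeSeparated (k , c) (k , c′)
      separate k c c′ i v≢v′ = punchIn k i , lookup c i ,
        (λ {p} p∈ → trans (coordinate-fixed (k , c) {p} (⟦⟧⊆line (edge (k , c)) p∈) {punchIn k i} (Fin.punchInᵢ≢i k i))
          (reflexive (≡.cong bit (Vec.insertAt-punchIn c k false i)))) ,
        (λ {p} p∈ → trans (coordinate-fixed (k , c′) {p} (⟦⟧⊆line (edge (k , c′)) p∈) {punchIn k i} (Fin.punchInᵢ≢i k i))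
          (reflexive (≡.cong bit (≡.trans (Vec.insertAt-punchIn c′ k false i) (Bool.¬-not (v≢v′ ∘ ≡.sym))))))

      by-label : ∀ e e′ → e ≢ e′ → free e ≡ free e′ → EdgeSeparated e e′
      by-label (k , x ∷ᵥ y ∷ᵥ []ᵥ) (.k , x′ ∷ᵥ y′ ∷ᵥ []ᵥ) e≢e′ ≡.refl = by-values (x Bool.≟ x′) (y Bool.≟ y′)
        where
        by-values : Dec (x ≡ x′) → Dec (y ≡ y′) → EdgeSeparated (k , x ∷ᵥ y ∷ᵥ []ᵥ) (k , x′ ∷ᵥ y′ ∷ᵥ []ᵥ)
        by-values (no x≢x′) _         = separate k (x ∷ᵥ y ∷ᵥ []ᵥ) (x′ ∷ᵥ y′ ∷ᵥ []ᵥ) 0F x≢x′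
        by-values (yes _)   (no y≢y′) = separate k (x ∷ᵥ y ∷ᵥ []ᵥ) (x′ ∷ᵥ y′ ∷ᵥ []ᵥ) 1F y≢y′
        by-values (yes p)   (yes q)   = contradiction (≡.cong₂ (λ x y → k , x ∷ᵥ y ∷ᵥ []ᵥ) p q) e≢e′

    face-separated : ∀ e e′ k b → ⟦ edge e ⟧ ⊆ face k b → ⟦ edge e′ ⟧ ⊆ face k (not b) → EdgeSeparated e e′
    face-separated e e′ k b e⊆ e′⊆ = k , b ,
      (λ {p} p∈ → coordinate-face k b {p} (e⊆ p∈)) , (λ {p} p∈ → coordinate-face k (not b) {p} (e′⊆ p∈))

  in-four-parallel-edges⇒separated : ∀ {n} {S : Vector Segment n} → InFourParallelEdges S → Separated S
  in-four-parallel-edges⇒separated {S = S} (Q , e , e-injective , parallel , inside) =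
    edge-separated⇒separated e {S} inside λ a b a≢b → parallel-separated (e a) (e b) (a≢b ∘ e-injective) (parallel a b)
    where open Edges Q

  in-edges-of-opposite-faces⇒separated : ∀ {n} {S : Vector Segment n} → InEdgesOfOppositeFaces S → Separated S
  in-edges-of-opposite-faces⇒separated {S = S}
    (Q , e , k , b , e-injective , (e₀⊆ , e₁⊆) , (e₂⊆ , e₃⊆) , e₀∥e₁ , e₂∥e₃ , _ , inside) =
    edge-separated⇒separated e {S} inside separate
    where
    open Edges Q

    01-separated = parallel-separated (e 0F) (e 1F) ((λ ()) ∘ e-injective) e₀∥e₁
    23-separated = parallel-separated (e 2F) (e 3F) ((λ ()) ∘ e-injective) e₂∥e₃
    02-separated = face-separated (e 0F) (e 2F) k b e₀⊆ e₂⊆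
    03-separated = face-separated (e 0F) (e 3F) k b e₀⊆ e₃⊆
    12-separated = face-separated (e 1F) (e 2F) k b e₁⊆ e₂⊆
    13-separated = face-separated (e 1F) (e 3F) k b e₁⊆ e₃⊆

    separate : ∀ i j → i ≢ j → EdgeSeparated (e i) (e j)
    separate 0F 0F i≢j = contradiction ≡.refl i≢j
    separate 0F 1F _   = 01-separated
    separate 0F 2F _   = 02-separated
    separate 0F 3F _   = 03-separated
    separate 1F 0F _   = edge-separated-sym (e 0F) (e 1F) 01-separated
    separate 1F 1F i≢j = contradiction ≡.refl i≢j
    separate 1F 2F _   = 12-separated
    separate 1F 3F _   = 13-separated
    separate 2F 0F _   = edge-separated-sym (e 0F) (e 2F) 02-separated
    separate 2F 1F _   = edge-separated-sym (e 1F) (e 2F) 12-separated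
    separate 2F 2F i≢j = contradiction ≡.refl i≢j
    separate 2F 3F _   = 23-separated
    separate 3F 0F _   = edge-separated-sym (e 0F) (e 3F) 03-separated
    separate 3F 1F _   = edge-separated-sym (e 1F) (e 3F) 13-separated
    separate 3F 2F _   = edge-separated-sym (e 2F) (e 3F) 23-separated
    separate 3F 3F i≢j = contradiction ≡.refl i≢j

  third : ∀ (a b : Fin 3) → a ≢ b → ∃ λ c → a ≢ c × b ≢ c × (∀ l → l ≡ a ⊎ l ≡ b ⊎ l ≡ c)
  third = from-yes (Fin.all? {3} λ a → Fin.all? {3} λ b → ¬? (a Fin.≟ b) →-dec Fin.any? {3} λ c →
    ¬? (a Fin.≟ c) ×-dec ¬? (b Fin.≟ c) ×-dec Fin.all? {3} λ l → (l Fin.≟ a) ⊎-dec (l Fin.≟ b) ⊎-dec (l Fin.≟ c))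

  relint⊆ : ∀ s {p} → p ∈ relint s → p ∈ ⟦ s ⟧
  relint⊆ s (t , (0≤t , _) , (t≤1 , _) , eq) = t , 0≤t , t≤1 , eq

  -- The separator of two of the edges is the coordinate that is free on the third edge `c`. The
  -- first two edges lie at its opposite ends because they are skew, and it is strictly between 0
  -- and 1 in the relative interior of the third.
  in-skew-edges⇒strictly-separated : ∀ {n} {S : Vector Segment n} → InSkewEdges S → StrictlySeparated S
  in-skew-edges⇒strictly-separated {n} {S} (Q , e , skew , π , S⊆) i j i≢j =
    separate (third (π ⟨$⟩ʳ i) (π ⟨$⟩ʳ j) (injective π i≢j))
    where
    open Parallelepiped Q
    open Box Q

    a = π ⟨$⟩ʳ i
    b = π ⟨$⟩ʳ j

    free-distinct : ∀ {x y} → x ≢ y → free (e x) ≢ free (e y)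
    free-distinct {x} {y} x≢y eq = proj₁ (skew x y x≢y) (same-free⇒parallel (e x) (e y) eq)

    separate : (∃ λ c → a ≢ c × b ≢ c × (∀ l → l ≡ a ⊎ l ≡ b ⊎ l ≡ c)) → StrictSeparator S i j
    separate (c , a≢c , b≢c , cover) = record
      { separator = record
        { f  = orient β (coordinate m)
        ; ≈0 = λ {p} p∈ → orient-start β (coordinate m) {p} (at-a (S⊆ i p∈))
        ; ≈1 = λ {p} p∈ → orient-end β (coordinate m) {p} (at-b (S⊆ j p∈))
        ; ≥0 = λ k {p} p∈ → let within = coordinate-bounds (e (π ⟨$⟩ʳ k)) m {p} (relint⊆ (edge (e (π ⟨$⟩ʳ k))) (S⊆ k p∈))
                            in orient-≥0 β (coordinate m) {p} (proj₁ within) (proj₂ within)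
        ; ≤1 = λ k {p} p∈ → let within = coordinate-bounds (e (π ⟨$⟩ʳ k)) m {p} (relint⊆ (edge (e (π ⟨$⟩ʳ k))) (S⊆ k p∈))
                            in orient-≤1 β (coordinate m) {p} (proj₁ within) (proj₂ within)
        }
      ; ≉0 = λ {k} {p} k≢i p∈ eq → not-start (cover (π ⟨$⟩ʳ k)) (injective π k≢i) {p} (S⊆ k p∈) (orient≈0 β (coordinate m) {p} eq)
      ; ≉1 = λ {k} {p} k≢j p∈ eq → not-end (cover (π ⟨$⟩ʳ k)) (injective π k≢j) {p} (S⊆ k p∈) (orient≈1 β (coordinate m) {p} eq)
      }
      where
      m = free (e c)

      β = value (e a) m

      m≢a : m ≢ free (e a)
      m≢a = free-distinct (a≢c ∘ ≡.sym)

      m≢b : m ≢ free (e b)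
      m≢b = free-distinct (b≢c ∘ ≡.sym)

      frees : ∀ l → l ≡ free (e a) ⊎ l ≡ free (e b) ⊎ l ≡ m
      frees l with third (free (e a)) (free (e b)) (free-distinct (injective π i≢j))
      ... | c′ , _ , _ , cover′ with cover′ l | cover′ m
      ...   | inj₁ p        | _             = inj₁ p
      ...   | inj₂ (inj₁ p) | _             = inj₂ (inj₁ p)
      ...   | inj₂ (inj₂ p) | inj₂ (inj₂ q) = inj₂ (inj₂ (≡.trans p (≡.sym q)))
      ...   | inj₂ (inj₂ p) | inj₁ q        = contradiction q m≢a
      ...   | inj₂ (inj₂ p) | inj₂ (inj₁ q) = contradiction q m≢b

      -- If the fixed values at m agreed, then the lines would meet.
      values-differ : value (e b) m ≢ β
      values-differ same = proj₂ (skew a b (injective π i≢j)) (at (edge (e a)) tₐ , (tₐ , λ _ → refl) , (t_b , λ k →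
        trans (at-edge (e a) tₐ k) (trans (point-cong {weights (e a) tₐ} {weights (e b) t_b} weights-agree k) (sym (at-edge (e b) t_b k)))))
        where
        tₐ t_b : Carrier
        -- At the meeting point, the free coordinate of either edge has the value at which the other
        -- edge fixes it.
        tₐ = bit (value (e b) (free (e a)))
        t_b = bit (value (e a) (free (e b)))

        a≢b : free (e a) ≢ free (e b)
        a≢b = free-distinct (injective π i≢j)

        agree : ∀ l → l ≡ free (e a) ⊎ l ≡ free (e b) ⊎ l ≡ m → weights (e a) tₐ l ≈ weights (e b) t_b l
        agree l (inj₁ eq) = ≡.subst (λ l → weights (e a) tₐ l ≈ weights (e b) t_b l) (≡.sym eq)
          (trans (weights-free (e a) tₐ) (sym (weights-fixed (e b) t_b a≢b)))
        agree l (inj₂ (inj₁ eq)) = ≡.subst (λ l → weights (e a) tₐ l ≈ weights (e b) t_b l) (≡.sym eq)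
          (trans (weights-fixed (e a) tₐ (a≢b ∘ ≡.sym)) (sym (weights-free (e b) t_b)))
        agree l (inj₂ (inj₂ eq)) = ≡.subst (λ l → weights (e a) tₐ l ≈ weights (e b) t_b l) (≡.sym eq)
          (trans (weights-fixed (e a) tₐ m≢a) (trans (reflexive (≡.cong bit (≡.sym same))) (sym (weights-fixed (e b) t_b m≢b))))

        weights-agree : ∀ l → weights (e a) tₐ l ≈ weights (e b) t_b l
        weights-agree l = agree l (frees l)

      at-a : ∀ {p} → p ∈ relint (edge (e a)) → coordinate m · p ≈ bit β
      at-a {p} p∈ = coordinate-fixed (e a) {p} (⟦⟧⊆line (edge (e a)) (relint⊆ (edge (e a)) p∈)) {m} m≢a

      at-b : ∀ {p} → p ∈ relint (edge (e b)) → coordinate m · p ≈ bit (not β)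
      at-b {p} p∈ = trans (coordinate-fixed (e b) {p} (⟦⟧⊆line (edge (e b)) (relint⊆ (edge (e b)) p∈)) {m} m≢b)
        (reflexive (≡.cong bit (Bool.¬-not values-differ)))

      strictly-inside : ∀ b′ {p} → p ∈ relint (edge (e c)) → coordinate m · p ≉ bit b′
      strictly-inside false {p} (t , (_ , 0≉t) , _ , p≋) eq = 0≉t (trans (sym eq) (coordinate-free (e c) {p} {t} p≋))
      strictly-inside true  {p} (t , _ , (_ , t≉1) , p≋) eq = t≉1 (trans (sym (coordinate-free (e c) {p} {t} p≋)) eq)

      not-start : ∀ {l} → l ≡ a ⊎ l ≡ b ⊎ l ≡ c → l ≢ a → ∀ {p} → p ∈ relint (edge (e l)) → coordinate m · p ≉ bit β
      not-start (inj₁ l≡a)               l≢a _          = contradiction l≡a l≢a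
      not-start {l} (inj₂ (inj₁ l≡b))    _   {p} p∈ eq  = bit-distinct β (trans (sym eq)
        (at-b (≡.subst (λ l → p ∈ relint (edge (e l))) l≡b p∈)))
      not-start (inj₂ (inj₂ l≡c))        _   {p} p∈     = strictly-inside β {p} (≡.subst (λ l → p ∈ relint (edge (e l))) l≡c p∈)

      not-end : ∀ {l} → l ≡ a ⊎ l ≡ b ⊎ l ≡ c → l ≢ b → ∀ {p} → p ∈ relint (edge (e l)) → coordinate m · p ≉ bit (not β)
      not-end (inj₁ l≡a)            _   {p} p∈ eq = bit-distinct β (trans (sym
        (at-a (≡.subst (λ l → p ∈ relint (edge (e l))) l≡a p∈))) eq)
      not-end (inj₂ (inj₁ l≡b))     l≢b _         = contradiction l≡b l≢b
      not-end (inj₂ (inj₂ l≡c))     _   {p} p∈    = strictly-inside (not β) {p} (≡.subst (λ l → p ∈ relint (edge (e l))) l≡c p∈)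

  -- An affine function that is constant along the translation may be prescribed at the three base
  -- vertices.
  in-lateral-edges⇒strictly-separated : ∀ {n} {S : Vector Segment n} → InLateralEdgesOfPrism S → StrictlySeparated S
  in-lateral-edges⇒strictly-separated {n} {S} (prism , π , S⊆) i j i≢j = record
    { separator = record
      { f  = f
      ; ≈0 = λ {p} p∈ → trans (on-lateral (π ⟨$⟩ʳ i) {p} (S⊆ i p∈)) height-a
      ; ≈1 = λ {p} p∈ → trans (on-lateral (π ⟨$⟩ʳ j) {p} (S⊆ j p∈)) height-b
      ; ≥0 = λ k {p} p∈ → 0≤-cong (sym (on-lateral (π ⟨$⟩ʳ k) {p} (S⊆ k p∈))) (proj₁ (height-bounds (π ⟨$⟩ʳ k)))
      ; ≤1 = λ k {p} p∈ → 0≤-cong (+-congˡ (-‿cong (sym (on-lateral (π ⟨$⟩ʳ k) {p} (S⊆ k p∈))))) (proj₂ (height-bounds (π ⟨$⟩ʳ k)))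
      }
    ; ≉0 = λ {k} {p} k≢i p∈ eq → height≉0 (injective π k≢i) (trans (sym (on-lateral (π ⟨$⟩ʳ k) {p} (S⊆ k p∈))) eq)
    ; ≉1 = λ {k} {p} k≢j p∈ eq → height≉1 (injective π k≢j) (trans (sym (on-lateral (π ⟨$⟩ʳ k) {p} (S⊆ k p∈))) eq)
    }
    where
    open TriangularPrism prism

    a = π ⟨$⟩ʳ i
    b = π ⟨$⟩ʳ j

    height : Fin 3 → Carrier
    height l = by-cases (l Fin.≟ a) (l Fin.≟ b)
      where
      by-cases : Dec (l ≡ a) → Dec (l ≡ b) → Carrier
      by-cases (yes _) _       = 0#
      by-cases (no _)  (yes _) = 1#
      -- The third edge must lie strictly between the planes, which excludes the values 0 and 1.
      by-cases (no _)  (no _)  = ½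

    height-a : height a ≈ 0#
    height-a with a Fin.≟ a
    ... | yes _  = refl
    ... | no a≢a = contradiction ≡.refl a≢a

    height-b : height b ≈ 1#
    height-b with b Fin.≟ a | b Fin.≟ b
    ... | yes b≡a | _      = contradiction (≡.sym b≡a) (injective π i≢j)
    ... | no _    | yes _  = refl
    ... | no _    | no b≢b = contradiction ≡.refl b≢b

    height-bounds : ∀ l → 0# ≤ height l × 0# ≤ 1# - height l
    height-bounds l with l Fin.≟ a | l Fin.≟ b
    ... | yes _ | _     = ≤-refl , x≤y⇒0≤y-x 0≤1
    ... | no _  | yes _ = 0≤1 , x≤y⇒0≤y-x ≤-refl
    ... | no _  | no _  = proj₁ ½-positive , 0≤-cong (sym 1-½≈½) (proj₁ ½-positive)

    height≉0 : ∀ {l} → l ≢ a → height l ≉ 0#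
    height≉0 {l} l≢a with l Fin.≟ a | l Fin.≟ b
    ... | yes l≡a | _     = contradiction l≡a l≢a
    ... | no _    | yes _ = 1≉0
    ... | no _    | no _  = Positive⇒≉0 ½-positive

    height≉1 : ∀ {l} → l ≢ b → height l ≉ 1#
    height≉1 {l} l≢b with l Fin.≟ a | l Fin.≟ b
    ... | yes _ | _       = λ eq → 1≉0 (sym eq)
    ... | no _  | yes l≡b = contradiction l≡b l≢b
    ... | no _  | no _    = λ eq → Positive⇒≉0 ½-positive (trans (sym 1-½≈½) (x≈y⇒x-y≈0 (sym eq)))

    solution = interpolate {frame} (independent⇒spanning {frame} independent)
      (height 1F - height 0F ∷ height 2F - height 0F ∷ 0# ∷ [])

    u = proj₁ solution

    f : Affine
    f = affine u (height 0F - ⟨ u , base 0F ⟩)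

    f-base₀ : f · base 0F ≈ height 0F
    f-base₀ = solve 2 (λ x h → x :+ (h :- x) := h) refl ⟨ u , base 0F ⟩ (height 0F)

    f-base : ∀ l → f · base l ≈ height l
    f-base 0F = f-base₀
    f-base 1F = begin
      f · base 1F                                   ≈⟨ solve 2 (λ x y → x := x :- y :+ y) refl (f · base 1F) (f · base 0F) ⟩
      f · base 1F - f · base 0F + f · base 0F       ≈⟨ +-cong (trans (sym (·-⊖ f (base 1F) (base 0F))) (proj₂ solution 0F)) f-base₀ ⟩
      height 1F - height 0F + height 0F             ≈⟨ solve 2 (λ x y → x :- y :+ y := x) refl (height 1F) (height 0F) ⟩
      height 1F                                     ∎
    f-base 2F = begin
      f · base 2F                                   ≈⟨ solve 2 (λ x y → x := x :- y :+ y) refl (f · base 2F) (f · base 0F) ⟩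
      f · base 2F - f · base 0F + f · base 0F       ≈⟨ +-cong (trans (sym (·-⊖ f (base 2F) (base 0F))) (proj₂ solution 1F)) f-base₀ ⟩
      height 2F - height 0F + height 0F             ≈⟨ solve 2 (λ x y → x :- y :+ y := x) refl (height 2F) (height 0F) ⟩
      height 2F                                     ∎

    f-top : ∀ l → f · (base l ⊕ translation) ≈ height l
    f-top l = trans (+-congʳ (trans (⟨⟩-⊕ u (base l) translation) (trans (+-congˡ (proj₂ solution 2F)) (+-identityʳ _)))) (f-base l)

    on-lateral : ∀ l {p} → p ∈ ⟦ lateralEdge l ⟧ → f · p ≈ height l
    on-lateral l {p} (t , _ , _ , eq) = begin
      f · p                                            ≈⟨ ·-cong f eq ⟩
      f · at (lateralEdge l) t                         ≈⟨ ·-at f (lateralEdge l) t ⟩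
      (1# - t) * f · base l + t * f · (base l ⊕ translation)  ≈⟨ +-cong (*-congˡ (f-base l)) (*-congˡ (f-top l)) ⟩
      (1# - t) * height l + t * height l               ≈⟨ solve 2 (λ t h → (:1 :- t) :* h :+ t :* h := h) refl t (height l) ⟩
      height l                                         ∎

-- Parallelepipeds and prisms around given segments.

module Constructions (ℝ : Reals) where

  open Reals ℝ hiding (zero)
  open Geometry ℝ
  open Segment
  open OrderedField ℝ
  open LinearAlgebra ℝ
  open Separation ℝ
  open Directions ℝ
  open Classification ℝ
  open Boxes ℝ
  open Converse ℝ
  open Affine
  open IntegerCoefficients commutativeRing
  open SemiringSum semiring using (sum)
  open SetoidReasoning setoid

  segment-nonneg : ∀ f s → 0# ≤ f · source s → 0# ≤ f · target s → ∀ {q} → q ∈ ⟦ s ⟧ → 0# ≤ f · q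
  segment-nonneg f s 0≤source 0≤target (t , 0≤t , t≤1 , eq) = 0≤-cong (sym (trans (·-cong f eq) (·-at f s t)))
    (+-nonneg (*-nonneg (x≤y⇒0≤y-x t≤1) 0≤source) (*-nonneg 0≤t 0≤target))

  1+x²-bound : ∀ x → 0# ≤ 1# + x * x - x
  1+x²-bound x = [ (λ 0≤x → 0≤-cong (solve 1 (λ x → (:1 :- x) :* (:1 :- x) :+ x := :1 :+ x :* x :- x) refl x)
                      (+-nonneg (x*x-nonneg (1# - x)) 0≤x))
                 , (λ 0≤-x → +-nonneg (+-nonneg 0≤1 (x*x-nonneg x)) 0≤-x) ]′ (sign x)

  common-bound : ∀ {n} (x : Vector Carrier n) → ∃ λ K → Positive K × (∀ i → 0# ≤ K - x i × 0# ≤ K + x i)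
  common-bound {n} x = K , +-positive 1-positive (squares x) , λ i → below x i , 0≤-cong (above x i) (below (λ i → - x i) i)
    where
    K = 1# + sum (λ i → x i * x i)

    squares : ∀ {n} (x : Vector Carrier n) → 0# ≤ sum (λ i → x i * x i)
    squares {n} x = sum-nonneg {n} (λ i → x*x-nonneg (x i))

    below : ∀ {n} (x : Vector Carrier n) i → 0# ≤ 1# + sum (λ i → x i * x i) - x i
    below x zero = 0≤-cong (solve 2 (λ x s → :1 :+ x :* x :- x :+ s := :1 :+ (x :* x :+ s) :- x) refl (x 0F) _)
      (+-nonneg (1+x²-bound (x 0F)) (squares (tail x)))
    below x (suc i) = 0≤-cong (solve 3 (λ x s y → x :* x :+ (:1 :+ s :- y) := :1 :+ (x :* x :+ s) :- y) refl (x 0F) _ (x (suc i)))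
      (+-nonneg (x*x-nonneg (x 0F)) (below (tail x) i))

    negated : ∀ {n} (x : Vector Carrier n) → sum (λ i → - x i * - x i) ≈ sum (λ i → x i * x i)
    negated {zero}  x = refl
    negated {suc n} x = +-cong (solve 1 (λ x → (:- x) :* (:- x) := x :* x) refl (x 0F)) (negated (tail x))

    above : ∀ {n} (x : Vector Carrier n) i → 1# + sum (λ i → - x i * - x i) - - x i ≈ 1# + sum (λ i → x i * x i) + x i
    above x i = trans (+-congʳ (+-congˡ (negated x))) (solve 2 (λ s y → s :- (:- y) := s :+ y) refl _ (x i))

  -- Finitely many bounded segments fit between two planes orthogonal to any nonzero `u`. This
  -- supplies the coordinate in the common direction, for which parallel segments have no separator.
  scaled : ∀ {n} (S : Vector Segment n) u → ∃ λ f →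
    (∀ {p} → ⟨ u , p ⟩ ≉ 0# → ⟨ linear f , p ⟩ ≉ 0#) ×
    (∀ k {q} → q ∈ ⟦ S k ⟧ → 0# ≤ f · q × 0# ≤ 1# - f · q)
  scaled {n} S u = f , (λ {p} up≉0 eq → *-≉0 (Positive⇒≉0 κ>0) up≉0 (trans (sym (linear-f p)) eq)) ,
    λ k {q} q∈ → segment-nonneg f (S k) (at-source k) (at-target k) {q} q∈ ,
             0≤-cong (·-complement f q) (segment-nonneg (complement f) (S k)
               (0≤-cong (sym (·-complement f (source (S k)))) (at-source′ k))
               (0≤-cong (sym (·-complement f (target (S k)))) (at-target′ k)) {q} q∈)
    where
    s = common-bound (λ k → ⟨ u , source (S k) ⟩)
    t = common-bound (λ k → ⟨ u , target (S k) ⟩)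

    K = proj₁ s + proj₁ t

    K>0 : Positive K
    K>0 = +-positive (proj₁ (proj₂ s)) (proj₁ (proj₁ (proj₂ t)))

    K⁻¹ = proj₁ (inverse-positive K>0)

    -- With `K` bounding the values of `u` in absolute value, `κ` maps them into an interval of
    -- radius one half around zero, and the constant `½` shifts this to the unit interval.
    κ = ½ * K⁻¹

    κ>0 : Positive κ
    κ>0 = *-positive ½-positive (proj₁ (proj₂ (inverse-positive K>0)))

    κK≈½ : κ * K ≈ ½
    κK≈½ = trans (solve 3 (λ h i k → h :* i :* k := h :* (k :* i)) refl ½ K⁻¹ K)
      (trans (*-congˡ (proj₂ (proj₂ (inverse-positive K>0)))) (*-identityʳ ½))

    f : Affine
    f = affine (κ ⊙ u) ½

    linear-f : ∀ p → ⟨ κ ⊙ u , p ⟩ ≈ κ * ⟨ u , p ⟩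
    linear-f = ⟨⟩-factor {κ ⊙ u} {u} (λ _ → refl)

    lower : ∀ {p} → 0# ≤ K + ⟨ u , p ⟩ → 0# ≤ f · p
    lower {p} h = 0≤-cong (trans (solve 3 (λ c k x → c :* (k :+ x) := c :* x :+ c :* k) refl κ K ⟨ u , p ⟩)
      (+-cong (sym (linear-f p)) κK≈½)) (*-nonneg (proj₁ κ>0) h)

    upper : ∀ {p} → 0# ≤ K - ⟨ u , p ⟩ → 0# ≤ 1# - f · p
    upper {p} h = 0≤-cong (begin
      κ * (K - ⟨ u , p ⟩)               ≈⟨ solve 3 (λ c k x → c :* (k :- x) := c :* k :+ c :* k :- (c :* x :+ c :* k)) refl κ K ⟨ u , p ⟩ ⟩
      κ * K + κ * K - (κ * ⟨ u , p ⟩ + κ * K)  ≈⟨ +-cong (trans (+-cong κK≈½ κK≈½) ½+½≈1) (-‿cong (+-cong (sym (linear-f p)) κK≈½)) ⟩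
      1# - f · p                        ∎) (*-nonneg (proj₁ κ>0) h)

    at-source : ∀ k → 0# ≤ f · source (S k)
    at-source k = lower {source (S k)} (0≤-cong (solve 3 (λ a b x → b :+ (a :+ x) := a :+ b :+ x) refl (proj₁ s) (proj₁ t) ⟨ u , source (S k) ⟩)
      (+-nonneg (proj₁ (proj₁ (proj₂ t))) (proj₂ (proj₂ (proj₂ s) k))))

    at-target : ∀ k → 0# ≤ f · target (S k)
    at-target k = lower {target (S k)} (0≤-cong (sym (+-assoc (proj₁ s) (proj₁ t) ⟨ u , target (S k) ⟩))
      (+-nonneg (proj₁ (proj₁ (proj₂ s))) (proj₂ (proj₂ (proj₂ t) k))))

    at-source′ : ∀ k → 0# ≤ 1# - f · source (S k)
    at-source′ k = upper {source (S k)} (0≤-cong (solve 3 (λ a b x → b :+ (a :- x) := a :+ b :- x) refl (proj₁ s) (proj₁ t) ⟨ u , source (S k) ⟩)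
      (+-nonneg (proj₁ (proj₁ (proj₂ t))) (proj₁ (proj₂ (proj₂ s) k))))

    at-target′ : ∀ k → 0# ≤ 1# - f · target (S k)
    at-target′ k = upper {target (S k)} (0≤-cong (sym (+-assoc (proj₁ s) (proj₁ t) (- ⟨ u , target (S k) ⟩)))
      (+-nonneg (proj₁ (proj₁ (proj₂ s))) (proj₁ (proj₂ (proj₂ t) k))))

  module _ {n} {S : Vector Segment n} where

    private
      p d : Fin n → Point
      p i = source (S i)
      d i = direction (S i)

    -- The relation reads `f · p c ≈ 1# + f · p e`, and within the unit interval this is possible
    -- only for the values 1 and 0.
    corner : ∀ {a b c e} (σ : Separator S a b) → let f = Separator.f σ in
      f · p a + f · p c ≈ f · p b + f · p e → f · p e ≈ 0# × f · p c ≈ 1#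
    corner {a} {b} {c} {e} σ eq = fe≈0 , trans fc≈ (trans (+-congˡ fe≈0) (+-identityʳ 1#))
      where
      open Separator σ

      fc≈ : f · p c ≈ 1# + f · p e
      fc≈ = trans (sym (+-identityˡ _)) (trans (+-congʳ (sym source≈0)) (trans eq (+-congʳ source≈1)))

      fe≈0 : f · p e ≈ 0#
      fe≈0 = 0≤x∧0≤-x⇒x≈0 (source≥0 e) (0≤-cong (trans (+-congˡ (-‿cong fc≈))
        (solve 1 (λ x → :1 :- (:1 :+ x) := :- x) refl (f · p e))) (source≤1 c))

  distinct? : ∀ {n} (e : Vector (Fin 3 × Vec Bool 2) n) → Dec (∀ i j → e i ≡ e j → i ≡ j)
  distinct? e = Fin.all? λ i → Fin.all? λ j → Product.≡-dec Fin._≟_ (Vec.≡-dec Bool._≟_) (e i) (e j) →-dec (i Fin.≟ j)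

  -- The separators of `0F` from its two neighbours `2F` and `3F` are coordinates on the projected
  -- parallelogram; by `corner` they are 0 or 1 on every segment. The remaining coordinate is a
  -- scaled functional that does not vanish on the common direction.
  parallelogram⇒in-four-parallel-edges : ∀ {S : Vector Segment 4} → Separated S →
    (∀ k → Proportional (direction (S k)) (direction (S 0F))) →
    Diagonals (λ m → source (S m)) (direction (S 0F)) 0F 1F 2F 3F → InFourParallelEdges S
  parallelogram⇒in-four-parallel-edges {S} sep parallel diagonals =
    box , e , e-injective , (λ i j → same-free⇒parallel (e i) (e j) (≡.trans (vertical i) (≡.sym (vertical j)))) ,
    Permutation.id , λ i {q} q∈ → ∈-edge (e i) {q} (fixed i q∈)
      (≡.subst (λ k → 0# ≤ f k · q) (≡.sym (vertical i)) (proj₁ (within i q∈)))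
      (≡.subst (λ k → f k · q ≤ 1#) (≡.sym (vertical i)) (0≤y-x⇒x≤y (proj₂ (within i q∈))))
    where
    d : Fin 4 → Point
    d m = direction (S m)

    σ₀₂ = sep 0F 2F (λ ())
    σ₀₃ = sep 0F 3F (λ ())
    X = Separator.f σ₀₂
    Y = Separator.f σ₀₃
    Z = proj₁ (scaled S (d 0F))
    within = proj₂ (proj₂ (scaled S (d 0F)))

    f : Fin 3 → Affine
    f = Z ∷ X ∷ Y ∷ []

    X-values : X · source (S 3F) ≈ 0# × X · source (S 1F) ≈ 1#
    X-values = corner {S = S} {0F} {2F} {1F} {3F} σ₀₂ (diagonals X (Separator.⟂ⁱ σ₀₂))

    Y-values : Y · source (S 2F) ≈ 0# × Y · source (S 1F) ≈ 1#
    Y-values = corner {S = S} {0F} {3F} {1F} {2F} σ₀₃ (trans (diagonals Y (Separator.⟂ⁱ σ₀₃)) (+-comm _ _))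

    constant-on : ∀ g k {q} → linear g ⟂ d 0F → q ∈ ⟦ S k ⟧ → g · q ≈ g · source (S k)
    constant-on g k {q} g⟂ = constant-along {S = S} g {k} {q} (⟂-proportional {linear g} {d 0F} {d k} (parallel k) g⟂)

    spanning : Spanning (linear ∘ f)
    spanning u h = independent⇒spanning {linear Z ∷ linear X ∷ linear Y ∷ []}
      (triangular-independent {x₀ = d 0F} {source (S 2F) ⊖ source (S 0F)} {source (S 3F) ⊖ source (S 0F)}
        (proj₁ (proj₂ (scaled S (d 0F))) {d 0F} (λ eq → direction≉𝟎 (S 0F) (⟨z,z⟩≈0⇒z≋𝟎 (d 0F) eq)))
        (Separator.⟂ⁱ σ₀₂) (Separator.⟂ⁱ σ₀₃)
        (λ eq → 1≉0 (trans (sym (Separator.rise σ₀₂)) eq))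
        (trans (difference {S = S} σ₀₃ (source (S 2F))) (proj₁ Y-values))
        (λ eq → 1≉0 (trans (sym (Separator.rise σ₀₃)) eq)))
      u λ { 0F → h 0F ; 1F → h 1F ; 2F → h 2F }

    open FromFunctionals f spanning

    e : Vector (Parallelepiped.EdgeLabel box) 4
    e = (0F , false ∷ᵥ false ∷ᵥ []ᵥ) ∷ (0F , true ∷ᵥ true ∷ᵥ []ᵥ) ∷ (0F , true ∷ᵥ false ∷ᵥ []ᵥ) ∷ (0F , false ∷ᵥ true ∷ᵥ []ᵥ) ∷ []

    e-injective : ∀ {i j} → e i ≡ e j → i ≡ j
    e-injective = from-yes (distinct? e) _ _

    vertical : ∀ i → proj₁ (e i) ≡ 0F
    vertical 0F = ≡.refl
    vertical 1F = ≡.refl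
    vertical 2F = ≡.refl
    vertical 3F = ≡.refl

    fixed : ∀ i {q} → q ∈ ⟦ S i ⟧ → ∀ m → m ≢ free (e i) → f m · q ≈ bit (value (e i) m)
    fixed i  q∈ 0F m≢ = contradiction (≡.sym (vertical i)) m≢
    fixed 0F {q} q∈ 1F _ = Separator.≈0 σ₀₂ q∈
    fixed 0F {q} q∈ 2F _ = Separator.≈0 σ₀₃ q∈
    fixed 1F {q} q∈ 1F _ = trans (constant-on X 1F {q} (Separator.⟂ⁱ σ₀₂) q∈) (proj₂ X-values)
    fixed 1F {q} q∈ 2F _ = trans (constant-on Y 1F {q} (Separator.⟂ⁱ σ₀₃) q∈) (proj₂ Y-values)
    fixed 2F {q} q∈ 1F _ = Separator.≈1 σ₀₂ q∈
    fixed 2F {q} q∈ 2F _ = trans (constant-on Y 2F {q} (Separator.⟂ⁱ σ₀₃) q∈) (proj₁ Y-values)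
    fixed 3F {q} q∈ 1F _ = trans (constant-on X 3F {q} (Separator.⟂ⁱ σ₀₂) q∈) (proj₁ X-values)
    fixed 3F {q} q∈ 2F _ = Separator.≈1 σ₀₃ q∈

  -- The separator `Z` is the height between the opposite faces, and within each face the separator
  -- of its two segments is a coordinate. This one varies along the direction of the other face.
  two-directions⇒in-opposite-faces : ∀ {S : Vector Segment 4} (sep : Separated S) →
    let d = λ m → direction (S m) ; f₀₂ = Separator.f (sep 0F 2F (λ ())) in
    LinearlyIndependent (d 0F ∷ d 2F ∷ []) → Proportional (d 1F) (d 0F) → Proportional (d 3F) (d 2F) →
    f₀₂ · source (S 1F) ≈ 0# → f₀₂ · source (S 3F) ≈ 1# → InEdgesOfOppositeFaces S
  two-directions⇒in-opposite-faces {S} sep indep d₁∥d₀ d₃∥d₂ Z₁≈0 Z₃≈1 =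
    box , e , 2F , false , e-injective ,
    (edge⊆face (e 0F) 2F (λ ()) , edge⊆face (e 1F) 2F (λ ())) ,
    (edge⊆face (e 2F) 2F (λ ()) , edge⊆face (e 3F) 2F (λ ())) ,
    same-free⇒parallel (e 0F) (e 1F) ≡.refl , same-free⇒parallel (e 2F) (e 3F) ≡.refl ,
    (λ par → case parallel⇒same-free (e 0F) (e 2F) par of λ ()) ,
    Permutation.id , λ i {q} q∈ → ∈-edge (e i) {q} (fixed i q∈) (proj₁ (bounds i (free (e i)) q∈)) (proj₂ (bounds i (free (e i)) q∈))
    where
    d : Fin 4 → Point
    d m = direction (S m)

    σ₂₃ = sep 2F 3F (λ ())
    σ₀₁ = sep 0F 1F (λ ())
    σ₀₂ = sep 0F 2F (λ ())
    X = Separator.f σ₂₃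
    Y = Separator.f σ₀₁
    Z = Separator.f σ₀₂

    f : Fin 3 → Affine
    f = X ∷ Y ∷ Z ∷ []

    bounds : ∀ k m {q} → q ∈ ⟦ S k ⟧ → 0# ≤ f m · q × f m · q ≤ 1#
    bounds k 0F q∈ = Separator.≥0 σ₂₃ k q∈ , 0≤y-x⇒x≤y (Separator.≤1 σ₂₃ k q∈)
    bounds k 1F q∈ = Separator.≥0 σ₀₁ k q∈ , 0≤y-x⇒x≤y (Separator.≤1 σ₀₁ k q∈)
    bounds k 2F q∈ = Separator.≥0 σ₀₂ k q∈ , 0≤y-x⇒x≤y (Separator.≤1 σ₀₂ k q∈)

    -- A functional that kills both directions is proportional to `Z` and cannot separate segments
    -- at equal height.
    not-constant : ∀ {i j} (σ : Separator S i j) → Z · source (S i) ≈ Z · source (S j) →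
      ¬ (linear (Separator.f σ) ⟂ d 0F × linear (Separator.f σ) ⟂ d 2F)
    not-constant {i} {j} σ same (⟂d₀ , ⟂d₂) = 1≉0 (trans (sym (Separator.rise σ))
      (proportional-⟂ {linear (Separator.f σ)} {linear Z} {source (S j) ⊖ source (S i)}
        (annihilators-proportional {d 0F} {d 2F} indep (Separator.linear≉𝟎 σ₀₂) (Separator.⟂ⁱ σ₀₂) (Separator.⟂ʲ σ₀₂) ⟂d₀ ⟂d₂)
        (trans (·-⊖ Z (source (S j)) (source (S i))) (x≈y⇒x-y≈0 (sym same)))))

    spanning : Spanning (linear ∘ f)
    spanning u h = independent⇒spanning {linear X ∷ linear Y ∷ linear Z ∷ []}
      (triangular-independent {x₀ = d 0F} {d 2F} {source (S 2F) ⊖ source (S 0F)}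
        (λ X⟂d₀ → not-constant σ₂₃ (trans (Separator.source≈1 σ₀₂) (sym Z₃≈1)) (X⟂d₀ , Separator.⟂ⁱ σ₂₃))
        (Separator.⟂ⁱ σ₀₁) (Separator.⟂ⁱ σ₀₂)
        (λ Y⟂d₂ → not-constant σ₀₁ (trans (Separator.source≈0 σ₀₂) (sym Z₁≈0)) (Separator.⟂ⁱ σ₀₁ , Y⟂d₂))
        (Separator.⟂ʲ σ₀₂)
        (λ eq → 1≉0 (trans (sym (Separator.rise σ₀₂)) eq)))
      u λ { 0F → h 0F ; 1F → h 1F ; 2F → h 2F }

    open FromFunctionals f spanning

    e : Vector (Parallelepiped.EdgeLabel box) 4
    e = (0F , false ∷ᵥ false ∷ᵥ []ᵥ) ∷ (0F , true ∷ᵥ false ∷ᵥ []ᵥ) ∷ (1F , false ∷ᵥ true ∷ᵥ []ᵥ) ∷ (1F , true ∷ᵥ true ∷ᵥ []ᵥ) ∷ []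

    e-injective : ∀ {i j} → e i ≡ e j → i ≡ j
    e-injective = from-yes (distinct? e) _ _

    fixed : ∀ i {q} → q ∈ ⟦ S i ⟧ → ∀ m → m ≢ free (e i) → f m · q ≈ bit (value (e i) m)
    fixed 0F     q∈ 0F m≢ = contradiction ≡.refl m≢
    fixed 0F     q∈ 1F _  = Separator.≈0 σ₀₁ q∈
    fixed 0F     q∈ 2F _  = Separator.≈0 σ₀₂ q∈
    fixed 1F     q∈ 0F m≢ = contradiction ≡.refl m≢
    fixed 1F     q∈ 1F _  = Separator.≈1 σ₀₁ q∈
    fixed 1F {q} q∈ 2F _  = trans (constant-along {S = S} Z {1F} {q} (⟂-proportional {linear Z} {d 0F} {d 1F} d₁∥d₀ (Separator.⟂ⁱ σ₀₂)) q∈) Z₁≈0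
    fixed 2F     q∈ 0F _  = Separator.≈0 σ₂₃ q∈
    fixed 2F     q∈ 1F m≢ = contradiction ≡.refl m≢
    fixed 2F     q∈ 2F _  = Separator.≈1 σ₀₂ q∈
    fixed 3F     q∈ 0F _  = Separator.≈1 σ₂₃ q∈
    fixed 3F     q∈ 1F m≢ = contradiction ≡.refl m≢
    fixed 3F {q} q∈ 2F _  = trans (constant-along {S = S} Z {3F} {q} (⟂-proportional {linear Z} {d 2F} {d 3F} d₃∥d₂ (Separator.⟂ʲ σ₀₂)) q∈) Z₃≈1

  -- Each coordinate is the separator of two segments, taken in cyclic order, and varies strictly
  -- inside the unit interval on the third. Hence on each axis the other two edges lie at opposite
  -- ends, which makes them skew.
  spanning⇒in-skew-edges : ∀ {S : Vector Segment 3} → StrictlySeparated S →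
    Spanning (direction (S 0F) ∷ direction (S 1F) ∷ direction (S 2F) ∷ []) → InSkewEdges S
  spanning⇒in-skew-edges {S} strict spanning-d =
    box , e , skew , Permutation.id , λ i {q} q∈ → ∈-relint (e i) {q} (fixed i q∈) (above-0 i q∈) (below-1 i q∈)
    where
    d : Fin 3 → Point
    d m = direction (S m)

    module X = StrictSeparator (strict 1F 2F (λ ()))
    module Y = StrictSeparator (strict 2F 0F (λ ()))
    module Z = StrictSeparator (strict 0F 1F (λ ()))

    f : Fin 3 → Affine
    f = X.f ∷ Y.f ∷ Z.f ∷ []

    spanning : Spanning (linear ∘ f)
    spanning u h = independent⇒spanning {linear X.f ∷ linear Y.f ∷ linear Z.f ∷ []}
      (triangular-independent {x₀ = d 0F} {d 1F} {d 2F}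
        (λ eq → X.linear≉𝟎 (spanning-d (linear X.f) λ { 0F → eq ; 1F → X.⟂ⁱ ; 2F → X.⟂ʲ })) Y.⟂ʲ Z.⟂ⁱ
        (λ eq → Y.linear≉𝟎 (spanning-d (linear Y.f) λ { 0F → Y.⟂ʲ ; 1F → eq ; 2F → Y.⟂ⁱ })) Z.⟂ʲ
        (λ eq → Z.linear≉𝟎 (spanning-d (linear Z.f) λ { 0F → Z.⟂ⁱ ; 1F → Z.⟂ʲ ; 2F → eq })))
      u λ { 0F → h 0F ; 1F → h 1F ; 2F → h 2F }

    open FromFunctionals f spanning

    e : Vector (Parallelepiped.EdgeLabel box) 3
    e = (0F , true ∷ᵥ false ∷ᵥ []ᵥ) ∷ (1F , false ∷ᵥ true ∷ᵥ []ᵥ) ∷ (2F , true ∷ᵥ false ∷ᵥ []ᵥ) ∷ []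

    free-e : ∀ i → free (e i) ≡ i
    free-e 0F = ≡.refl
    free-e 1F = ≡.refl
    free-e 2F = ≡.refl

    skew : ∀ i j → i ≢ j → Skew (Parallelepiped.edge box (e i)) (Parallelepiped.edge box (e j))
    skew i j i≢j = (λ par → i≢j (≡.trans (≡.sym (free-e i)) (≡.trans (parallel⇒same-free (e i) (e j) par) (free-e j)))) , apart i j i≢j
      where
      apart : ∀ i j → i ≢ j → ¬ (∃ λ p → p ∈ line (Parallelepiped.edge box (e i)) × p ∈ line (Parallelepiped.edge box (e j)))
      apart 0F 0F i≢j = contradiction ≡.refl i≢j
      apart 1F 1F i≢j = contradiction ≡.refl i≢j
      apart 2F 2F i≢j = contradiction ≡.refl i≢j
      apart 0F 1F _ = different-values⇒disjoint (e 0F) (e 1F) {2F} (λ ()) (λ ()) (λ ())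
      apart 1F 0F _ = different-values⇒disjoint (e 1F) (e 0F) {2F} (λ ()) (λ ()) (λ ())
      apart 0F 2F _ = different-values⇒disjoint (e 0F) (e 2F) {1F} (λ ()) (λ ()) (λ ())
      apart 2F 0F _ = different-values⇒disjoint (e 2F) (e 0F) {1F} (λ ()) (λ ()) (λ ())
      apart 1F 2F _ = different-values⇒disjoint (e 1F) (e 2F) {0F} (λ ()) (λ ()) (λ ())
      apart 2F 1F _ = different-values⇒disjoint (e 2F) (e 1F) {0F} (λ ()) (λ ()) (λ ())

    fixed : ∀ i {q} → q ∈ ⟦ S i ⟧ → ∀ m → m ≢ free (e i) → f m · q ≈ bit (value (e i) m)
    fixed 0F q∈ 0F m≢ = contradiction ≡.refl m≢
    fixed 0F q∈ 1F _  = Y.≈1 q∈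
    fixed 0F q∈ 2F _  = Z.≈0 q∈
    fixed 1F q∈ 0F _  = X.≈0 q∈
    fixed 1F q∈ 1F m≢ = contradiction ≡.refl m≢
    fixed 1F q∈ 2F _  = Z.≈1 q∈
    fixed 2F q∈ 0F _  = X.≈1 q∈
    fixed 2F q∈ 1F _  = Y.≈0 q∈
    fixed 2F q∈ 2F m≢ = contradiction ≡.refl m≢

    above-0 : ∀ i {q} → q ∈ ⟦ S i ⟧ → 0# < f (free (e i)) · q
    above-0 0F q∈ = positive (X.≥0 0F q∈) (X.≉0 (λ ()) q∈)
    above-0 1F q∈ = positive (Y.≥0 1F q∈) (Y.≉0 (λ ()) q∈)
    above-0 2F q∈ = positive (Z.≥0 2F q∈) (Z.≉0 (λ ()) q∈)

    below-1 : ∀ i {q} → q ∈ ⟦ S i ⟧ → f (free (e i)) · q < 1#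
    below-1 0F q∈ = 0≤y-x⇒x≤y (X.≤1 0F q∈) , X.≉1 (λ ()) q∈
    below-1 1F q∈ = 0≤y-x⇒x≤y (Y.≤1 1F q∈) , Y.≉1 (λ ()) q∈
    below-1 2F q∈ = 0≤y-x⇒x≤y (Z.≤1 2F q∈) , Z.≉1 (λ ()) q∈

  -- Every direction is `c k` times `d`, and `K` bounds all `c k` in absolute value. Translating
  -- each source by `K ⊙ d` in both directions gives an edge long enough for its segment, with the
  -- same translation for all three.
  parallel⇒in-lateral-edges : ∀ {S : Vector Segment 3} → Separated S →
    (∀ k → Proportional (direction (S k)) (direction (S 0F))) → InLateralEdgesOfPrism S
  parallel⇒in-lateral-edges {S} sep parallel = prism , Permutation.id , λ i {q} q∈ → inside i {q} q∈
    where
    d = direction (S 0F)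

    c : Fin 3 → Carrier
    c k = proj₁ (parallel k)

    bound = common-bound c
    K = proj₁ bound

    K>0 : Positive K
    K>0 = proj₁ (proj₂ bound)

    2K>0 : Positive (K + K)
    2K>0 = +-positive K>0 (proj₁ K>0)

    base : Vector Point 3
    base k = source (S k) ⊖ K ⊙ d

    translation : Point
    translation = (K + K) ⊙ d

    frame : Vector Point 3
    frame = (base 1F ⊖ base 0F) ∷ (base 2F ⊖ base 0F) ∷ translation ∷ []

    frame-independent : LinearlyIndependent frame
    frame-independent w eq = λ
      { 0F → all 0F ; 1F → all 1F
      ; 2F → x*y≈0⇒y≈0 (Positive⇒≉0 2K>0) (trans (*-comm _ _) (all 2F)) }
      where
      -- Shifting all sources by the same vector preserves their differences, so only the last
      -- weight changes, by the factor from `translation`.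
      all : ∀ i → (w 0F ∷ w 1F ∷ w 2F * (K + K) ∷ []) i ≈ 0#
      all = parallel-independent {S = S} sep {0F} {1F} {2F} (λ ()) (λ ()) (λ ()) (parallel 1F) (parallel 2F) _ λ k → trans
        (solve 8 (λ x y z K a b s d → x :* (b :- a) :+ (y :* (s :- a) :+ (z :* (K :+ K) :* d :+ :0))
             := x :* (b :- K :* d :- (a :- K :* d)) :+ (y :* (s :- K :* d :- (a :- K :* d)) :+ (z :* ((K :+ K) :* d) :+ :0)))
          refl (w 0F) (w 1F) (w 2F) K (source (S 0F) k) (source (S 1F) k) (source (S 2F) k) (d k)) (eq k)

    prism : TriangularPrism
    prism = record { base = base ; translation = translation ; independent = frame-independent }

    inside : ∀ i → ⟦ S i ⟧ ⊆ ⟦ TriangularPrism.lateralEdge prism i ⟧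
    inside i {q} (t , 0≤t , t≤1 , q≋) = s , 0≤s , s≤1 , position
      where
      i₂ = inverse-positive 2K>0
      J = proj₁ i₂

      J-inverse : (K + K) * J ≈ 1#
      J-inverse = proj₂ (proj₂ i₂)

      0≤J : 0# ≤ J
      0≤J = proj₁ (proj₁ (proj₂ i₂))

      -- The parameter `t` gives the point `t * c i` in units of `d` from the source, in an edge
      -- that runs from `- K` to `K`; `J` is the reciprocal of its length.
      s = J * (K + t * c i)

      0≤1-t : 0# ≤ 1# - t
      0≤1-t = x≤y⇒0≤y-x t≤1

      0≤s : 0# ≤ s
      0≤s = *-nonneg 0≤J (0≤-cong (solve 3 (λ K t c → (:1 :- t) :* K :+ t :* (K :+ c) := K :+ t :* c) refl K t (c i))
        (+-nonneg (*-nonneg 0≤1-t (proj₁ K>0)) (*-nonneg 0≤t (proj₂ (proj₂ (proj₂ bound) i)))))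

      s≤1 : s ≤ 1#
      s≤1 = 0≤y-x⇒x≤y (0≤-cong (begin
        J * ((1# - t) * K + t * (K - c i))
          ≈⟨ solve 4 (λ J K t c → J :* ((:1 :- t) :* K :+ t :* (K :- c)) := (K :+ K) :* J :- J :* (K :+ t :* c)) refl J K t (c i) ⟩
        (K + K) * J - s
          ≈⟨ +-congʳ J-inverse ⟩
        1# - s ∎)
        (*-nonneg 0≤J (+-nonneg (*-nonneg 0≤1-t (proj₁ K>0)) (*-nonneg 0≤t (proj₁ (proj₂ (proj₂ bound) i))))))

      position : q ≋ at (TriangularPrism.lateralEdge prism i) s
      position k = begin
        q k
          ≈⟨ q≋ k ⟩
        (1# - t) * a + t * b
          ≈⟨ solve 3 (λ t a b → (:1 :- t) :* a :+ t :* b := a :+ t :* (b :- a)) refl t a b ⟩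
        a + t * (b - a)
          ≈⟨ +-congˡ (*-congˡ (proj₂ (parallel i) k)) ⟩
        a + t * (c i * d k)
          ≈⟨ solve 5 (λ a t c d K → a :+ t :* (c :* d) := a :- K :* d :+ :1 :* (K :+ t :* c) :* d) refl a t (c i) (d k) K ⟩
        a - K * d k + 1# * (K + t * c i) * d k
          ≈⟨ +-congˡ (*-congʳ (*-congʳ (sym J-inverse))) ⟩
        a - K * d k + (K + K) * J * (K + t * c i) * d k
          ≈⟨ solve 5 (λ a J K r d → a :- K :* d :+ (K :+ K) :* J :* r :* d
                 := (:1 :- J :* r) :* (a :- K :* d) :+ J :* r :* (a :- K :* d :+ (K :+ K) :* d)) refl a J K (K + t * c i) (d k) ⟩
        at (TriangularPrism.lateralEdge prism i) s k ∎
        where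
        a = source (S i) k
        b = target (S i) k

-- The cardinality bounds and the case distinction by the directions.

module Counting (ℝ : Reals) where

  open Reals ℝ hiding (zero)
  open Geometry ℝ
  open Segment
  open OrderedField ℝ
  open LinearAlgebra ℝ
  open Separation ℝ
  open Affine
  open Directions ℝ
  open Classification ℝ
  open Constructions ℝ

  parallel-or-not : ∀ {n} (S : Vector Segment (suc n)) →
    (∀ k → Proportional (direction (S k)) (direction (S zero))) ⊎
    ∃ λ j → LinearlyIndependent (direction (S zero) ∷ direction (S j) ∷ [])
  parallel-or-not S = split (λ k → Sum.swap (independent⊎proportional (d zero) (d k) (direction≉𝟎 (S zero))))
    where
    d = λ k → direction (S k)

    split : ∀ {n} {P Q : Fin n → Set} → (∀ k → P k ⊎ Q k) → (∀ k → P k) ⊎ ∃ Q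
    split {zero}  h = inj₁ λ ()
    split {suc n} {P} h with h zero | split (h ∘ suc)
    ... | inj₂ q | _            = inj₂ (zero , q)
    ... | inj₁ _ | inj₂ (k , q) = inj₂ (suc k , q)
    ... | inj₁ p | inj₁ ps      = inj₁ λ { zero → p ; (suc k) → ps k }

  not-self-independent : ∀ {a} → ¬ LinearlyIndependent (a ∷ a ∷ [])
  not-self-independent {a} indep = independent⇒¬proportional {a} {a} indep (1# , λ k → sym (*-identityˡ (a k)))

  -- The presence of a fourth segment excludes that the first three directions span, so they are
  -- coplanar.
  two-classes : ∀ {S : Vector Segment 4} (sep : Separated S) →
    let d = λ m → direction (S m) ; f = Separator.f (sep 0F 1F (λ ())) in
    LinearlyIndependent (d 0F ∷ d 1F ∷ []) →
    (Proportional (d 2F) (d 0F) × f · source (S 2F) ≈ 0#) ⊎ (Proportional (d 2F) (d 1F) × f · source (S 2F) ≈ 1#)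
  two-classes {S} sep indep = [ (λ spanning → ⊥-elim (no-four-spanning sep spanning))
                              , coplanar⇒parallel sep {0F} {1F} {2F} (λ ()) (λ ()) (λ ()) indep ]′
    (spanning? (direction (S 0F) ∷ direction (S 1F) ∷ direction (S 2F) ∷ []))

  -- Two more segments in one class would make three parallel segments in a plane on which `f` is
  -- constant.
  same-class : ∀ {n} {S : Vector Segment n} (sep : Separated S) {i j k l} (i≢j : i ≢ j) → i ≢ k → i ≢ l → j ≢ k → j ≢ l → k ≢ l →
    let d = λ m → direction (S m) ; f = Separator.f (sep i j i≢j)
        Class = λ m → (Proportional (d m) (d i) × f · source (S m) ≈ 0#) ⊎ (Proportional (d m) (d j) × f · source (S m) ≈ 1#) in
    Class k → Class l →
    ((Proportional (d k) (d i) × f · source (S k) ≈ 0#) × (Proportional (d l) (d j) × f · source (S l) ≈ 1#)) ⊎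
    ((Proportional (d k) (d j) × f · source (S k) ≈ 1#) × (Proportional (d l) (d i) × f · source (S l) ≈ 0#))
  same-class {S = S} sep {i} {j} {k} {l} i≢j i≢k i≢l j≢k j≢l k≢l = λ where
      (inj₁ x)           (inj₂ y)           → inj₁ (x , y)
      (inj₂ x)           (inj₁ y)           → inj₂ (x , y)
      (inj₁ (k∥i , fk))  (inj₁ (l∥i , fl))  → ⊥-elim (no-three-coplanar {S = S} sep i≢k i≢l k≢l k∥i l∥i {f} linear≉𝟎 ⟂ⁱ
        (trans fk (sym source≈0)) (trans fl (sym source≈0)))
      (inj₂ (k∥j , fk))  (inj₂ (l∥j , fl))  → ⊥-elim (no-three-coplanar {S = S} sep j≢k j≢l k≢l k∥j l∥j {f} linear≉𝟎 ⟂ʲ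
        (trans fk (sym source≈1)) (trans fl (sym source≈1)))
    where open Separator (sep i j i≢j)

  along : ∀ {m n} {S : Vector Segment n} → Separated S → (ι : Fin m → Fin n) → (∀ i j → ι i ≡ ι j → i ≡ j) → Separated (S ∘ ι)
  along {S = S} sep ι inj = restrict {S = S} ι (inj _ _) sep

  along-strict : ∀ {m n} {S : Vector Segment n} → StrictlySeparated S → (ι : Fin m → Fin n) → (∀ i j → ι i ≡ ι j → i ≡ j) →
                 StrictlySeparated (S ∘ ι)
  along-strict {S = S} sep ι inj = restrict-strict {S = S} ι (inj _ _) sep

  -- With a nonparallel pair, the three other segments fall into two classes, each of which admits
  -- only one more segment.
  no-five : ∀ {S : Vector Segment 5} → Separated S → ⊥
  no-five {S} sep = [ no-five-parallel sep , (λ (j , indep) → by-partner j indep) ]′ (parallel-or-not S)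
    where
    partner-1 : ∀ {S : Vector Segment 5} → Separated S →
      ¬ LinearlyIndependent (direction (S 0F) ∷ direction (S 1F) ∷ [])
    partner-1 {S} sep indep = clash
        (same-class {S = S} sep {0F} {1F} {2F} {3F} (λ ()) (λ ()) (λ ()) (λ ()) (λ ()) (λ ()) class₂ class₃)
        (same-class {S = S} sep {0F} {1F} {2F} {4F} (λ ()) (λ ()) (λ ()) (λ ()) (λ ()) (λ ()) class₂ class₄)
        (same-class {S = S} sep {0F} {1F} {3F} {4F} (λ ()) (λ ()) (λ ()) (λ ()) (λ ()) (λ ()) class₃ class₄)
      where
      ι₂ ι₃ ι₄ : Vector (Fin 5) 4
      ι₂ = 0F ∷ 1F ∷ 2F ∷ 3F ∷ []
      ι₃ = 0F ∷ 1F ∷ 3F ∷ 2F ∷ []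
      ι₄ = 0F ∷ 1F ∷ 4F ∷ 2F ∷ []

      class₂ = two-classes (along {S = S} sep ι₂ (from-yes (injective? ι₂))) indep
      class₃ = two-classes (along {S = S} sep ι₃ (from-yes (injective? ι₃))) indep
      class₄ = two-classes (along {S = S} sep ι₄ (from-yes (injective? ι₄))) indep

      distinct : ∀ {P Q : Set} {x} → P × x ≈ 0# → Q × x ≈ 1# → ⊥
      distinct (_ , x≈0) (_ , x≈1) = 1≉0 (trans (sym x≈1) x≈0)

      clash : ∀ {A₂ A₃ A₄ B₂ B₃ B₄ : Set} {x₂ x₃ x₄} →
        ((A₂ × x₂ ≈ 0#) × (B₃ × x₃ ≈ 1#)) ⊎ ((B₂ × x₂ ≈ 1#) × (A₃ × x₃ ≈ 0#)) →
        ((A₂ × x₂ ≈ 0#) × (B₄ × x₄ ≈ 1#)) ⊎ ((B₂ × x₂ ≈ 1#) × (A₄ × x₄ ≈ 0#)) →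
        ((A₃ × x₃ ≈ 0#) × (B₄ × x₄ ≈ 1#)) ⊎ ((B₃ × x₃ ≈ 1#) × (A₄ × x₄ ≈ 0#)) → ⊥
      clash (inj₁ (a₂ , b₃)) (inj₁ (_ , b₄))  (inj₁ (a₃ , _)) = distinct a₃ b₃
      clash (inj₁ (a₂ , b₃)) (inj₁ (_ , b₄))  (inj₂ (_ , a₄)) = distinct a₄ b₄
      clash (inj₁ (a₂ , _))  (inj₂ (b₂ , _))  _               = distinct a₂ b₂
      clash (inj₂ (b₂ , _))  (inj₁ (a₂ , _))  _               = distinct a₂ b₂
      clash (inj₂ (_ , a₃))  (inj₂ (_ , a₄))  (inj₁ (_ , b₄)) = distinct a₄ b₄
      clash (inj₂ (_ , a₃))  (inj₂ (_ , a₄))  (inj₂ (b₃ , _)) = distinct a₃ b₃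

    by-partner : ∀ j → ¬ LinearlyIndependent (direction (S 0F) ∷ direction (S j) ∷ [])
    by-partner 0F = not-self-independent {direction (S 0F)}
    by-partner 1F = partner-1 sep
    by-partner 2F = partner-1 (along {S = S} sep ι (from-yes (injective? ι)))
      where ι = 0F ∷ 2F ∷ 1F ∷ 3F ∷ 4F ∷ []
    by-partner 3F = partner-1 (along {S = S} sep ι (from-yes (injective? ι)))
      where ι = 0F ∷ 3F ∷ 1F ∷ 2F ∷ 4F ∷ []
    by-partner 4F = partner-1 (along {S = S} sep ι (from-yes (injective? ι)))
      where ι = 0F ∷ 4F ∷ 1F ∷ 2F ∷ 3F ∷ []

  -- Both four-segment configurations place a further segment in one of the two planes of some
  -- separator: by its class when there is a nonparallel pair, by `corner` when all are parallel.
  no-four-strict : ∀ {S : Vector Segment 4} → StrictlySeparated S → ⊥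
  no-four-strict {S} strict = [ all-parallel , (λ (j , indep) → by-partner j indep) ]′ (parallel-or-not S)
    where
    sep = strictly-separated⇒separated {S = S} strict

    partner-1 : ∀ {S : Vector Segment 4} → StrictlySeparated S →
      ¬ LinearlyIndependent (direction (S 0F) ∷ direction (S 1F) ∷ [])
    partner-1 {S} strict indep = [ (λ (_ , eq) → ≉0 {2F} (λ ()) (source-∈ (S 2F)) eq) , (λ (_ , eq) → ≉1 {2F} (λ ()) (source-∈ (S 2F)) eq) ]′
      (two-classes (strictly-separated⇒separated {S = S} strict) indep)
      where open StrictSeparator (strict 0F 1F (λ ()))

    by-partner : ∀ j → ¬ LinearlyIndependent (direction (S 0F) ∷ direction (S j) ∷ [])
    by-partner 0F = not-self-independent {direction (S 0F)}
    by-partner 1F = partner-1 strict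
    by-partner 2F = partner-1 (along-strict {S = S} strict ι (from-yes (injective? ι)))
      where ι = 0F ∷ 2F ∷ 1F ∷ 3F ∷ []
    by-partner 3F = partner-1 (along-strict {S = S} strict ι (from-yes (injective? ι)))
      where ι = 0F ∷ 3F ∷ 1F ∷ 2F ∷ []

    all-parallel : (∀ k → Proportional (direction (S k)) (direction (S 0F))) → ⊥
    all-parallel parallel =
      [ excluded {2F} {1F} {3F} (λ ()) (λ ())
      , [ excluded {1F} {2F} {3F} (λ ()) (λ ()) , excluded {1F} {3F} {2F} (λ ()) (λ ()) ]′ ]′
      (Parallel.parallelogram sep parallel)
      where
      excluded : ∀ {b c e} (0≢b : 0F ≢ b) → e ≢ 0F → ¬ Diagonals (λ m → source (S m)) (direction (S 0F)) 0F c b e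
      excluded {b} {c} {e} 0≢b e≢0 D = ≉0 e≢0 (source-∈ (S e)) (proj₁ (corner {S = S} {0F} {b} {c} {e} separator (D f ⟂ⁱ)))
        where open StrictSeparator (strict 0F b 0≢b)

  -- The reorderings used are involutions, so each serves as its own inverse.
  rearrange : ∀ {m n} {S : Vector Segment n} {T : Vector PointSet m} (ι : Fin n → Fin n) → (∀ i → ι (ι i) ≡ i) →
              OneInEach (S ∘ ι) T → OneInEach S T
  rearrange {S = S} {T} ι ι∘ι (π , inside) = Permutation.permutation ι ι ι∘ι ι∘ι Permutation.∘ₚ π ,
    λ i p∈ → inside (ι i) (≡.subst (λ j → _ ∈ ⟦ S j ⟧) (≡.sym (ι∘ι i)) p∈)

  involutive? : ∀ {n} (ι : Fin n → Fin n) → Dec (∀ i → ι (ι i) ≡ i)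
  involutive? ι = Fin.all? λ i → ι (ι i) Fin.≟ i

  -- The first two edges of an `InEdgesOfOppositeFaces` configuration share a face, so a nonparallel
  -- partner of `0F` is moved to position `2F`, and the others are then sorted into the two classes.
  four⇒configuration : ∀ {S : Vector Segment 4} → Separated S → InFourParallelEdges S ⊎ InEdgesOfOppositeFaces S
  four⇒configuration {S} sep = [ (λ par → inj₁ (all-parallel par)) , (λ (j , indep) → inj₂ (by-partner j indep)) ]′ (parallel-or-not S)
    where
    rearrange₁ : ∀ {S : Vector Segment 4} ι → (∀ i → ι (ι i) ≡ i) → InFourParallelEdges (S ∘ ι) → InFourParallelEdges S
    rearrange₁ {S} ι ι∘ι (Q , e , inj , par , inside) =
      Q , e , inj , par , rearrange {S = S} {λ i → ⟦ Parallelepiped.edge Q (e i) ⟧} ι ι∘ι inside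

    rearrange₂ : ∀ {S : Vector Segment 4} ι → (∀ i → ι (ι i) ≡ i) → InEdgesOfOppositeFaces (S ∘ ι) → InEdgesOfOppositeFaces S
    rearrange₂ {S} ι ι∘ι (Q , e , k , b , inj , faces , faces′ , par , par′ , nonpar , inside) =
      Q , e , k , b , inj , faces , faces′ , par , par′ , nonpar , rearrange {S = S} {λ i → ⟦ Parallelepiped.edge Q (e i) ⟧} ι ι∘ι inside

    ι₁₂ ι₂₃ ι₁₃ : Vector (Fin 4) 4
    ι₁₂ = 0F ∷ 2F ∷ 1F ∷ 3F ∷ []
    ι₂₃ = 0F ∷ 1F ∷ 3F ∷ 2F ∷ []
    ι₁₃ = 0F ∷ 3F ∷ 2F ∷ 1F ∷ []

    all-parallel : (∀ k → Proportional (direction (S k)) (direction (S 0F))) → InFourParallelEdges S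
    all-parallel parallel = by-diagonals (Parallel.parallelogram sep parallel)
      where
      D : (a c b e : Fin 4) → Set
      D = Diagonals (λ m → source (S m)) (direction (S 0F))

      by-diagonals : D 0F 1F 2F 3F ⊎ D 0F 2F 1F 3F ⊎ D 0F 3F 1F 2F → InFourParallelEdges S
      by-diagonals (inj₁ diagonals)        = parallelogram⇒in-four-parallel-edges sep parallel diagonals
      by-diagonals (inj₂ (inj₁ diagonals)) = rearrange₁ {S} ι₁₂ (from-yes (involutive? ι₁₂))
        (parallelogram⇒in-four-parallel-edges (along {S = S} sep ι₁₂ (from-yes (injective? ι₁₂)))
          (λ { 0F → parallel 0F ; 1F → parallel 2F ; 2F → parallel 1F ; 3F → parallel 3F }) diagonals)
      by-diagonals (inj₂ (inj₂ diagonals)) = rearrange₁ {S} ι₁₃ (from-yes (involutive? ι₁₃))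
        (parallelogram⇒in-four-parallel-edges (along {S = S} sep ι₁₃ (from-yes (injective? ι₁₃)))
          (λ { 0F → parallel 0F ; 1F → parallel 3F ; 2F → parallel 2F ; 3F → parallel 1F })
          λ f f⟂ → trans (diagonals f f⟂) (+-comm _ _))

    partner-2 : ∀ {S : Vector Segment 4} → Separated S →
      LinearlyIndependent (direction (S 0F) ∷ direction (S 2F) ∷ []) → InEdgesOfOppositeFaces S
    partner-2 {S} sep indep =
      [ (λ ((1∥0 , f₁) , (3∥2 , f₃)) → two-directions⇒in-opposite-faces sep indep 1∥0 3∥2 f₁ f₃)
      , (λ ((1∥2 , f₁) , (3∥0 , f₃)) → rearrange₂ {S} ι₁₃ (from-yes (involutive? ι₁₃))
          (two-directions⇒in-opposite-faces (along {S = S} sep ι₁₃ (from-yes (injective? ι₁₃))) indep 3∥0 1∥2 f₃ f₁)) ]′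
      (same-class {S = S} sep {0F} {2F} {1F} {3F} (λ ()) (λ ()) (λ ()) (λ ()) (λ ()) (λ ())
        (two-classes (along {S = S} sep ι₁ (from-yes (injective? ι₁))) indep)
        (two-classes (along {S = S} sep ι₃ (from-yes (injective? ι₃))) indep))
      where
      ι₁ ι₃ : Vector (Fin 4) 4
      ι₁ = 0F ∷ 2F ∷ 1F ∷ 3F ∷ []
      ι₃ = 0F ∷ 2F ∷ 3F ∷ 1F ∷ []

    by-partner : ∀ j → LinearlyIndependent (direction (S 0F) ∷ direction (S j) ∷ []) → InEdgesOfOppositeFaces S
    by-partner 0F indep = contradiction indep (not-self-independent {direction (S 0F)})
    by-partner 1F indep = rearrange₂ {S} ι₁₂ (from-yes (involutive? ι₁₂)) (partner-2 (along {S = S} sep ι₁₂ (from-yes (injective? ι₁₂))) indep)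
    by-partner 2F indep = partner-2 sep indep
    by-partner 3F indep = rearrange₂ {S} ι₂₃ (from-yes (involutive? ι₂₃)) (partner-2 (along {S = S} sep ι₂₃ (from-yes (injective? ι₂₃))) indep)

  -- If some pair is not parallel, coplanar directions would put the third segment into one of the
  -- planes of that pair, against strictness. Thus the directions are all parallel or span.
  three⇒configuration : ∀ {S : Vector Segment 3} → StrictlySeparated S → InLateralEdgesOfPrism S ⊎ InSkewEdges S
  three⇒configuration {S} strict = [ (λ par → inj₁ (parallel⇒in-lateral-edges sep par)) , (λ (j , indep) → inj₂ (by-partner j indep)) ]′
    (parallel-or-not S)
    where
    sep = strictly-separated⇒separated {S = S} strict

    d : Fin 3 → Point
    d m = direction (S m)

    not-coplanar : ∀ {j k} → (0≢j : 0F ≢ j) → k ≢ 0F → k ≢ j → LinearlyIndependent (d 0F ∷ d j ∷ []) → Spanning (d 0F ∷ d j ∷ d k ∷ [])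
    not-coplanar {j} {k} 0≢j k≢0 k≢j indep = [ (λ spanning → spanning) , (λ coplanar → ⊥-elim
        ([ (λ (_ , eq) → ≉0 k≢0 (source-∈ (S k)) eq) , (λ (_ , eq) → ≉1 k≢j (source-∈ (S k)) eq) ]′
          (coplanar⇒parallel {S = S} sep 0≢j (k≢0 ∘ ≡.sym) (k≢j ∘ ≡.sym) indep coplanar))) ]′
      (spanning? (d 0F ∷ d j ∷ d k ∷ []))
      where open StrictSeparator (strict 0F j 0≢j)

    by-partner : ∀ j → LinearlyIndependent (d 0F ∷ d j ∷ []) → InSkewEdges S
    by-partner 0F indep = contradiction indep (not-self-independent {d 0F})
    by-partner 1F indep = spanning⇒in-skew-edges strict (not-coplanar {1F} {2F} (λ ()) (λ ()) (λ ()) indep)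
    by-partner 2F indep = spanning⇒in-skew-edges strict λ u h →
      not-coplanar {2F} {1F} (λ ()) (λ ()) (λ ()) indep u λ { 0F → h 0F ; 1F → h 2F ; 2F → h 1F }

open import Data.Nat.Base using (_≤_)

theorem4p1 : (ℝ : Reals) → let open Geometry ℝ in
    (n : ℕ) (S : Vector Segment n) → Distinct S → AffinelySpanning S →
    (Antipodal S → n ≤ 4)
    × (StrictlyAntipodal S → n ≤ 3)
    × ((Antipodal S × n ≡ 4) ⇔ (InFourParallelEdges S ⊎ InEdgesOfOppositeFaces S))
    × ((StrictlyAntipodal S × n ≡ 3) ⇔ (InLateralEdgesOfPrism S ⊎ InSkewEdges S))
theorem4p1 ℝ n S _ _ = at-most-four , at-most-three , mk⇔ four⇒ ⇒four , mk⇔ three⇒ ⇒three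
  where
  open Geometry ℝ
  open Separation ℝ
  open Converse ℝ
  open Counting ℝ

  at-most-four : Antipodal S → n ≤ 4
  at-most-four anti = ℕ.≮⇒≥ λ 5≤n → no-five
    (restrict {S = S} (λ i → inject≤ i 5≤n) (Fin.inject≤-injective 5≤n 5≤n _ _) (antipodal⇒separated {S = S} anti))

  at-most-three : StrictlyAntipodal S → n ≤ 3
  at-most-three anti = ℕ.≮⇒≥ λ 4≤n → no-four-strict
    (restrict-strict {S = S} (λ i → inject≤ i 4≤n) (Fin.inject≤-injective 4≤n 4≤n _ _) (strictly-antipodal⇒strictly-separated {S = S} anti))

  four⇒ : Antipodal S × n ≡ 4 → InFourParallelEdges S ⊎ InEdgesOfOppositeFaces S
  four⇒ (anti , ≡.refl) = four⇒configuration (antipodal⇒separated {S = S} anti)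

  ⇒four : InFourParallelEdges S ⊎ InEdgesOfOppositeFaces S → Antipodal S × n ≡ 4
  -- The number of segments is read off from the bijection with the four edges.
  ⇒four (inj₁ config@(_ , _ , _ , _ , π , _)) =
    separated⇒antipodal {S = S} (in-four-parallel-edges⇒separated {S = S} config) , ↔⇒≡ π
  ⇒four (inj₂ config@(_ , _ , _ , _ , _ , _ , _ , _ , _ , _ , π , _)) =
    separated⇒antipodal {S = S} (in-edges-of-opposite-faces⇒separated {S = S} config) , ↔⇒≡ π

  three⇒ : StrictlyAntipodal S × n ≡ 3 → InLateralEdgesOfPrism S ⊎ InSkewEdges S
  three⇒ (anti , ≡.refl) = three⇒configuration (strictly-antipodal⇒strictly-separated {S = S} anti)

  ⇒three : InLateralEdgesOfPrism S ⊎ InSkewEdges S → StrictlyAntipodal S × n ≡ 3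
  ⇒three (inj₁ config@(_ , π , _)) =
    strictly-separated⇒strictly-antipodal {S = S} (in-lateral-edges⇒strictly-separated {S = S} config) , ↔⇒≡ π
  ⇒three (inj₂ config@(_ , _ , _ , π , _)) =
    strictly-separated⇒strictly-antipodal {S = S} (in-skew-edges⇒strictly-separated {S = S} config) , ↔⇒≡ π
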